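{- For any connected graph $G$ and any integer $r\ge 0$, $$t(L(S_r(G)))=\prod_{v\in V(G)}d(v)^{d(v)-2}\sum_{E'\subseteq E(G)}t(G[E'])\,r^{|E'|-|V(G)|+1}\prod_{e\in E(G)-E'}\left(d(u_e)^{ -1}+d(v_e)^{ -1}\right),$$ where $d(v)=d_G(v)$ is the degree of $v$ in $G$ and $u_e$ and $v_e$ are the two ends of $e$.
   Context: Graphs have no loops but may have parallel edges. $V(G)$ and $E(G)$ are the vertex set and edge set of $G$; $d_G(v)$ is the number of edges of $G$ incident with $v$. $t(G)$ is the number of spanning trees of $G$ (so $t(G)=0$ if $G$ is disconnected). For $E'\subseteq E(G)$, $G[E']$ is the spanning subgraph of $G$ with vertex set $V(G)$ and edge set $E'$. $L(G)$ is the line graph of $G$: its vertices are the edges of $G$, and two distinct edges of $G$ are joined in $L(G)$ by as many edges as they have common ends (so two parallel edges of $G$ are joined by two parallel edges in $L(G)$). $S_r(G)$ is the graph obtained from $G$ by replacing each edge $e$ of $G$ by a path of length $r+1$ connecting the two ends of $e$ (so $S_0(G)=G$). For $r=0$ the sum is read with $0^0=1$, and a summand with $t(G[E'])=0$ is $0$ (note that $t(G[E'])\neq 0$ forces $|E'|\ge |V(G)|-1$), so that only the edge sets $E'$ of spanning trees of $G$ contribute. -}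

module Defs where

open import Data.Bool using (Bool; true; false)
open import Data.Fin using (Fin; zero; suc; toℕ; _↑ˡ_; _↑ʳ_; combine)
open import Data.Fin.Properties as Fin using (any?; all?)
open import Data.Fin.Subset using (Subset; inside; outside)
open import Data.Fin.Subset.Properties using (_∈?_)
open import Data.Integer as ℤ using (ℤ; +_; -[1+_])
open import Data.List using (List; []; _∷_; _++_; [_]; length; map; filter; lookup; foldr; allFin; concatMap; cartesianProduct; zip; drop)
open import Data.List.Membership.Propositional using (_∈_)
open import Data.List.Membership.DecPropositional using () renaming (_∈?_ to mem?)
open import Data.List.Membership.Propositional.Properties using (∈-lookup; ∈-map⁻)
open import Data.List.Properties using (length-map)
open import Data.List.Relation.Unary.All as All using (All; []; _∷_)
open import Data.List.Relation.Unary.All.Properties as All using (¬Any⇒All¬)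
open import Data.List.Relation.Unary.AllPairs using ([]; _∷_)
open import Data.List.Relation.Unary.Any using (here; there)
open import Data.List.Relation.Unary.Unique.Propositional using (Unique)
open import Data.List.Relation.Unary.Unique.Propositional.Properties as Unique using (allFin⁺)
open import Data.List.Relation.Unary.Unique.DecPropositional using (unique?)
open import Data.Nat as ℕ using (ℕ; zero; suc; _≤_; _<_; z≤n; s≤s; NonZero)
open import Data.Nat.Properties as ℕ using ()
open import Data.Product using (∃; _×_; _,_; proj₁; proj₂; uncurry)
open import Data.Rational as ℚ using (ℚ; 0ℚ; 1ℚ)
open import Data.Rational.Properties as ℚ using ()
open import Algebra.Definitions.RawSemiring ℚ.+-*-rawSemiring using (_^_)
open import Data.Sum using (_⊎_; inj₁; inj₂)
open import Data.Vec using ([]; _∷_)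
open import Function using (_∘_)
open import Relation.Binary.PropositionalEquality using (_≡_; _≢_; refl; sym; cong; subst)
open import Relation.Nullary using (¬_; Dec; yes; no; ¬?; contradiction)
open import Relation.Nullary.Decidable using (map′; _×-dec_; _⊎-dec_)
open import Relation.Unary using (Decidable)

-- Every edge is stored as an ordered pair of ends; the order carries no
-- meaning.  Parallel edges are repeated entries, and an edge is identified
-- by its position in the list.
record Graph : Set where
  field
    order    : ℕ
    edges    : List (Fin order × Fin order)
    loopless : All (uncurry _≢_) edges

open Graph public

V E : Graph → Set
V G = Fin (order G)
E G = Fin (length (edges G))

size : Graph → ℕ
size G = length (edges G)

end₁ end₂ : (G : Graph) → E G → V G
end₁ G e = proj₁ (lookup (edges G) e)
end₂ G e = proj₂ (lookup (edges G) e)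

Incident : (G : Graph) → V G → E G → Set
Incident G v e = v ≡ end₁ G e ⊎ v ≡ end₂ G e

incident? : (G : Graph) (v : V G) → Decidable (Incident G v)
incident? G v e = (v Fin.≟ end₁ G e) ⊎-dec (v Fin.≟ end₂ G e)

degree : (G : Graph) → V G → ℕ
degree G v = length (filter (incident? G v) (allFin (size G)))

-- An edge together with a direction of traversal.
Dart : Graph → Set
Dart G = E G × Bool

src tgt : (G : Graph) → Dart G → V G
src G (e , false) = end₁ G e
src G (e , true)  = end₂ G e
tgt G (e , false) = end₂ G e
tgt G (e , true)  = end₁ G e

data Walk (G : Graph) : V G → List (Dart G) → V G → Set where
  []  : ∀ {u} → Walk G u [] u
  _∷_ : ∀ d {ds v} → Walk G (tgt G d) ds v → Walk G (src G d) (d ∷ ds) v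

-- The graph without vertices is not connected; in particular it has no
-- spanning tree.
Connected : Graph → Set
Connected G = NonZero (order G) × (∀ u v → ∃ λ ds → Walk G u ds v)

-- Two parallel edges form a cycle of length 2; going back and forth along
-- one edge is excluded by the distinctness of the edges.
record IsCycle (G : Graph) (u : V G) (ds : List (Dart G)) : Set where
  field
    nonempty         : ds ≢ []
    closed           : Walk G u ds u
    distinctEdges    : Unique (map proj₁ ds)
    distinctVertices : Unique (map (src G) ds)

Acyclic : Graph → Set
Acyclic G = ∀ u ds → ¬ IsCycle G u ds

IsTree : Graph → Set
IsTree G = Connected G × Acyclic G

private
  unique-length : ∀ {n} (xs : List (Fin n)) → Unique xs → length xs ≤ n
  unique-length xs u = Fin.injective⇒≤ (inj xs u)
    where
    inj : ∀ {A : Set} (xs : List A) → Unique xs →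
          ∀ {i j} → lookup xs i ≡ lookup xs j → i ≡ j
    inj (x ∷ xs) (_ ∷ _)  {zero}  {zero}  _  = refl
    inj (x ∷ xs) (px ∷ _) {zero}  {suc j} eq = contradiction eq (All.lookup px (∈-lookup j))
    inj (x ∷ xs) (px ∷ _) {suc i} {zero}  eq = contradiction (sym eq) (All.lookup px (∈-lookup i))
    inj (x ∷ xs) (_ ∷ u)  {suc i} {suc j} eq = cong suc (inj xs u eq)

  anyBool? : {P : Bool → Set} → Decidable P → Dec (∃ P)
  anyBool? P? with P? false | P? true
  ... | yes p | _     = yes (false , p)
  ... | no _  | yes p = yes (true , p)
  ... | no ¬p | no ¬q = no λ { (false , p) → ¬p p ; (true , q) → ¬q q }

module _ (G : Graph) where

  walk? : ∀ u ds v → Dec (Walk G u ds v)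
  walk? u [] v = map′ (λ { refl → [] }) (λ { [] → refl }) (u Fin.≟ v)
  walk? u (d ∷ ds) v =
    map′ (λ { (refl , w) → d ∷ w }) (λ { (d ∷ w) → refl , w })
         ((u Fin.≟ src G d) ×-dec walk? (tgt G d) ds v)

  private
    anyList? : ∀ k {P : List (Dart G) → Set} → Decidable P →
               Dec (∃ λ ds → length ds ≤ k × P ds)
    anyList? zero P? =
      map′ (λ p → [] , z≤n , p) (λ { ([] , _ , p) → p }) (P? [])
    anyList? (suc k) P? =
      map′ (λ { (inj₁ p) → [] , z≤n , p
              ; (inj₂ (e , b , ds , l , p)) → (e , b) ∷ ds , s≤s l , p })
           (λ { ([] , _ , p) → inj₁ p
              ; ((e , b) ∷ ds , s≤s l , p) → inj₂ (e , b , ds , l , p) })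
           (P? [] ⊎-dec any? λ e → anyBool? λ b → anyList? k (P? ∘ ((e , b) ∷_)))

    Path : V G → List (Dart G) → V G → Set
    Path u ds v = Walk G u ds v × Unique (u ∷ map (tgt G) ds)

    cut : ∀ {x y ds v} → x ∈ y ∷ map (tgt G) ds → Path y ds v →
          ∃ λ ds′ → Path x ds′ v
    cut (here refl) p = _ , p
    cut {ds = _ ∷ _} (there i) (_ ∷ w , _ ∷ un) = cut i (w , un)

    shorten : ∀ {u ds v} → Walk G u ds v → ∃ λ ds′ → Path u ds′ v
    shorten [] = [] , [] , [] ∷ []
    shorten (d ∷ w) with shorten w
    ... | ds′ , w′ , un with mem? Fin._≟_ (src G d) (tgt G d ∷ map (tgt G) ds′)
    ...   | yes i = cut i (w′ , un)
    ...   | no ¬i = d ∷ ds′ , d ∷ w′ , ¬Any⇒All¬ _ ¬i ∷ un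

    path-length : ∀ {u ds v} → Path u ds v → length ds ≤ order G
    path-length {u} {ds} (_ , un) =
      ℕ.≤-trans (ℕ.n≤1+n _)
        (subst (λ l → suc l ≤ order G) (length-map (tgt G) ds)
               (unique-length (u ∷ map (tgt G) ds) un))

  reachable? : ∀ u v → Dec (∃ λ ds → Walk G u ds v)
  reachable? u v =
    map′ (λ { (ds , _ , w) → ds , w })
         (λ { (_ , w) → let ds′ , p = shorten w in ds′ , path-length p , proj₁ p })
         (anyList? (order G) λ ds → walk? u ds v)

  connected? : Dec (Connected G)
  connected? = ℕ.nonZero? (order G) ×-dec all? λ u → all? λ v → reachable? u v

  isCycle? : ∀ u → Decidable (IsCycle G u)
  isCycle? u ds =
    map′ (λ { (ne , w , ue , uv) → record { nonempty = ne ; closed = w ; distinctEdges = ue ; distinctVertices = uv } })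
         (λ c → let open IsCycle c in nonempty , closed , distinctEdges , distinctVertices)
         (nonempty? ds ×-dec walk? u ds u
          ×-dec unique? Fin._≟_ (map proj₁ ds)
          ×-dec unique? Fin._≟_ (map (src G) ds))
    where
    nonempty? : (ds : List (Dart G)) → Dec (ds ≢ [])
    nonempty? []      = no λ ne → ne refl
    nonempty? (_ ∷ _) = yes λ ()

  acyclic? : Dec (Acyclic G)
  acyclic? =
    map′ (λ ¬c u ds c → ¬c (u , ds , cycle-length c , c))
         (λ { ac (u , ds , _ , c) → ac u ds c })
         (¬? (any? λ u → anyList? (size G) (isCycle? u)))
    where
    cycle-length : ∀ {u ds} → IsCycle G u ds → length ds ≤ size G
    cycle-length {ds = ds} c =
      subst (_≤ size G) (length-map proj₁ ds)
            (unique-length (map proj₁ ds) (IsCycle.distinctEdges c))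

  isTree? : Dec (IsTree G)
  isTree? = connected? ×-dec acyclic?

select : {A : Set} (xs : List A) → Subset (length xs) → List A
select []       []            = []
select (x ∷ xs) (inside  ∷ S) = x ∷ select xs S
select (x ∷ xs) (outside ∷ S) = select xs S

select-All : {A : Set} {P : A → Set} {xs : List A} (S : Subset (length xs)) →
             All P xs → All P (select xs S)
select-All []            []         = []
select-All (inside  ∷ S) (px ∷ pxs) = px ∷ select-All S pxs
select-All (outside ∷ S) (px ∷ pxs) = select-All S pxs

EdgeSet : Graph → Set
EdgeSet G = Subset (size G)

-- The spanning subgraph G[E′].
spanning : (G : Graph) → EdgeSet G → Graph
spanning G E′ = record
  { order    = order G
  ; edges    = select (edges G) E′
  ; loopless = select-All E′ (loopless G)
  }

allSubsets : ∀ n → List (Subset n)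
allSubsets zero    = [ [] ]
allSubsets (suc n) = map (inside ∷_) (allSubsets n) ++ map (outside ∷_) (allSubsets n)

-- The number of spanning trees.
t : Graph → ℕ
t G = length (filter (λ E′ → isTree? (spanning G E′)) (allSubsets (size G)))

-- One edge between e and f for every triple ((e , f) , v) with e < f and v
-- a common end of e and f.
module _ (G : Graph) where

  private
    Triple : Set
    Triple = (E G × E G) × V G

  Adjacency : Triple → Set
  Adjacency ((e , f) , v) = toℕ e < toℕ f × Incident G v e × Incident G v f

  adjacency? : Decidable Adjacency
  adjacency? ((e , f) , v) =
    (toℕ e ℕ.<? toℕ f) ×-dec incident? G v e ×-dec incident? G v f

  triples : List Triple
  triples = cartesianProduct (cartesianProduct (allFin (size G)) (allFin (size G)))
                             (allFin (order G))

  L : Graph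
  L = record
    { order    = size G
    ; edges    = map proj₁ (filter adjacency? triples)
    ; loopless = All.map⁺ (All.map (λ { (e<f , _) refl → ℕ.<-irrefl refl e<f })
                                   (All.all-filter adjacency? triples))
    }

consecutive : {A : Set} → List A → List (A × A)
consecutive xs = zip xs (drop 1 xs)

module _ (r : ℕ) (G : Graph) where

  private
    V′ : Set
    V′ = Fin (order G ℕ.+ size G ℕ.* r)

  old : V G → V′
  old v = v ↑ˡ (size G ℕ.* r)

  -- The i-th of the r new vertices on the edge e.
  new : E G → Fin r → V′
  new e i = order G ↑ʳ combine e i

  pathVertices : E G → List V′
  pathVertices e = old (end₁ G e) ∷ map (new e) (allFin r) ++ [ old (end₂ G e) ]

  private
    consecutive-≢ : {A : Set} (xs : List A) → Unique xs → All (uncurry _≢_) (consecutive xs)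
    consecutive-≢ []           _                = []
    consecutive-≢ (x ∷ [])     _                = []
    consecutive-≢ (x ∷ y ∷ xs) ((x≢y ∷ _) ∷ un) = x≢y ∷ consecutive-≢ (y ∷ xs) un

    old≢new : ∀ v e i → old v ≢ new e i
    old≢new v e i eq = ℕ.<⇒≢ v<n+k (cong toℕ eq)
      where
      v<n+k : toℕ (old v) < toℕ (new e i)
      v<n+k = ℕ.≤-trans
        (subst (_< order G) (sym (Fin.toℕ-↑ˡ v _)) (Fin.toℕ<n v))
        (subst (order G ≤_) (sym (Fin.toℕ-↑ʳ (order G) _)) (ℕ.m≤m+n _ _))

    new-injective : ∀ e {i j} → new e i ≡ new e j → i ≡ j
    new-injective e {i} {j} eq =
      Fin.combine-injectiveʳ e i e j (Fin.↑ʳ-injective (order G) _ _ eq)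

    pathVertices-unique : ∀ e → Unique (pathVertices e)
    pathVertices-unique e =
      All.++⁺ (All.map⁺ (All.tabulate λ {i} _ → old≢new (end₁ G e) e i))
              ((λ eq → All.lookup (loopless G) (∈-lookup e) (Fin.↑ˡ-injective _ _ _ eq)) ∷ [])
      ∷ Unique.++⁺ (Unique.map⁺ (new-injective e) (allFin⁺ r))
                   ([] ∷ [])
                   λ { (v∈new , here refl) →
                         let i , _ , eq = ∈-map⁻ (new e) v∈new in old≢new _ e i eq }

  S : Graph
  S = record
    { order    = order G ℕ.+ size G ℕ.* r
    ; edges    = concatMap (consecutive ∘ pathVertices) (allFin (size G))
    ; loopless = All.concat⁺ (All.map⁺ {xs = allFin (size G)} (All.tabulate λ {e} _ →
                   consecutive-≢ (pathVertices e) (pathVertices-unique e)))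
    }

fromℕ : ℕ → ℚ
fromℕ n = + n ℚ./ 1

-- The inverse of 0 is taken to be 0, so that 0 ^ℤ (- 2) is 0.  For a connected
-- graph a zero degree occurs only in the one-vertex graph.
inv : ℚ → ℚ
inv q with q ℚ.≟ 0ℚ
... | yes _   = 0ℚ
... | no  q≢0 = ℚ.1/_ q {{ℚ.≢-nonZero q≢0}}

-- Integer powers, with q ^ℤ 0 = 1 for every q, including q = 0.
infixr 8 _^ℤ_
_^ℤ_ : ℚ → ℤ → ℚ
q ^ℤ (+ n)    = q ^ n
q ^ℤ -[1+ n ] = inv q ^ suc n

sumOver productOver : {A : Set} → List A → (A → ℚ) → ℚ
sumOver     xs f = foldr ℚ._+_ 0ℚ (map f xs)
productOver xs f = foldr ℚ._*_ 1ℚ (map f xs)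

syntax sumOver xs (λ x → q)     = ∑[ x ← xs ] q
syntax productOver xs (λ x → q) = ∏[ x ← xs ] q

vertices : (G : Graph) → List (V G)
vertices G = allFin (order G)

edgeSets : (G : Graph) → List (EdgeSet G)
edgeSets G = allSubsets (size G)

edgesOutside : (G : Graph) → EdgeSet G → List (E G)
edgesOutside G E′ = filter (λ e → ¬? (e ∈? E′)) (allFin (size G))

{-# OPTIONS --safe #-}
module Submission where

-- Give every edge of the barycentric subdivision of a graph H the weight d(v),
-- where v is its end in V(H).  In this weighted graph eliminate vertices by
-- star-mesh transformations: deleting x and adding w(x,a) w(x,b) / w(x) between
-- its neighbours divides the weighted number of spanning trees by w(x), the sum
-- of the weights at x.  Eliminating V(H) gives the line graph L(H); eliminating
-- E(H) instead gives H with resistance 1/d(u) + 1/d(v) on an edge uv.  For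
-- H = S_r(G) the new vertices have degree 2, so the paths that replace an edge uv
-- of G reduce in series to one edge of resistance r + 1/d(u) + 1/d(v).  The sum of
-- the weights of the spanning trees of G with these resistances is expanded
-- according to which of the edges outside a tree contribute the term r.
--
-- The weighted number of spanning trees is defined by the elimination itself (tau).
-- It does not depend on the order of elimination, and it obeys deletion and
-- contraction of an edge, which identifies it with the sum over trees.

open import Defs
open import Data.Bool using (Bool; true; false; not; _∧_; if_then_else_)
open import Data.Empty using (⊥)
open import Data.Fin as Fin using (Fin; zero; suc; toℕ; _↑ˡ_; _↑ʳ_; combine)
open import Data.Fin.Properties as Fin using ()
open import Data.Fin.Subset using (Subset; inside; outside; ∣_∣)
open import Data.Fin.Subset.Properties using (_∈?_)
open import Data.Integer as ℤ using ()
open import Data.Integer.Properties as ℤ using ()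
open import Data.List using (List; []; _∷_; _++_; [_]; length; map; filter; lookup; foldr; allFin; tabulate; concatMap; cartesianProduct)
open import Data.List.Membership.Propositional using (_∈_; lose)
open import Data.List.Membership.DecPropositional using () renaming (_∈?_ to mem?)
open import Data.List.Membership.Propositional.Properties using (∈-lookup; ∈-map⁻; ∈-map⁺; ∈-allFin; ∈-∃++; ∈-++⁺ˡ; ∈-++⁺ʳ; ∈-++⁻; ∈-concatMap⁺)
open import Data.List.Properties using (filter-some; length-map; map-++; map-∘; map-cong; length-tabulate; map-tabulate; tabulate-lookup; concatMap-cong; concatMap-map; map-concatMap; ++-assoc; map-id)
open import Data.List.Relation.Binary.Permutation.Propositional as Perm using (_↭_; ↭-sym; ↭-trans; ↭-reflexive; ↭⇒↭ₛ)
open import Data.List.Relation.Binary.Permutation.Propositional.Properties using (¬x∷xs↭[]; shift; ∈-resp-↭; ↭-length; ++-comm)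
import Data.List.Relation.Binary.Permutation.Setoid.Properties as PermSetoid
open import Data.List.Relation.Unary.All as All using (All; []; _∷_)
open import Data.List.Relation.Unary.All.Properties as All using (¬Any⇒All¬)
open import Data.List.Relation.Unary.AllPairs as AllPairs using (AllPairs; []; _∷_)
open import Data.List.Relation.Unary.AllPairs.Properties as AllPairs using ()
open import Data.List.Relation.Unary.Any using (here; there)
open import Data.List.Relation.Unary.Unique.Propositional using (Unique)
open import Data.List.Relation.Unary.Unique.Propositional.Properties as Unique using (allFin⁺)
open import Data.Nat as ℕ using (ℕ; zero; suc)
open import Data.Nat.Properties as ℕ using ()
open import Data.Nat.Coprimality as Coprime using (Coprime; 1-coprimeTo)
open import Data.Product using (∃; _×_; _,_; proj₁; proj₂; uncurry)
open import Data.Rational as ℚ using (ℚ; 0ℚ; 1ℚ; _+_; _*_; _≤_; _<_)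
open import Data.Rational.Properties as ℚ using (+-comm; +-assoc; +-identityˡ; +-identityʳ; *-comm; *-assoc; *-identityˡ; *-identityʳ; *-zeroˡ; *-zeroʳ; *-distribˡ-+)
open import Algebra.Definitions.RawSemiring ℚ.+-*-rawSemiring using (_^_)
open import Data.Rational.Solver using (module +-*-Solver)
open import Data.Sum using (_⊎_; inj₁; inj₂; swap)
open import Data.Unit using (⊤; tt)
open import Data.Vec using ([]; _∷_)
open import Function using (_∘_; id; mk⇔)
open import Relation.Binary.PropositionalEquality using (_≡_; _≢_; _≗_; refl; sym; trans; cong; cong₂; subst; setoid; module ≡-Reasoning)
open import Relation.Nullary using (¬_; Dec; yes; no; does; ¬?; contradiction)
open import Relation.Nullary.Decidable using (_⊎-dec_; does-⇔; dec-true; dec-false)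
open +-*-Solver using (solve; _:=_; _:+_; _:*_; con)

-- The weight d(v) is chosen so that the star at v has total weight d(v)^2; its mesh then joins two
-- edges at v with weight d(v) d(v) / d(v)^2 = 1, which is the multiplicity rule of the line graph.
-- The vertex in the middle of an edge uv has total weight d(u) + d(v), and this is d(u) d(v) times
-- the resistance 1/d(u) + 1/d(v). Over all edges the factors d(u) d(v) multiply to the product of
-- d(v)^d(v) over the vertices; dividing by the factors d(v)^2 of the other elimination gives the
-- exponents d(v) - 2. The product of all resistances times the weighted number of trees is the sum
-- over the trees of the product of the resistances outside the tree. In this form series reduction
-- leaves no correction factor, and E' appears as a tree together with those outside edges that
-- contribute r. Deleting edges leads to disconnected networks, where an elimination may divide by
-- zero. Since weights are nonnegative, a conductance that vanishes has only zero summands, so the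
-- convention `inv 0ℚ ≡ 0ℚ` does no harm.

private variable
  A B : Set
  n : ℕ
  P Q : Set

-- Finite sums and products over lists.

sum-cong : (xs : List A) {f g : A → ℚ} → (∀ x → x ∈ xs → f x ≡ g x) → sumOver xs f ≡ sumOver xs g
sum-cong []       h = refl
sum-cong (x ∷ xs) h = cong₂ _+_ (h x (here refl)) (sum-cong xs λ y y∈ → h y (there y∈))

sum-cong′ : (xs : List A) {f g : A → ℚ} → f ≗ g → sumOver xs f ≡ sumOver xs g
sum-cong′ xs h = sum-cong xs λ x _ → h x

sum-0 : (xs : List A) {f : A → ℚ} → (∀ x → x ∈ xs → f x ≡ 0ℚ) → sumOver xs f ≡ 0ℚ
sum-0 []       h = refl
sum-0 (x ∷ xs) h = trans (cong₂ _+_ (h x (here refl)) (sum-0 xs λ y y∈ → h y (there y∈))) (+-identityˡ 0ℚ)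

+-interchange : ∀ a b c d → (a + b) + (c + d) ≡ (a + c) + (b + d)
+-interchange = solve 4 (λ a b c d → (a :+ b) :+ (c :+ d) := (a :+ c) :+ (b :+ d)) refl

*-interchange : ∀ a b c d → (a * b) * (c * d) ≡ (a * c) * (b * d)
*-interchange = solve 4 (λ a b c d → (a :* b) :* (c :* d) := (a :* c) :* (b :* d)) refl

sum-+ : (xs : List A) (f g : A → ℚ) → sumOver xs (λ x → f x + g x) ≡ sumOver xs f + sumOver xs g
sum-+ []       f g = sym (+-identityˡ 0ℚ)
sum-+ (x ∷ xs) f g = trans (cong (f x + g x +_) (sum-+ xs f g)) (+-interchange (f x) (g x) (sumOver xs f) (sumOver xs g))

sum-*ˡ : (q : ℚ) (xs : List A) (f : A → ℚ) → sumOver xs (λ x → q * f x) ≡ q * sumOver xs f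
sum-*ˡ q []       f = sym (*-zeroʳ q)
sum-*ˡ q (x ∷ xs) f = trans (cong (q * f x +_) (sum-*ˡ q xs f)) (sym (*-distribˡ-+ q (f x) (sumOver xs f)))

sum-*ʳ : (q : ℚ) (xs : List A) (f : A → ℚ) → sumOver xs (λ x → f x * q) ≡ sumOver xs f * q
sum-*ʳ q xs f = trans (sum-cong′ xs λ x → *-comm (f x) q) (trans (sum-*ˡ q xs f) (*-comm q (sumOver xs f)))

sum-map : (xs : List A) (h : A → B) (f : B → ℚ) → sumOver (map h xs) f ≡ sumOver xs (f ∘ h)
sum-map xs h f = cong (foldr _+_ 0ℚ) (sym (map-∘ xs))

sum-++ : (xs ys : List A) (f : A → ℚ) → sumOver (xs ++ ys) f ≡ sumOver xs f + sumOver ys f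
sum-++ []       ys f = sym (+-identityˡ _)
sum-++ (x ∷ xs) ys f = trans (cong (f x +_) (sum-++ xs ys f)) (sym (+-assoc (f x) _ _))

sum-↭ : {xs ys : List A} (f : A → ℚ) → xs ↭ ys → sumOver xs f ≡ sumOver ys f
sum-↭ f Perm.refl         = refl
sum-↭ f (Perm.prep x p)   = cong (f x +_) (sum-↭ f p)
sum-↭ f (Perm.trans p q)  = trans (sum-↭ f p) (sum-↭ f q)
sum-↭ f (Perm.swap {xs} {ys} x y p) =
  trans (cong (λ s → f x + (f y + s)) (sum-↭ f p))
        (solve 3 (λ a b c → a :+ (b :+ c) := b :+ (a :+ c)) refl (f x) (f y) (sumOver ys f))

sum-swap : (xs : List A) (ys : List B) (f : A → B → ℚ) →
           sumOver xs (λ x → sumOver ys (f x)) ≡ sumOver ys (λ y → sumOver xs (λ x → f x y))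
sum-swap []       ys f = sym (sum-0 ys λ _ _ → refl)
sum-swap (x ∷ xs) ys f = trans (cong (sumOver ys (f x) +_) (sum-swap xs ys f))
                               (sym (sum-+ ys (f x) (λ y → sumOver xs (λ x′ → f x′ y))))

sum-concatMap : (xs : List A) (h : A → List B) (f : B → ℚ) →
                sumOver (concatMap h xs) f ≡ sumOver xs (λ x → sumOver (h x) f)
sum-concatMap []       h f = refl
sum-concatMap (x ∷ xs) h f = trans (sum-++ (h x) (concatMap h xs) f) (cong (sumOver (h x) f +_) (sum-concatMap xs h f))

prod-cong : (xs : List A) {f g : A → ℚ} → (∀ x → x ∈ xs → f x ≡ g x) → productOver xs f ≡ productOver xs g
prod-cong []       h = refl
prod-cong (x ∷ xs) h = cong₂ _*_ (h x (here refl)) (prod-cong xs λ y y∈ → h y (there y∈))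

prod-1 : (xs : List A) {f : A → ℚ} → (∀ x → x ∈ xs → f x ≡ 1ℚ) → productOver xs f ≡ 1ℚ
prod-1 []       h = refl
prod-1 (x ∷ xs) h = trans (cong₂ _*_ (h x (here refl)) (prod-1 xs λ y y∈ → h y (there y∈))) (*-identityˡ 1ℚ)

prod-* : (xs : List A) (f g : A → ℚ) → productOver xs (λ x → f x * g x) ≡ productOver xs f * productOver xs g
prod-* []       f g = sym (*-identityˡ 1ℚ)
prod-* (x ∷ xs) f g = trans (cong (f x * g x *_) (prod-* xs f g)) (*-interchange (f x) (g x) (productOver xs f) (productOver xs g))

prod-map : (xs : List A) (h : A → B) (f : B → ℚ) → productOver (map h xs) f ≡ productOver xs (f ∘ h)
prod-map xs h f = cong (foldr _*_ 1ℚ) (sym (map-∘ xs))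

prod-++ : (xs ys : List A) (f : A → ℚ) → productOver (xs ++ ys) f ≡ productOver xs f * productOver ys f
prod-++ []       ys f = sym (*-identityˡ _)
prod-++ (x ∷ xs) ys f = trans (cong (f x *_) (prod-++ xs ys f)) (sym (*-assoc (f x) _ _))

prod-concatMap : (xs : List A) (h : A → List B) (f : B → ℚ) →
                 productOver (concatMap h xs) f ≡ productOver xs (λ x → productOver (h x) f)
prod-concatMap []       h f = refl
prod-concatMap (x ∷ xs) h f = trans (prod-++ (h x) (concatMap h xs) f) (cong (productOver (h x) f *_) (prod-concatMap xs h f))

prod-swap : (xs : List A) (ys : List B) (f : A → B → ℚ) →
            productOver xs (λ x → productOver ys (f x)) ≡ productOver ys (λ y → productOver xs (λ x → f x y))
prod-swap []       ys f = sym (prod-1 ys λ _ _ → refl)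
prod-swap (x ∷ xs) ys f = trans (cong (productOver ys (f x) *_) (prod-swap xs ys f))
                                (sym (prod-* ys (f x) (λ y → productOver xs (λ x′ → f x′ y))))

-- Order, inverses and indicators in the rationals.

sum-nonneg : (xs : List A) {f : A → ℚ} → (∀ x → 0ℚ ≤ f x) → 0ℚ ≤ sumOver xs f
sum-nonneg []       h = ℚ.≤-refl
sum-nonneg (x ∷ xs) h = ℚ.+-mono-≤ (h x) (sum-nonneg xs h)

*-nonneg : ∀ {p q} → 0ℚ ≤ p → 0ℚ ≤ q → 0ℚ ≤ p * q
*-nonneg {p} {q} hp hq =
  ℚ.nonNegative⁻¹ (p * q) {{ℚ.nonNeg*nonNeg⇒nonNeg p {{ℚ.nonNegative hp}} q {{ℚ.nonNegative hq}}}}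

+-positive : ∀ {p q} → 0ℚ < p → 0ℚ < q → 0ℚ < p + q
+-positive = ℚ.+-mono-<

+-≡0ˡ : ∀ {p q} → 0ℚ ≤ p → 0ℚ ≤ q → p + q ≡ 0ℚ → p ≡ 0ℚ
+-≡0ˡ {p} {q} hp hq e =
  ℚ.≤-antisym (ℚ.≤-trans (ℚ.≤-reflexive (sym (+-identityʳ p))) (ℚ.≤-trans (ℚ.+-monoʳ-≤ p hq) (ℚ.≤-reflexive e))) hp

+-≡0ʳ : ∀ {p q} → 0ℚ ≤ p → 0ℚ ≤ q → p + q ≡ 0ℚ → q ≡ 0ℚ
+-≡0ʳ {p} {q} hp hq e = +-≡0ˡ hq hp (trans (+-comm q p) e)

>0⇒≢0 : ∀ {q} → 0ℚ < q → q ≢ 0ℚ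
>0⇒≢0 h e = ℚ.<⇒≢ h (sym e)

≥0∧≢0⇒>0 : ∀ {q} → 0ℚ ≤ q → q ≢ 0ℚ → 0ℚ < q
≥0∧≢0⇒>0 {q} h ne = ℚ.≰⇒> λ q≤0 → ne (ℚ.≤-antisym q≤0 h)

inv-inverseʳ : ∀ q → q ≢ 0ℚ → q * inv q ≡ 1ℚ
inv-inverseʳ q q≢0 with q ℚ.≟ 0ℚ
... | yes e   = contradiction e q≢0
... | no  ne = ℚ.*-inverseʳ q {{ℚ.≢-nonZero ne}}

*-cancelˡ : ∀ {q x y} → q ≢ 0ℚ → q * x ≡ q * y → x ≡ y
*-cancelˡ {q} {x} {y} q≢0 e = begin
  x                ≡⟨ lem x ⟩
  inv q * (q * x)  ≡⟨ cong (inv q *_) e ⟩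
  inv q * (q * y)  ≡⟨ sym (lem y) ⟩
  y                ∎
  where
  open ≡-Reasoning
  lem : ∀ z → z ≡ inv q * (q * z)
  lem z = trans (sym (*-identityˡ z)) (trans (cong (_* z) (sym (inv-inverseʳ q q≢0)))
            (solve 3 (λ a b c → a :* b :* c := b :* (a :* c)) refl q (inv q) z))

inv-unique : ∀ q i → q * i ≡ 1ℚ → inv q ≡ i
inv-unique q i e = *-cancelˡ q≢0 (trans (inv-inverseʳ q q≢0) (sym e))
  where
  q≢0 : q ≢ 0ℚ
  q≢0 refl = ℚ.1≢0 (trans (sym e) (*-zeroˡ i))

*-≢0 : ∀ {p q} → p ≢ 0ℚ → q ≢ 0ℚ → p * q ≢ 0ℚ
*-≢0 {p} {q} hp hq e = hq (*-cancelˡ hp (trans e (sym (*-zeroʳ p))))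

inv-positive : ∀ {q} → 0ℚ < q → 0ℚ < inv q
inv-positive {q} h with q ℚ.≟ 0ℚ
... | yes e  = contradiction e (>0⇒≢0 h)
... | no  ne = ℚ.positive⁻¹ _ {{ℚ.1/pos⇒pos q {{ℚ.positive h}}}}

inv-nonneg : ∀ {q} → 0ℚ ≤ q → 0ℚ ≤ inv q
inv-nonneg {q} h = go (q ℚ.≟ 0ℚ)
  where
  go : Dec (q ≡ 0ℚ) → 0ℚ ≤ inv q
  go (yes refl) = ℚ.≤-refl
  go (no  ne)   = ℚ.<⇒≤ (inv-positive (≥0∧≢0⇒>0 h ne))

𝟙 : Bool → ℚ
𝟙 true  = 1ℚ
𝟙 false = 0ℚ

𝟙-nonneg : ∀ b → 0ℚ ≤ 𝟙 b
𝟙-nonneg true  = ℚ.<⇒≤ (ℚ.positive⁻¹ 1ℚ)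
𝟙-nonneg false = ℚ.≤-refl

𝟙-∧ : ∀ a b → 𝟙 (a ∧ b) ≡ 𝟙 a * 𝟙 b
𝟙-∧ true  b = sym (*-identityˡ (𝟙 b))
𝟙-∧ false b = sym (*-zeroˡ (𝟙 b))

-- Networks and the elimination of a vertex.

Weights : Set → Set
Weights A = A → A → ℚ

record IsNetwork (W : Weights A) : Set where
  field
    symmetric : ∀ a b → W a b ≡ W b a
    nonneg    : ∀ a b → 0ℚ ≤ W a b

open IsNetwork

conductance : Weights A → A → List A → ℚ
conductance W x vs = sumOver vs (W x)

-- Off the diagonal and up to sign, this is the Schur complement of the weighted Laplacian at `x`.
-- Diagonal values are meaningless and are not read on lists of distinct vertices.
starMesh : Weights A → A → List A → Weights A
starMesh W x vs a b = W a b + W x a * W x b * inv (conductance W x vs)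

-- The weighted number of spanning trees, by elimination of the vertices in the
-- order of the list; only weights W x z with x before z are read.
tau : Weights A → List A → ℚ
tau W []               = 0ℚ
tau W (x ∷ [])         = 1ℚ
tau W (x ∷ vs@(_ ∷ _)) = conductance W x vs * tau (starMesh W x vs) vs

tau-∷ : ∀ (W : Weights A) x vs → vs ≢ [] → tau W (x ∷ vs) ≡ conductance W x vs * tau (starMesh W x vs) vs
tau-∷ W x []       ne = contradiction refl ne
tau-∷ W x (_ ∷ _)  ne = refl

starMesh-isNetwork : ∀ {W : Weights A} x vs → IsNetwork W → IsNetwork (starMesh W x vs)
starMesh-isNetwork {W = W} x vs net .symmetric a b =
  cong₂ _+_ (symmetric net a b) (cong (_* inv (conductance W x vs)) (*-comm (W x a) (W x b)))
starMesh-isNetwork {W = W} x vs net .nonneg a b =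
  ℚ.+-mono-≤ (nonneg net a b)
    (*-nonneg (*-nonneg (nonneg net x a) (nonneg net x b)) (inv-nonneg (sum-nonneg vs (nonneg net x))))

AllPairs-zip : {P : A → Set} {R : A → A → Set} {xs : List A} →
               All P xs → AllPairs R xs → AllPairs (λ a b → P a × P b × R a b) xs
AllPairs-zip []         []         = []
AllPairs-zip (px ∷ pxs) (rx ∷ rxs) = All.zipWith (λ (p , r) → px , p , r) (pxs , rx) ∷ AllPairs-zip pxs rxs

tau-cong : ∀ {W W′ : Weights A} {vs} → AllPairs (λ a b → W a b ≡ W′ a b) vs → tau W vs ≡ tau W′ vs
tau-cong {vs = []}              _        = refl
tau-cong {vs = x ∷ []}          _        = refl
tau-cong {W = W} {W′} {x ∷ vs@(_ ∷ _)} (px ∷ ps) =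
  cong₂ _*_ s≡ (tau-cong (AllPairs.map (λ (xa , xb , ab) → cong₂ _+_ ab (cong₂ _*_ (cong₂ _*_ xa xb) (cong inv s≡)))
                                       (AllPairs-zip px ps)))
  where
  s≡ : conductance W x vs ≡ conductance W′ x vs
  s≡ = sum-cong vs λ z z∈ → All.lookup px z∈

tau-cong′ : ∀ {W W′ : Weights A} vs → (∀ a b → W a b ≡ W′ a b) → tau W vs ≡ tau W′ vs
tau-cong′ vs h = tau-cong (all vs)
  where
  all : ∀ vs → AllPairs _ vs
  all []       = []
  all (x ∷ vs) = All.tabulate (λ {z} _ → h x z) ∷ all vs

tau-map : ∀ (f : A → B) (W : Weights B) vs → tau W (map f vs) ≡ tau (λ a b → W (f a) (f b)) vs
tau-map f W []                 = refl
tau-map f W (x ∷ [])           = refl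
tau-map f W (x ∷ vs@(_ ∷ _)) =
  cong₂ _*_ s≡ (trans (tau-map f (starMesh W (f x) (map f vs)) vs)
                      (tau-cong′ vs λ a b → cong (λ s → W (f a) (f b) + W (f x) (f a) * W (f x) (f b) * inv s) s≡))
  where
  s≡ : conductance W (f x) (map f vs) ≡ conductance (λ a b → W (f a) (f b)) x vs
  s≡ = sum-map vs f (W (f x))

-- Independence of the order of elimination.

private
  -- The product of the two successive conductances is a polynomial that is symmetric under exchange
  -- of the two vertices. If `w + a` is zero, nonnegativity makes `w` and `a` zero and both sides
  -- vanish.
  two-conductances : ∀ {w a b} → 0ℚ ≤ w → 0ℚ ≤ a →
                     (w + a) * (b + w * a * inv (w + a)) ≡ w * b + a * b + w * a
  two-conductances {w} {a} {b} w≥0 a≥0 = go ((w + a) ℚ.≟ 0ℚ)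
    where
    open ≡-Reasoning
    go : Dec (w + a ≡ 0ℚ) → _
    go (no s≢0) = begin
      (w + a) * (b + w * a * inv (w + a))
        ≡⟨ solve 4 (λ w a b i → (w :+ a) :* (b :+ w :* a :* i) := w :* b :+ a :* b :+ w :* a :* ((w :+ a) :* i)) refl w a b (inv (w + a)) ⟩
      w * b + a * b + w * a * ((w + a) * inv (w + a))
        ≡⟨ cong (λ u → w * b + a * b + w * a * u) (inv-inverseʳ (w + a) s≢0) ⟩
      w * b + a * b + w * a * 1ℚ
        ≡⟨ cong (w * b + a * b +_) (*-identityʳ (w * a)) ⟩
      w * b + a * b + w * a ∎
    go (yes s≡0) rewrite +-≡0ˡ w≥0 a≥0 s≡0 | +-≡0ʳ w≥0 a≥0 s≡0 =
      solve 1 (λ b → con 0ℚ :* (b :+ con 0ℚ) := con 0ℚ :* b :+ con 0ℚ :* b :+ con 0ℚ) refl b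

  -- `i * j` is the inverse of the product of the two conductances. Over this common denominator the
  -- weight left after both eliminations is symmetric in the two eliminated vertices.
  two-meshes : ∀ W xp xq yp yq w a b i j → (w + a) * i ≡ 1ℚ → (b + w * a * i) * j ≡ 1ℚ →
    W + xp * xq * i + (yp + w * xp * i) * (yq + w * xq * i) * j
      ≡ W + i * j * ((w + b) * (xp * xq) + w * (xp * yq + yp * xq) + (w + a) * (yp * yq))
  two-meshes W xp xq yp yq w a b i j h₁ h₂ = begin
    W + xp * xq * i + (yp + w * xp * i) * (yq + w * xq * i) * j
      ≡⟨ solve 10 (λ W xp xq yp yq w a b i j →
           W :+ xp :* xq :* i :+ (yp :+ w :* xp :* i) :* (yq :+ w :* xq :* i) :* j
           := W :+ xp :* xq :* i :* con 1ℚ :+ yp :* yq :* j :* con 1ℚ :+ w :* (xp :* yq :+ yp :* xq) :* i :* j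
              :+ xp :* xq :* w :* w :* i :* i :* j) refl W xp xq yp yq w a b i j ⟩
    W + xp * xq * i * 1ℚ + yp * yq * j * 1ℚ + c + d
      -- The factors 1 are expanded by the hypotheses so that every mesh term acquires the common
      -- factor `i * j`.
      ≡⟨ cong₂ (λ u v → W + xp * xq * i * u + yp * yq * j * v + c + d) (sym h₂) (sym h₁) ⟩
    W + xp * xq * i * ((b + w * a * i) * j) + yp * yq * j * ((w + a) * i) + c + d
      ≡⟨ solve 10 (λ W xp xq yp yq w a b i j →
           W :+ xp :* xq :* i :* ((b :+ w :* a :* i) :* j) :+ yp :* yq :* j :* ((w :+ a) :* i)
             :+ w :* (xp :* yq :+ yp :* xq) :* i :* j :+ xp :* xq :* w :* w :* i :* i :* j
           := W :+ i :* j :* ((w :* ((w :+ a) :* i) :+ b) :* (xp :* xq) :+ w :* (xp :* yq :+ yp :* xq) :+ (w :+ a) :* (yp :* yq)))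
           refl W xp xq yp yq w a b i j ⟩
    W + i * j * ((w * ((w + a) * i) + b) * (xp * xq) + w * (xp * yq + yp * xq) + (w + a) * (yp * yq))
      ≡⟨ cong (λ u → W + i * j * ((u + b) * (xp * xq) + w * (xp * yq + yp * xq) + (w + a) * (yp * yq)))
              (trans (cong (w *_) h₁) (*-identityʳ w)) ⟩
    W + i * j * ((w + b) * (xp * xq) + w * (xp * yq + yp * xq) + (w + a) * (yp * yq)) ∎
    where
    open ≡-Reasoning
    c = w * (xp * yq + yp * xq) * i * j
    d = xp * xq * w * w * i * i * j

  module TwoEliminations {W : Weights A} (net : IsNetwork W) (x y : A) (vs : List A) (vs≢[] : vs ≢ []) where
    w = W x y
    a = sumOver vs (W x)
    b = sumOver vs (W y)
    D = w * b + a * b + w * a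

    W₁ = starMesh W x (y ∷ vs)
    W₂ = starMesh W₁ y vs
    i = inv (w + a)

    w≥0 : 0ℚ ≤ w
    w≥0 = nonneg net x y
    a≥0 : 0ℚ ≤ a
    a≥0 = sum-nonneg vs (nonneg net x)

    s₁ : conductance W₁ y vs ≡ b + w * a * i
    s₁ = trans (sum-+ vs _ _) (cong (_+_ b) (trans (sum-*ʳ i vs _) (cong (_* i) (sum-*ˡ w vs (W x)))))

    first : tau W (x ∷ y ∷ vs) ≡ D * tau W₂ vs
    first = begin
      (w + a) * tau W₁ (y ∷ vs)                       ≡⟨ cong ((w + a) *_) (tau-∷ W₁ y vs vs≢[]) ⟩
      (w + a) * (conductance W₁ y vs * tau W₂ vs)     ≡⟨ sym (*-assoc (w + a) _ _) ⟩
      (w + a) * conductance W₁ y vs * tau W₂ vs       ≡⟨ cong (λ s → (w + a) * s * tau W₂ vs) s₁ ⟩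
      (w + a) * (b + w * a * i) * tau W₂ vs           ≡⟨ cong (_* tau W₂ vs) (two-conductances w≥0 a≥0) ⟩
      D * tau W₂ vs                                   ∎
      where open ≡-Reasoning

    second : D ≢ 0ℚ → ∀ p q → W₂ p q ≡
      W p q + inv D * ((w + b) * (W x p * W x q) + w * (W x p * W y q + W y p * W x q) + (w + a) * (W y p * W y q))
    second D≢0 p q = trans (cong (λ s → W₁ p q + W₁ y p * W₁ y q * inv s) s₁)
      (trans (two-meshes (W p q) (W x p) (W x q) (W y p) (W y q) w a b i (inv (b + w * a * i)) h₁ h₂)
             (cong (λ k → W p q + k * K) (sym (inv-unique D (i * inv (b + w * a * i)) k≡))))
      where
      K = (w + b) * (W x p * W x q) + w * (W x p * W y q + W y p * W x q) + (w + a) * (W y p * W y q)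
      sD : (w + a) * (b + w * a * i) ≡ D
      sD = two-conductances w≥0 a≥0
      h₁ : (w + a) * i ≡ 1ℚ
      h₁ = inv-inverseʳ (w + a) λ e → D≢0 (trans (sym sD) (trans (cong (_* (b + w * a * i)) e) (*-zeroˡ (b + w * a * i))))
      h₂ : (b + w * a * i) * inv (b + w * a * i) ≡ 1ℚ
      h₂ = inv-inverseʳ (b + w * a * i) λ e → D≢0 (trans (sym sD) (trans (cong ((w + a) *_) e) (*-zeroʳ (w + a))))
      k≡ : D * (i * inv (b + w * a * i)) ≡ 1ℚ
      k≡ = trans (cong (_* (i * inv (b + w * a * i))) (sym sD))
             (trans (*-interchange (w + a) (b + w * a * i) i _) (trans (cong₂ _*_ h₁ h₂) (*-identityˡ 1ℚ)))

-- If the product `D` of the two conductances is zero, both sides are zero, whatever the remaining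
-- networks are. Otherwise `second` gives both remaining networks over the same denominator, and
-- they agree entry by entry.
tau-swap : ∀ {W : Weights A} → IsNetwork W → ∀ x y vs → tau W (x ∷ y ∷ vs) ≡ tau W (y ∷ x ∷ vs)
tau-swap net x y [] = cong (λ w → (w + 0ℚ) * 1ℚ) (symmetric net x y)
tau-swap {W = W} net x y vs@(_ ∷ _) = begin
  tau W (x ∷ y ∷ vs) ≡⟨ X.first ⟩
  X.D * tau X.W₂ vs  ≡⟨ go (X.D ℚ.≟ 0ℚ) ⟩
  Y.D * tau Y.W₂ vs  ≡⟨ sym Y.first ⟩
  tau W (y ∷ x ∷ vs) ∎
  where
  open ≡-Reasoning
  module X = TwoEliminations net x y vs (λ ())
  module Y = TwoEliminations net y x vs (λ ())
  w≡ : X.w ≡ Y.w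
  w≡ = symmetric net x y
  D≡ : X.D ≡ Y.D
  D≡ = trans (cong (λ w → w * X.b + X.a * X.b + w * X.a) w≡)
             (solve 3 (λ w a b → w :* b :+ a :* b :+ w :* a := w :* a :+ b :* a :+ w :* b) refl Y.w X.a X.b)
  go : Dec (X.D ≡ 0ℚ) → X.D * tau X.W₂ vs ≡ Y.D * tau Y.W₂ vs
  go (yes e)   = trans (cong (_* tau X.W₂ vs) e) (trans (*-zeroˡ (tau X.W₂ vs))
                   (sym (trans (cong (_* tau Y.W₂ vs) (trans (sym D≡) e)) (*-zeroˡ (tau Y.W₂ vs)))))
  go (no D≢0) = cong₂ _*_ D≡ (tau-cong′ vs λ p q → trans (X.second D≢0 p q)
    (trans (cong₂ (λ w D → W p q + inv D * ((w + X.b) * (W x p * W x q) + w * (W x p * W y q + W y p * W x q) + (w + X.a) * (W y p * W y q)))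
                  w≡ D≡)
    (trans (cong (λ K → W p q + inv Y.D * K)
                 (solve 7 (λ w a b xp xq yp yq →
                    (w :+ b) :* (xp :* xq) :+ w :* (xp :* yq :+ yp :* xq) :+ (w :+ a) :* (yp :* yq)
                    := (w :+ a) :* (yp :* yq) :+ w :* (yp :* xq :+ xp :* yq) :+ (w :+ b) :* (xp :* xq))
                    refl Y.w X.a X.b (W x p) (W x q) (W y p) (W y q)))
           (sym (Y.second (λ e → D≢0 (trans D≡ e)) p q)))))

-- The conductance at the head is a sum and ignores the order of the tail. The induction hypothesis
-- ranges over all networks because eliminating the head changes the weights. Emptiness is matched
-- first since `tau` has a clause of its own for a single vertex.
tau-prep : ∀ {xs ys : List A} → xs ↭ ys → (∀ {W} → IsNetwork W → tau W xs ≡ tau W ys) →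
           ∀ {W} x → IsNetwork W → tau W (x ∷ xs) ≡ tau W (x ∷ ys)
tau-prep {xs = []}    {[]}    p ih x net = refl
tau-prep {xs = []}    {_ ∷ _} p ih x net = contradiction (↭-sym p) ¬x∷xs↭[]
tau-prep {xs = _ ∷ _} {[]}    p ih x net = contradiction p ¬x∷xs↭[]
tau-prep {xs = xs@(_ ∷ _)} {ys@(_ ∷ _)} p ih {W} x net =
  cong₂ _*_ s≡ (trans (ih (starMesh-isNetwork x xs net))
                      (tau-cong′ ys λ a b → cong (λ s → W a b + W x a * W x b * inv s) s≡))
  where
  s≡ : conductance W x xs ≡ conductance W x ys
  s≡ = sum-↭ (W x) p

tau-↭ : ∀ {W : Weights A} {xs ys} → IsNetwork W → xs ↭ ys → tau W xs ≡ tau W ys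
tau-↭ net Perm.refl         = refl
tau-↭ net (Perm.prep x p)   = tau-prep p (λ n → tau-↭ n p) x net
tau-↭ net (Perm.trans p q)  = trans (tau-↭ net p) (tau-↭ net q)
tau-↭ net (Perm.swap {xs} {ys} x y p) =
  trans (tau-swap net x y xs) (tau-prep (Perm.prep x p) (λ n → tau-prep p (λ m → tau-↭ m p) x n) y net)

-- Deletion and contraction of an edge.

∷ʳ≢[] : ∀ (xs : List A) y ys → xs ++ y ∷ ys ≢ []
∷ʳ≢[] []       y ys ()
∷ʳ≢[] (_ ∷ xs) y ys ()

-- `W⁺` is `W` with the weight of pq raised by `w`, and `W~` is `W` with `q` merged into `p`. Both
-- relations survive a star-mesh step at any other vertex `x`: the conductance at `x` is the same in
-- all three networks, and the mesh weight is linear in the weight from `x` to `p` or `q`. Hence `p`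
-- and `q` are kept to the end, where the claim reads `W p q + w` against `W p q` and a single
-- point.
tau-contract : ∀ rest (p q : A) {W W⁺ W~ : Weights A} w →
  AllPairs (λ x z → W⁺ x z ≡ W x z × W~ x z ≡ W x z) rest →
  All (λ x → W⁺ x p ≡ W x p × W⁺ x q ≡ W x q × W~ x p ≡ W x p + W x q) rest →
  W⁺ p q ≡ W p q + w →
  tau W⁺ (rest ++ p ∷ q ∷ []) ≡ tau W (rest ++ p ∷ q ∷ []) + w * tau W~ (rest ++ [ p ])
tau-contract [] p q {W} {W⁺} w _ _ h = trans (cong (λ u → (u + 0ℚ) * 1ℚ) h)
  (solve 2 (λ u w → (u :+ w :+ con 0ℚ) :* con 1ℚ := (u :+ con 0ℚ) :* con 1ℚ :+ w :* con 1ℚ) refl (W p q) w)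
tau-contract (x ∷ rest) p q {W} {W⁺} {W~} w (px ∷ ps) ((xp , xq , xpq) ∷ qs) h = begin
  tau W⁺ (x ∷ rest ++ p ∷ q ∷ [])        ≡⟨ tau-∷ W⁺ x (rest ++ p ∷ q ∷ []) ne₂ ⟩
  s⁺ * tau (starMesh W⁺ x vs) vs         ≡⟨ cong₂ _*_ s⁺≡ (tau-contract rest p q w ps′ qs′ h′) ⟩
  s * (tau (starMesh W x vs) vs + w * tau (starMesh W~ x vs~) vs~)
    ≡⟨ solve 4 (λ s t w u → s :* (t :+ w :* u) := s :* t :+ w :* (s :* u)) refl s _ w _ ⟩
  s * tau (starMesh W x vs) vs + w * (s * tau (starMesh W~ x vs~) vs~)
    ≡⟨ cong₂ _+_ (sym (tau-∷ W x vs ne₂)) (cong (w *_) (trans (cong (_* tau (starMesh W~ x vs~) vs~) (sym s~≡)) (sym (tau-∷ W~ x vs~ ne₁)))) ⟩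
  tau W (x ∷ vs) + w * tau W~ (x ∷ vs~)  ∎
  where
  open ≡-Reasoning
  vs  = rest ++ p ∷ q ∷ []
  vs~ = rest ++ [ p ]
  ne₂ = ∷ʳ≢[] rest p (q ∷ [])
  ne₁ = ∷ʳ≢[] rest p []
  s  = conductance W x vs
  s⁺ = conductance W⁺ x vs
  s~ = conductance W~ x vs~
  s⁺≡ : s⁺ ≡ s
  s⁺≡ = trans (sum-++ rest _ (W⁺ x)) (trans
    (cong₂ _+_ (sum-cong rest λ z z∈ → proj₁ (All.lookup px z∈)) (cong₂ (λ u v → u + (v + 0ℚ)) xp xq))
    (sym (sum-++ rest _ (W x))))
  s~≡ : s~ ≡ s
  s~≡ = trans (sum-++ rest _ (W~ x)) (trans
    (cong₂ _+_ (sum-cong rest λ z z∈ → proj₂ (All.lookup px z∈)) (trans (cong (_+ 0ℚ) xpq) (+-assoc (W x p) _ _)))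
    (sym (sum-++ rest _ (W x))))
  ps′ = AllPairs.map (λ { ((a⁺ , a~) , (b⁺ , b~) , ab⁺ , ab~) →
          cong₂ _+_ ab⁺ (cong₂ _*_ (cong₂ _*_ a⁺ b⁺) (cong inv s⁺≡)) ,
          cong₂ _+_ ab~ (cong₂ _*_ (cong₂ _*_ a~ b~) (cong inv s~≡)) })
        (AllPairs-zip px ps)
  qs′ = All.zipWith (λ { {a} ((a⁺ , a~) , (ap , aq , apq)) →
          cong₂ _+_ ap (cong₂ _*_ (cong₂ _*_ a⁺ xp) (cong inv s⁺≡)) ,
          cong₂ _+_ aq (cong₂ _*_ (cong₂ _*_ a⁺ xq) (cong inv s⁺≡)) ,
          trans (cong₂ _+_ apq (cong₂ _*_ (cong₂ _*_ a~ xpq) (cong inv s~≡)))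
                (solve 6 (λ u v c d e i → u :+ v :+ c :* (d :+ e) :* i := u :+ c :* d :* i :+ (v :+ c :* e :* i))
                   refl (W a p) (W a q) (W x a) (W x p) (W x q) (inv s)) })
        (px , qs)
  h′ : starMesh W⁺ x vs p q ≡ starMesh W x vs p q + w
  h′ = trans (cong₂ _+_ h (cong₂ _*_ (cong₂ _*_ xp xq) (cong inv s⁺≡)))
         (solve 3 (λ u w m → u :+ w :+ m := u :+ m :+ w) refl (W p q) w (W x p * W x q * inv s))

-- Networks given by edge lists, and their weighted trees.

δ : Fin n → Fin n → ℚ
δ p q = 𝟙 (does (p Fin.≟ q))

δ-refl : (p : Fin n) → δ p p ≡ 1ℚ
δ-refl p = cong 𝟙 (dec-true (p Fin.≟ p) refl)

δ-≢ : {p q : Fin n} → p ≢ q → δ p q ≡ 0ℚ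
δ-≢ {p = p} {q} h = cong 𝟙 (dec-false (p Fin.≟ q) h)

δ-nonneg : (p q : Fin n) → 0ℚ ≤ δ p q
δ-nonneg p q = 𝟙-nonneg (does (p Fin.≟ q))

-- The sum over both orientations makes the indicator symmetric. For a loop it is nonzero only on
-- the diagonal, so edges that contraction turns into loops drop out by themselves.
link : Fin n × Fin n → Weights (Fin n)
link (a , b) p q = δ a p * δ b q + δ a q * δ b p

link-nonneg : ∀ e (p q : Fin n) → 0ℚ ≤ link e p q
link-nonneg (a , b) p q = ℚ.+-mono-≤ (*-nonneg (δ-nonneg a p) (δ-nonneg b q)) (*-nonneg (δ-nonneg a q) (δ-nonneg b p))

link-sym : ∀ e (p q : Fin n) → link e p q ≡ link e q p
link-sym (a , b) p q = +-comm (δ a p * δ b q) (δ a q * δ b p)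

link-≢ : ∀ {a b p : Fin n} → a ≢ p → b ≢ p → ∀ q → link (a , b) p q ≡ 0ℚ
link-≢ {a = a} {b} {p} a≢p b≢p q =
  trans (cong₂ (λ u v → u * δ b q + δ a q * v) (δ-≢ a≢p) (δ-≢ b≢p))
        (solve 2 (λ x y → con 0ℚ :* x :+ y :* con 0ℚ := con 0ℚ) refl (δ b q) (δ a q))

link-loop : ∀ {a p q : Fin n} → p ≢ q → link (a , a) p q ≡ 0ℚ
link-loop {a = a} {p} {q} p≢q with a Fin.≟ p
... | no  _    = trans (cong₂ _+_ (*-zeroˡ (δ a q)) (*-zeroʳ (δ a q))) (+-identityˡ 0ℚ)
... | yes refl = trans (cong (λ u → 1ℚ * u + u * 1ℚ) (δ-≢ p≢q)) refl

link-ends : ∀ {p q : Fin n} → p ≢ q → link (p , q) p q ≡ 1ℚ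
link-ends {p = p} {q} p≢q =
  trans (cong₂ _+_ (cong₂ _*_ (δ-refl p) (δ-refl q)) (cong (_* δ q p) (δ-≢ p≢q)))
        (trans (cong (1ℚ * 1ℚ +_) (*-zeroˡ (δ q p))) refl)

network : (A → Fin n × Fin n) → (A → ℚ) → List A → Weights (Fin n)
network ends w es p q = sumOver es (λ e → w e * link (ends e) p q)

network-isNetwork : ∀ (ends : A → Fin n × Fin n) {w : A → ℚ} es → (∀ e → 0ℚ ≤ w e) → IsNetwork (network ends w es)
network-isNetwork ends {w} es w≥0 .IsNetwork.symmetric p q = sum-cong′ es λ e → cong (w e *_) (link-sym (ends e) p q)
network-isNetwork ends {w} es w≥0 .IsNetwork.nonneg p q = sum-nonneg es λ e → *-nonneg (w≥0 e) (link-nonneg (ends e) p q)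

-- `w` weights the selected elements and `y` the others. Keeping both lets one recursion express
-- trees weighted by conductances (`y` constantly 1) and by the resistances left outside (`w`
-- constantly 1).
subsetSum : List A → (List A → ℚ) → (A → ℚ) → (A → ℚ) → ℚ
subsetSum []       g w y = g []
subsetSum (x ∷ xs) g w y = w x * subsetSum xs (g ∘ (x ∷_)) w y + y x * subsetSum xs g w y

subsetSum-cong : (xs : List A) {g h : List A → ℚ} {w w′ y y′ : A → ℚ} →
                 g ≗ h → w ≗ w′ → y ≗ y′ → subsetSum xs g w y ≡ subsetSum xs h w′ y′
subsetSum-cong []       g≗h _ _ = g≗h []
subsetSum-cong (x ∷ xs) g≗h w≗ y≗ =
  cong₂ _+_ (cong₂ _*_ (w≗ x) (subsetSum-cong xs (g≗h ∘ (x ∷_)) w≗ y≗)) (cong₂ _*_ (y≗ x) (subsetSum-cong xs g≗h w≗ y≗))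

subsetSum-0 : (xs : List A) {g : List A → ℚ} (w y : A → ℚ) → (∀ s → g s ≡ 0ℚ) → subsetSum xs g w y ≡ 0ℚ
subsetSum-0 []       w y h = h []
subsetSum-0 (x ∷ xs) w y h =
  trans (cong₂ (λ u v → w x * u + y x * v) (subsetSum-0 xs w y (h ∘ (x ∷_))) (subsetSum-0 xs w y h))
        (solve 2 (λ a b → a :* con 0ℚ :+ b :* con 0ℚ := con 0ℚ) refl (w x) (y x))

merge : Fin n → Fin n → Fin n → Fin n
merge p q u = if does (u Fin.≟ q) then p else u

merge-≡ : (p q : Fin n) → merge p q q ≡ p
merge-≡ p q rewrite dec-true (q Fin.≟ q) refl = refl

merge-≢ : ∀ (p : Fin n) {q u} → u ≢ q → merge p q u ≡ u
merge-≢ p {q} {u} h rewrite dec-false (u Fin.≟ q) h = refl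

δ-mergeˡ : ∀ {p q : Fin n} → p ≢ q → ∀ u → δ (merge p q u) p ≡ δ u p + δ u q
δ-mergeˡ {p = p} {q} p≢q u with u Fin.≟ q
... | yes refl = trans (δ-refl p) (trans (sym (+-identityˡ 1ℚ)) (cong (_+ 1ℚ) (sym (δ-≢ (p≢q ∘ sym)))))
... | no  u≢q  = sym (+-identityʳ _)

δ-merge : ∀ {p q x : Fin n} → p ≢ x → q ≢ x → ∀ u → δ (merge p q u) x ≡ δ u x
δ-merge {p = p} {q} p≢x q≢x u with u Fin.≟ q
... | yes refl = trans (δ-≢ p≢x) (sym (δ-≢ q≢x))
... | no  _    = refl

-- The edges are contracted one after the other; c u is the vertex into which u
-- has been merged, and k the number of vertices that are left.
contractsToPoint : (Fin n → Fin n) → ℕ → List (Fin n × Fin n) → Bool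
contractsToPoint c k []             = k ℕ.≡ᵇ 1
contractsToPoint c k ((a , b) ∷ es) =
  not (does (c a Fin.≟ c b)) ∧ contractsToPoint (merge (c a) (c b) ∘ c) (k ℕ.∸ 1) es

split-two : ∀ {vs : List A} {p q} → p ∈ vs → q ∈ vs → p ≢ q → ∃ λ rest → vs ↭ p ∷ q ∷ rest
split-two {p = p} {q} p∈ q∈ p≢q with ∈-∃++ p∈
... | l , r , refl with ∈-resp-↭ (shift p l r) q∈
...   | here q≡p = contradiction (sym q≡p) p≢q
...   | there q∈′ with ∈-∃++ q∈′
...     | l′ , r′ , eq = l′ ++ r′ , ↭-trans (shift p l r) (Perm.prep p (↭-trans (↭-reflexive eq) (shift q l′ r′)))

Unique-↭ : ∀ {xs ys : List A} → xs ↭ ys → Unique xs → Unique ys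
Unique-↭ p = PermSetoid.Unique-resp-↭ (setoid _) (↭⇒↭ₛ p)

tau-0 : ∀ {W : Weights A} vs → (∀ a b → W a b ≡ 0ℚ) → tau W vs ≡ 𝟙 (length vs ℕ.≡ᵇ 1)
tau-0 []           h = refl
tau-0 (x ∷ [])     h = refl
tau-0 {W = W} (x ∷ vs@(_ ∷ _)) h =
  trans (cong (_* tau (starMesh W x vs) vs) (sum-0 vs λ z _ → h x z)) (*-zeroˡ (tau (starMesh W x vs) vs))

module _ {A : Set} {n : ℕ} (ends : A → Fin n × Fin n) {w : A → ℚ} (w≥0 : ∀ e → 0ℚ ≤ w e) where

  private
    labelled : (Fin n → Fin n) → A → Fin n × Fin n
    labelled c e = c (proj₁ (ends e)) , c (proj₂ (ends e))

    N : (Fin n → Fin n) → List A → Weights (Fin n)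
    N c = network (labelled c) w

    treeSum : (Fin n → Fin n) → ℕ → List A → ℚ
    treeSum c k es = subsetSum es (λ s → 𝟙 (contractsToPoint c k (map ends s))) w (λ _ → 1ℚ)

  -- Induction over the edges. An edge whose ends have been merged lies in no tree and has zero link
  -- off the diagonal. For any other edge the two branches of `subsetSum` are contraction and
  -- deletion, combined by `tau-contract` after the order of elimination is changed so that the ends
  -- come last.
  weighted-trees : ∀ es c vs → Unique vs → (∀ u → c u ∈ vs) → treeSum c (length vs) es ≡ tau (N c es) vs
  weighted-trees []       c vs uniq im = sym (tau-0 vs λ _ _ → refl)
  weighted-trees (e ∷ es) c vs uniq im = go (p Fin.≟ q) refl
    where
    a b p q : Fin n
    a = proj₁ (ends e)
    b = proj₂ (ends e)
    p = c a
    q = c b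
    c′ = merge p q ∘ c

    go : (d : Dec (p ≡ q)) → does (p Fin.≟ q) ≡ does d →
         treeSum c (length vs) (e ∷ es) ≡ tau (N c (e ∷ es)) vs
    go (yes p≡q) d≡ = begin
      w e * subsetSum es _ w (λ _ → 1ℚ) + 1ℚ * treeSum c (length vs) es
        ≡⟨ cong₂ (λ u v → w e * u + 1ℚ * v)
                 (subsetSum-0 es w (λ _ → 1ℚ) λ s → cong (λ d → 𝟙 (not d ∧ contractsToPoint c′ (length vs ℕ.∸ 1) (map ends s))) d≡)
                 (weighted-trees es c vs uniq im) ⟩
      w e * 0ℚ + 1ℚ * tau (N c es) vs
        ≡⟨ solve 2 (λ x y → x :* con 0ℚ :+ con 1ℚ :* y := y) refl (w e) (tau (N c es) vs) ⟩
      tau (N c es) vs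
        ≡⟨ tau-cong (AllPairs.map (λ {x} {z} x≢z → sym (trans
             (cong (λ l → w e * l + N c es x z)
                   (trans (cong (λ r → link (p , r) x z) (sym p≡q)) (link-loop {a = p} x≢z)))
             (solve 2 (λ x y → x :* con 0ℚ :+ y := y) refl (w e) (N c es x z)))) uniq) ⟩
      tau (N c (e ∷ es)) vs ∎
      where open ≡-Reasoning
    go (no p≢q) d≡ with split-two (im a) (im b) p≢q
    ... | rest , vs↭ with Unique-↭ vs↭ uniq
    ...   | (_ ∷ p≢) ∷ q≢ ∷ uniq-rest = begin
      w e * subsetSum es _ w (λ _ → 1ℚ) + 1ℚ * treeSum c (length vs) es
        ≡⟨ cong₂ (λ u v → w e * u + 1ℚ * v)
                 (trans (subsetSum-cong es (λ s → cong₂ (λ d k → 𝟙 (not d ∧ contractsToPoint c′ k (map ends s))) d≡ length≡) (λ _ → refl) (λ _ → refl))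
                        (weighted-trees es c′ (rest ++ [ p ]) uniq′ im′))
                 (trans (weighted-trees es c vs uniq im) (tau-↭ (network-isNetwork (labelled c) es w≥0) vs↭′)) ⟩
      w e * tau (N c′ es) (rest ++ [ p ]) + 1ℚ * tau (N c es) (rest ++ p ∷ q ∷ [])
        ≡⟨ solve 3 (λ x y z → x :* y :+ con 1ℚ :* z := z :+ x :* y) refl (w e) (tau (N c′ es) (rest ++ [ p ])) (tau (N c es) (rest ++ p ∷ q ∷ [])) ⟩
      tau (N c es) (rest ++ p ∷ q ∷ []) + w e * tau (N c′ es) (rest ++ [ p ])
        ≡⟨ sym (tau-contract rest p q (w e)
             (AllPairs.map (λ { {x} {z} ((p≢x , q≢x) , (p≢z , q≢z) , _) → unchanged p≢x q≢x z , merged p≢x q≢x p≢z q≢z })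
                           (AllPairs-zip (All.zip (p≢ , q≢)) uniq-rest))
             (All.map (λ { {x} (p≢x , q≢x) → unchanged p≢x q≢x p , unchanged p≢x q≢x q , merged-p p≢x q≢x }) (All.zip (p≢ , q≢)))
             (trans (cong (λ l → w e * l + N c es p q) (link-ends p≢q))
                    (solve 2 (λ x y → x :* con 1ℚ :+ y := y :+ x) refl (w e) (N c es p q)))) ⟩
      tau (N c (e ∷ es)) (rest ++ p ∷ q ∷ [])
        ≡⟨ sym (tau-↭ (network-isNetwork (labelled c) (e ∷ es) w≥0) vs↭′) ⟩
      tau (N c (e ∷ es)) vs ∎
      where
      open ≡-Reasoning
      vs↭′ : vs ↭ rest ++ p ∷ q ∷ []
      vs↭′ = ↭-trans vs↭ (++-comm (p ∷ q ∷ []) rest)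
      rest↭ : p ∷ rest ↭ rest ++ [ p ]
      rest↭ = ++-comm [ p ] rest
      length≡ : length vs ℕ.∸ 1 ≡ length (rest ++ [ p ])
      length≡ = trans (cong (ℕ._∸ 1) (↭-length vs↭)) (↭-length rest↭)
      uniq′ : Unique (rest ++ [ p ])
      uniq′ = Unique-↭ rest↭ (p≢ ∷ uniq-rest)
      im′ : ∀ u → c′ u ∈ rest ++ [ p ]
      im′ u = ∈-resp-↭ rest↭ (place (c u) (∈-resp-↭ vs↭ (im u)))
        where
        place : ∀ v → v ∈ p ∷ q ∷ rest → merge p q v ∈ p ∷ rest
        place v v∈ with v Fin.≟ q | v∈
        ... | yes _   | _                  = here refl
        ... | no  v≢q | here v≡p           = here v≡p
        ... | no  v≢q | there (here v≡q)   = contradiction v≡q v≢q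
        ... | no  v≢q | there (there v∈r)  = there v∈r
      unchanged : ∀ {x} → p ≢ x → q ≢ x → ∀ z → N c (e ∷ es) x z ≡ N c es x z
      unchanged {x} p≢x q≢x z = trans (cong (λ l → w e * l + N c es x z) (link-≢ p≢x q≢x z))
        (solve 2 (λ x y → x :* con 0ℚ :+ y := y) refl (w e) (N c es x z))
      merged : ∀ {x z} → p ≢ x → q ≢ x → p ≢ z → q ≢ z → N c′ es x z ≡ N c es x z
      merged p≢x q≢x p≢z q≢z = sum-cong′ es λ f → let u = c (proj₁ (ends f)) ; v = c (proj₂ (ends f)) in cong (w f *_)
        (cong₂ _+_ (cong₂ _*_ (δ-merge p≢x q≢x u) (δ-merge p≢z q≢z v)) (cong₂ _*_ (δ-merge p≢z q≢z u) (δ-merge p≢x q≢x v)))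
      merged-p : ∀ {x} → p ≢ x → q ≢ x → N c′ es x p ≡ N c es x p + N c es x q
      merged-p {x} p≢x q≢x = trans (sum-cong′ es λ f → let u = c (proj₁ (ends f)) ; v = c (proj₂ (ends f)) in
        trans (cong (w f *_) (cong₂ _+_ (cong₂ _*_ (δ-merge p≢x q≢x u) (δ-mergeˡ p≢q v)) (cong₂ _*_ (δ-mergeˡ p≢q u) (δ-merge p≢x q≢x v))))
              (solve 7 (λ w ux vx up uq vp vq → w :* (ux :* (vp :+ vq) :+ (up :+ uq) :* vx) := w :* (ux :* vp :+ up :* vx) :+ w :* (ux :* vq :+ uq :* vx))
                 refl (w f) (δ u x) (δ v x) (δ u p) (δ u q) (δ v p) (δ v q)))
        (sum-+ es _ _)

-- Connectivity and forests under contraction.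

data Reach {n : ℕ} (c : Fin n → Fin n) (es : List (Fin n × Fin n)) : Fin n → Fin n → Set where
  merged : ∀ {u v} → c u ≡ c v → Reach c es u v
  edge   : ∀ {u v} → (u , v) ∈ es → Reach c es u v
  ~sym   : ∀ {u v} → Reach c es u v → Reach c es v u
  ~trans : ∀ {u v w} → Reach c es u v → Reach c es v w → Reach c es u w

module _ {n : ℕ} {c : Fin n → Fin n} where

  Reach-[] : ∀ {u v} → Reach c [] u v → c u ≡ c v
  Reach-[] (merged e)   = e
  Reach-[] (~sym r)     = sym (Reach-[] r)
  Reach-[] (~trans r s) = trans (Reach-[] r) (Reach-[] s)

  Reach-∷ : ∀ {es f u v} → Reach c es u v → Reach c (f ∷ es) u v
  Reach-∷ (merged e)   = merged e
  Reach-∷ (edge e∈)    = edge (there e∈)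
  Reach-∷ (~sym r)     = ~sym (Reach-∷ r)
  Reach-∷ (~trans r s) = ~trans (Reach-∷ r) (Reach-∷ s)

  -- One crossing of the edge ab is always enough: two crossings in the same direction collapse to
  -- one, and opposite crossings cancel.
  Through : List (Fin n × Fin n) → Fin n → Fin n → Fin n → Fin n → Set
  Through es a b u v =
    Reach c es u v ⊎ (Reach c es u a × Reach c es b v) ⊎ (Reach c es u b × Reach c es a v)

  Reach-through : ∀ {es a b u v} → Reach c ((a , b) ∷ es) u v → Through es a b u v
  Reach-through (merged e)         = inj₁ (merged e)
  Reach-through (edge (here refl)) = inj₂ (inj₁ (merged refl , merged refl))
  Reach-through (edge (there e∈))  = inj₁ (edge e∈)
  Reach-through (~sym r) with Reach-through r
  ... | inj₁ s               = inj₁ (~sym s)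
  ... | inj₂ (inj₁ (s , t₁)) = inj₂ (inj₂ (~sym t₁ , ~sym s))
  ... | inj₂ (inj₂ (s , t₁)) = inj₂ (inj₁ (~sym t₁ , ~sym s))
  Reach-through (~trans r r′) with Reach-through r | Reach-through r′
  ... | inj₁ s             | inj₁ s′               = inj₁ (~trans s s′)
  ... | inj₁ s             | inj₂ (inj₁ (s′ , t′)) = inj₂ (inj₁ (~trans s s′ , t′))
  ... | inj₁ s             | inj₂ (inj₂ (s′ , t′)) = inj₂ (inj₂ (~trans s s′ , t′))
  ... | inj₂ (inj₁ (s , t₁)) | inj₁ s′               = inj₂ (inj₁ (s , ~trans t₁ s′))
  ... | inj₂ (inj₁ (s , t₁)) | inj₂ (inj₁ (s′ , t′)) = inj₂ (inj₁ (s , t′))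
  ... | inj₂ (inj₁ (s , t₁)) | inj₂ (inj₂ (s′ , t′)) = inj₁ (~trans s t′)
  ... | inj₂ (inj₂ (s , t₁)) | inj₁ s′               = inj₂ (inj₂ (s , ~trans t₁ s′))
  ... | inj₂ (inj₂ (s , t₁)) | inj₂ (inj₁ (s′ , t′)) = inj₁ (~trans s t′)
  ... | inj₂ (inj₂ (s , t₁)) | inj₂ (inj₂ (s′ , t′)) = inj₂ (inj₂ (s , t′))

  through-Reach : ∀ {es a b u v} → Through es a b u v → Reach c ((a , b) ∷ es) u v
  through-Reach (inj₁ r)               = Reach-∷ r
  through-Reach (inj₂ (inj₁ (r , s))) = ~trans (Reach-∷ r) (~trans (edge (here refl)) (Reach-∷ s))
  through-Reach (inj₂ (inj₂ (r , s))) = ~trans (Reach-∷ r) (~trans (~sym (edge (here refl))) (Reach-∷ s))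

  -- With its converse `Reach-contract`: an additional edge has the same effect on connectivity as
  -- merging the labels of its ends.
  contract-Reach : ∀ {es a b u v} → Reach (merge (c a) (c b) ∘ c) es u v → Reach c ((a , b) ∷ es) u v
  contract-Reach {a = a} {b} {u} {v} (merged e) with c u Fin.≟ c b | c v Fin.≟ c b
  ... | yes u≡ | yes v≡ = merged (trans u≡ (sym v≡))
  ... | yes u≡ | no  _  = ~trans (merged u≡) (~trans (~sym (edge (here refl))) (merged e))
  ... | no  _  | yes v≡ = ~trans (merged e) (~trans (edge (here refl)) (merged (sym v≡)))
  ... | no  _  | no  _  = merged e
  contract-Reach (edge e∈)    = edge (there e∈)
  contract-Reach (~sym r)     = ~sym (contract-Reach r)
  contract-Reach (~trans r s) = ~trans (contract-Reach r) (contract-Reach s)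

  Reach-contract : ∀ {es a b u v} → Reach c ((a , b) ∷ es) u v → Reach (merge (c a) (c b) ∘ c) es u v
  Reach-contract {a = a} {b} (merged e) = merged (cong (merge (c a) (c b)) e)
  Reach-contract {a = a} {b} (edge (here refl)) = merged (trans left (sym (merge-≡ (c a) (c b))))
    where
    left : merge (c a) (c b) (c a) ≡ c a
    left with c a Fin.≟ c b
    ... | yes _ = refl
    ... | no  _ = refl
  Reach-contract (edge (there e∈)) = edge e∈
  Reach-contract (~sym r)          = ~sym (Reach-contract r)
  Reach-contract (~trans r s)      = ~trans (Reach-contract r) (Reach-contract s)

-- Each edge is tested only against the edges behind it, so a cycle is detected at its foremost
-- edge.
Forest : (Fin n → Fin n) → List (Fin n × Fin n) → Set
Forest c []             = ⊤
Forest c ((a , b) ∷ es) = Forest c es × ¬ Reach c es a b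

-- `Forest` builds the graph from the back of the list, whereas contraction consumes it from the
-- front. If contracting ab connects the ends `f` and `g` of a later edge that were not connected
-- before, the connection passes through ab; replacing ab by fg then connects `a` to `b` without ab,
-- which was excluded.
Forest-contract : ∀ {c : Fin n → Fin n} {a b} es →
                  Forest c ((a , b) ∷ es) → c a ≢ c b × Forest (merge (c a) (c b) ∘ c) es
Forest-contract [] (_ , ¬r) = (λ e → ¬r (merged e)) , tt
Forest-contract ((f , g) ∷ es) ((F , ¬fg) , ¬ab) with Forest-contract es (F , ¬ab ∘ Reach-∷)
... | a≢b , F′ = a≢b , F′ , λ r → exclude (Reach-through (contract-Reach r))
  where
  exclude : ¬ Through es _ _ f g
  exclude (inj₁ r)              = ¬fg r
  exclude (inj₂ (inj₁ (r , s))) = ¬ab (through-Reach (inj₂ (inj₁ (~sym r , ~sym s))))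
  exclude (inj₂ (inj₂ (r , s))) = ¬ab (through-Reach (inj₂ (inj₂ (s , r))))

contract-Forest : ∀ {c : Fin n → Fin n} {a b} es →
                  c a ≢ c b → Forest (merge (c a) (c b) ∘ c) es → Forest c ((a , b) ∷ es)
contract-Forest [] a≢b _ = tt , a≢b ∘ Reach-[]
contract-Forest ((f , g) ∷ es) a≢b (F′ , ¬fg) with contract-Forest es a≢b F′
... | F , ¬ab = (F , ¬fg ∘ Reach-contract ∘ Reach-∷) , λ r → exclude (Reach-through r)
  where
  exclude : ¬ Through es f g _ _
  exclude (inj₁ r)              = ¬ab r
  exclude (inj₂ (inj₁ (r , s))) = ¬fg (Reach-contract (through-Reach (inj₂ (inj₁ (~sym r , ~sym s)))))
  exclude (inj₂ (inj₂ (r , s))) = ¬fg (Reach-contract (through-Reach (inj₂ (inj₂ (s , r)))))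

Spans : (Fin n → Fin n) → List (Fin n × Fin n) → Set
Spans c es = Forest c es × (∀ u v → Reach c es u v)

-- `vs` is exactly the image of `c`, so its length is the number of vertices left. `section` turns
-- two surviving labels back into two vertices that have not been connected.
record Labels {n : ℕ} (c : Fin n → Fin n) (vs : List (Fin n)) : Set where
  field
    unique  : Unique vs
    image   : ∀ u → c u ∈ vs
    section : ∀ {p} → p ∈ vs → ∃ λ u → c u ≡ p

Labels-merge : ∀ {c : Fin n → Fin n} {vs} a b → Labels c vs → c a ≢ c b →
               ∃ λ vs′ → Labels (merge (c a) (c b) ∘ c) vs′ × length vs ℕ.∸ 1 ≡ length vs′
Labels-merge {c = c} {vs} a b labels a≢b with split-two (image a) (image b) a≢b
  where open Labels labels
... | rest , vs↭ with Unique-↭ vs↭ (Labels.unique labels)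
...   | (_ ∷ p≢) ∷ q≢ ∷ uniq-rest =
  c a ∷ rest , record { unique = p≢ ∷ uniq-rest ; image = im ; section = sec } , cong (ℕ._∸ 1) (↭-length vs↭)
  where
  im : ∀ u → merge (c a) (c b) (c u) ∈ c a ∷ rest
  im u with c u Fin.≟ c b | ∈-resp-↭ vs↭ (Labels.image labels u)
  ... | yes _   | _                 = here refl
  ... | no  v≢q | here v≡p          = here v≡p
  ... | no  v≢q | there (here v≡q)  = contradiction v≡q v≢q
  ... | no  v≢q | there (there v∈r) = there v∈r
  sec : ∀ {p} → p ∈ c a ∷ rest → ∃ λ u → merge (c a) (c b) (c u) ≡ p
  sec (here refl) = a , merge-≢ (c a) a≢b
  sec {p} (there p∈) with Labels.section labels (∈-resp-↭ (↭-sym vs↭) (there (there p∈)))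
  ... | u , refl = u , merge-≢ (c a) λ e → All.lookup q≢ p∈ (sym e)

contracts⇒Spans : ∀ {c : Fin n → Fin n} {vs} es → Labels c vs → contractsToPoint c (length vs) es ≡ true → Spans c es
contracts⇒Spans {vs = _ ∷ []} [] labels _ = tt , λ u v → merged (only (image u) (image v))
  where
  open Labels labels
  only : ∀ {x p q : Fin _} → p ∈ [ x ] → q ∈ [ x ] → p ≡ q
  only (here p≡) (here q≡) = trans p≡ (sym q≡)
contracts⇒Spans {c = c} ((a , b) ∷ es) labels h with c a Fin.≟ c b
contracts⇒Spans {c = c} ((a , b) ∷ es) labels () | yes _
... | no a≢b with Labels-merge a b labels a≢b
...   | _ , labels′ , k≡ with contracts⇒Spans es labels′ (trans (cong (λ k → contractsToPoint _ k es) (sym k≡)) h)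
...     | F , R = contract-Forest es a≢b F , λ u v → contract-Reach (R u v)

-- The vertex argument excludes the empty graph, for which `Spans` holds vacuously although no point
-- is left. If two labels survive all contractions, `section` yields two vertices that the edges do
-- not connect.
Spans⇒contracts : ∀ {c : Fin n → Fin n} {vs} es → Fin n → Labels c vs → Spans c es → contractsToPoint c (length vs) es ≡ true
Spans⇒contracts {vs = []}         [] o labels _ with () ← Labels.image labels o
Spans⇒contracts {vs = x ∷ []}     [] o labels _ = refl
Spans⇒contracts {vs = x ∷ y ∷ vs} [] o labels (_ , R)
  with Labels.section labels (here refl) | Labels.section labels (there (here refl)) | Labels.unique labels
... | u , refl | v , refl | (x≢y ∷ _) ∷ _ = contradiction (Reach-[] (R u v)) x≢y
Spans⇒contracts {c = c} ((a , b) ∷ es) o labels (F , R) with Forest-contract es F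
... | a≢b , F′ with Labels-merge a b labels a≢b
...   | _ , labels′ , k≡ rewrite dec-false (c a Fin.≟ c b) a≢b | k≡ =
  Spans⇒contracts es o labels′ (F′ , λ u v → Reach-contract (R u v))

-- Walks, cycles and the tree predicate.

Walk-++ : ∀ {G u v w ds es} → Walk G u ds v → Walk G v es w → Walk G u (ds ++ es) w
Walk-++ []      w = w
Walk-++ (d ∷ v) w = d ∷ Walk-++ v w

module _ {n : ℕ} {es : List (Fin n × Fin n)} {ll : All (uncurry _≢_) es} where

  private
    G : Graph
    G = record { order = n ; edges = es ; loopless = ll }

  dart-Reach : ∀ d → Reach id es (src G d) (tgt G d)
  dart-Reach (e , false) = edge (∈-lookup e)
  dart-Reach (e , true)  = ~sym (edge (∈-lookup e))

  Walk⇒Reach : ∀ {u ds v} → Walk G u ds v → Reach id es u v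
  Walk⇒Reach []      = merged refl
  Walk⇒Reach (d ∷ w) = ~trans (dart-Reach d) (Walk⇒Reach w)

  Walk-reverse : ∀ {u ds v} → Walk G u ds v → ∃ λ ds′ → Walk G v ds′ u
  Walk-reverse [] = [] , []
  Walk-reverse ((e , false) ∷ w) with Walk-reverse w
  ... | ds , w′ = ds ++ [ e , true ] , Walk-++ w′ ((e , true) ∷ [])
  Walk-reverse ((e , true) ∷ w) with Walk-reverse w
  ... | ds , w′ = ds ++ [ e , false ] , Walk-++ w′ ((e , false) ∷ [])

  Reach⇒Walk : ∀ {u v} → Reach id es u v → ∃ λ ds → Walk G u ds v
  Reach⇒Walk (merged refl)  = [] , []
  Reach⇒Walk (edge e∈) with ∈-∃-lookup e∈
    where
    ∈-∃-lookup : ∀ {x} {xs : List (Fin n × Fin n)} → x ∈ xs → ∃ λ i → lookup xs i ≡ x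
    ∈-∃-lookup (here refl) = zero , refl
    ∈-∃-lookup (there x∈) with ∈-∃-lookup x∈
    ... | i , eq = suc i , eq
  ... | i , eq = [ i , false ] , subst (λ p → Walk G (proj₁ p) [ i , false ] (proj₂ p)) eq ((i , false) ∷ [])
  Reach⇒Walk (~sym r)       = Walk-reverse (proj₂ (Reach⇒Walk r))
  Reach⇒Walk (~trans r s) with Reach⇒Walk r | Reach⇒Walk s
  ... | _ , w | _ , w′ = _ , Walk-++ w w′

  IsPath : Fin n → List (Dart G) → Fin n → Set
  IsPath u ds v = Walk G u ds v × Unique (u ∷ map (tgt G) ds)

  suffix : ∀ {x y ds v} → x ∈ y ∷ map (tgt G) ds → IsPath y ds v → ∃ λ ds′ → IsPath x ds′ v
  suffix (here refl) p = _ , p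
  suffix {ds = _ ∷ _} (there i) (_ ∷ w , _ ∷ un) = suffix i (w , un)

  Walk⇒Path : ∀ {u ds v} → Walk G u ds v → ∃ λ ds′ → IsPath u ds′ v
  Walk⇒Path [] = [] , [] , [] ∷ []
  Walk⇒Path (d ∷ w) with Walk⇒Path w
  ... | ds′ , w′ , un with mem? Fin._≟_ (src G d) (tgt G d ∷ map (tgt G) ds′)
  ...   | yes i = suffix i (w′ , un)
  ...   | no ¬i = d ∷ ds′ , d ∷ w′ , ¬Any⇒All¬ _ ¬i ∷ un

  vertices-of-walk : ∀ {u ds v} → Walk G u ds v → u ∷ map (tgt G) ds ≡ map (src G) ds ++ [ v ]
  vertices-of-walk []      = refl
  vertices-of-walk (d ∷ w) = cong (src G d ∷_) (vertices-of-walk w)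

  src-on-walk : ∀ {u ds v d} → Walk G u ds v → d ∈ ds → src G d ∈ u ∷ map (tgt G) ds
  src-on-walk (d ∷ w) (here refl) = here refl
  src-on-walk (d ∷ w) (there d∈)  = there (src-on-walk w d∈)

  same-edge : ∀ d d′ → proj₁ d ≡ proj₁ d′ → src G d ≡ src G d′ ⊎ src G d ≡ tgt G d′
  same-edge (e , false) (.e , false) refl = inj₁ refl
  same-edge (e , false) (.e , true)  refl = inj₂ refl
  same-edge (e , true)  (.e , false) refl = inj₂ refl
  same-edge (e , true)  (.e , true)  refl = inj₁ refl

  -- A later dart on the first edge has the starting vertex as one of its ends, so the walk would
  -- return to that vertex.
  Path-distinctEdges : ∀ {u ds v} → IsPath u ds v → Unique (map proj₁ ds)
  Path-distinctEdges ([] , _) = []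
  Path-distinctEdges (_∷_ d {ds} w , u∉ ∷ un) =
    All.map⁺ (All.tabulate λ {d′} d′∈ e≡ → absurd d′ d′∈ (same-edge d d′ e≡)) ∷ Path-distinctEdges (w , un)
    where
    absurd : ∀ d′ → d′ ∈ ds → src G d ≡ src G d′ ⊎ src G d ≡ tgt G d′ → ⊥
    absurd d′ d′∈ (inj₁ eq) = All.lookup u∉ (src-on-walk w d′∈) eq
    absurd d′ d′∈ (inj₂ eq) = All.lookup u∉ (there (∈-map⁺ (tgt G) d′∈)) eq

module _ {n : ℕ} {a b : Fin n} {es : List (Fin n × Fin n)} {a≢b : a ≢ b} {ll : All (uncurry _≢_) es} where

  private
    G G⁺ : Graph
    G  = record { order = n ; edges = es ; loopless = ll }
    G⁺ = record { order = n ; edges = (a , b) ∷ es ; loopless = a≢b ∷ ll }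

    up : Dart G → Dart G⁺
    up (e , o) = suc e , o

    src-up : ∀ d → src G⁺ (up d) ≡ src G d
    src-up (e , false) = refl
    src-up (e , true)  = refl

    Walk-up : ∀ {u ds v} → Walk G u ds v → Walk G⁺ u (map up ds) v
    Walk-up []                = []
    Walk-up ((e , false) ∷ w) = (suc e , false) ∷ Walk-up w
    Walk-up ((e , true) ∷ w)  = (suc e , true) ∷ Walk-up w

    Walk-down : ∀ {u v} ds → Walk G⁺ u (map up ds) v → Walk G u ds v
    Walk-down []                 []      = []
    Walk-down ((e , false) ∷ ds) (_ ∷ w) = (e , false) ∷ Walk-down ds w
    Walk-down ((e , true) ∷ ds)  (_ ∷ w) = (e , true) ∷ Walk-down ds w

    srcs-up : ∀ ds → map (src G⁺) (map up ds) ≡ map (src G) ds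
    srcs-up ds = trans (sym (map-∘ ds)) (map-cong src-up ds)

    edges-up : ∀ ds → map proj₁ (map up ds) ≡ map suc (map proj₁ ds)
    edges-up ds = trans (sym (map-∘ ds)) (map-∘ ds)

    avoiding : ∀ ds → All (λ d → zero ≢ proj₁ d) ds → ∃ λ ds′ → ds ≡ map up ds′
    avoiding []                 []       = [] , refl
    avoiding ((zero , o) ∷ ds)  (p ∷ ps) = contradiction refl p
    avoiding ((suc e , o) ∷ ds) (p ∷ ps) with avoiding ds ps
    ... | ds′ , refl = (e , o) ∷ ds′ , refl

    avoiding-Reach : ∀ {u ds v} → All (λ d → zero ≢ proj₁ d) ds → Walk G⁺ u ds v → Reach id es u v
    avoiding-Reach {ds = ds} ps w with avoiding ds ps
    ... | ds′ , refl = Walk⇒Reach (Walk-down ds′ w)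

    Walk-split : ∀ {u v} ds d es → Walk G⁺ u (ds ++ d ∷ es) v → Walk G⁺ u ds (src G⁺ d) × Walk G⁺ (tgt G⁺ d) es v
    Walk-split []       d es (.d ∷ w) = [] , w
    Walk-split (f ∷ ds) d es (.f ∷ w) with Walk-split ds d es w
    ... | w₁ , w₂ = f ∷ w₁ , w₂

    cycle-down : ∀ {u} ds → IsCycle G⁺ u (map up ds) → IsCycle G u ds
    cycle-down ds c = record
      { nonempty         = λ { refl → nonempty refl }
      ; closed           = Walk-down ds closed
      ; distinctEdges    = AllPairs.map (_∘ cong suc) (AllPairs.map⁻ (subst Unique (edges-up ds) distinctEdges))
      ; distinctVertices = subst Unique (srcs-up ds) distinctVertices
      }
      where open IsCycle c

    cycle-up : ∀ {u} ds → IsCycle G u ds → IsCycle G⁺ u (map up ds)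
    cycle-up ds c = record
      { nonempty         = λ e → nonempty (map-empty ds e)
      ; closed           = Walk-up closed
      ; distinctEdges    = subst Unique (sym (edges-up ds)) (Unique.map⁺ Fin.suc-injective distinctEdges)
      ; distinctVertices = subst Unique (sym (srcs-up ds)) distinctVertices
      }
      where
      open IsCycle c
      map-empty : ∀ ds → map up ds ≡ [] → ds ≡ []
      map-empty [] _ = refl

    closing-cycle : ∀ {ds} → IsPath {ll = ll} b ds a → IsCycle G⁺ a ((zero , false) ∷ map up ds)
    closing-cycle {ds} p@(w , un) = record
      { nonempty         = λ ()
      ; closed           = (zero , false) ∷ Walk-up w
      ; distinctEdges    = All.map⁺ (All.map⁺ (All.tabulate λ _ ())) ∷
                           subst Unique (sym (edges-up ds)) (Unique.map⁺ Fin.suc-injective (Path-distinctEdges p))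
      -- The vertices of the path are its sources followed by `a`. Moving `a` to the front gives the
      -- sources along the cycle.
      ; distinctVertices = subst (λ vs → Unique (a ∷ vs)) (sym (srcs-up ds))
                             (Unique-↭ (++-comm (map (src G) ds) [ a ]) (subst Unique (vertices-of-walk w) un))
      }

  Acyclic-∷⁻ : Acyclic G⁺ → Acyclic G × ¬ Reach id es a b
  Acyclic-∷⁻ ac = (λ u ds c → ac u (map up ds) (cycle-up ds c)) ,
    λ r → let _ , w = Reach⇒Walk {ll = ll} (~sym r) ; _ , p = Walk⇒Path w in ac a _ (closing-cycle p)

  -- A cycle through the new edge uses it only once. The part after it, followed by the part before
  -- it, connects the ends of the new edge in the old graph.
  Acyclic-∷⁺ : Acyclic G → ¬ Reach id es a b → Acyclic G⁺
  Acyclic-∷⁺ ac ¬r u ds c with mem? Fin._≟_ zero (map proj₁ ds)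
  ... | no ∉ with avoiding ds (All.map⁻ (¬Any⇒All¬ (map proj₁ ds) ∉))
  ...   | ds′ , refl = ac u ds′ (cycle-down ds′ c)
  Acyclic-∷⁺ ac ¬r u ds c | yes ∈ with ∈-map⁻ proj₁ ∈
  ... | (.zero , o) , d∈ , refl with ∈-∃++ d∈
  ...   | l , r , refl with Walk-split l (zero , o) r (IsCycle.closed c)
                          | Unique-↭ (shift zero (map proj₁ l) (map proj₁ r))
                                     (subst Unique (map-++ proj₁ l ((zero , o) ∷ r)) (IsCycle.distinctEdges c))
  ...     | w₁ , w₂ | ∉ ∷ _ = orient o (~trans (avoiding-Reach (All.map⁻ (All.++⁻ʳ (map proj₁ l) ∉)) w₂)
                                              (avoiding-Reach (All.map⁻ (All.++⁻ˡ (map proj₁ l) ∉)) w₁))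
    where
    orient : ∀ o → Reach id es (tgt G⁺ (zero , o)) (src G⁺ (zero , o)) → ⊥
    orient false r = ¬r (~sym r)
    orient true  r = ¬r r

Acyclic⇒Forest : ∀ (es : List (Fin n × Fin n)) ll → Acyclic (record { order = n ; edges = es ; loopless = ll }) → Forest id es
Acyclic⇒Forest []       []       ac = tt
Acyclic⇒Forest (e ∷ es) (p ∷ ll) ac with Acyclic-∷⁻ ac
... | ac′ , ¬r = Acyclic⇒Forest es ll ac′ , ¬r

Forest⇒Acyclic : ∀ (es : List (Fin n × Fin n)) ll → Forest id es → Acyclic (record { order = n ; edges = es ; loopless = ll })
Forest⇒Acyclic []       []       F u []            c = IsCycle.nonempty c refl
Forest⇒Acyclic []       []       F u ((() , _) ∷ _) c
Forest⇒Acyclic (e ∷ es) (p ∷ ll) (F , ¬r) = Acyclic-∷⁺ (Forest⇒Acyclic es ll F) ¬r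

-- This replaces the decision procedure inside `t` by a recursion along the edge list, on which
-- deletion and contraction can act.
isTree-contracts : ∀ G → does (isTree? G) ≡ contractsToPoint id (order G) (edges G)
isTree-contracts G = reflects (isTree? G) tree⇒ (⇒tree (order G) (edges G) (loopless G))
  where
  reflects : {b : Bool} (d : Dec P) → (P → b ≡ true) → (b ≡ true → P) → does d ≡ b
  reflects         (yes p) f g = sym (f p)
  reflects {b = true}  (no ¬p) f g = contradiction (g refl) ¬p
  reflects {b = false} (no ¬p) f g = refl
  labels : ∀ n → Labels id (allFin n)
  labels n = record { unique = allFin⁺ n ; image = ∈-allFin ; section = λ {p} _ → p , refl }
  length≡ : ∀ n → length (allFin n) ≡ n
  length≡ n = length-tabulate id
  point : ∀ n → ℕ.NonZero n → Fin n
  point (suc n) _ = zero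
  tree⇒ : IsTree G → contractsToPoint id (order G) (edges G) ≡ true
  tree⇒ ((nz , conn) , ac) = trans (cong (λ k → contractsToPoint id k (edges G)) (sym (length≡ (order G))))
    (Spans⇒contracts (edges G) (point (order G) nz) (labels (order G))
      (Acyclic⇒Forest (edges G) (loopless G) ac , λ u v → Walk⇒Reach (proj₂ (conn u v))))
  ⇒tree : ∀ n es ll → contractsToPoint id n es ≡ true → IsTree (record { order = n ; edges = es ; loopless = ll })
  ⇒tree zero ((() , _) ∷ _) ll h
  ⇒tree (suc n) es ll h with contracts⇒Spans es (labels (suc n)) (trans (cong (λ k → contractsToPoint id k es) (length≡ (suc n))) h)
  ... | F , R = (_ , λ u v → Reach⇒Walk (R u v)) , Forest⇒Acyclic es ll F

-- Spanning tree numbers as values of `tau`.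

fromℕ-suc : ∀ k → fromℕ (suc k) ≡ 1ℚ + fromℕ k
-- `fromℕ k` is normalised by a gcd, which is stuck for a variable `k`. Coprimality with 1 exposes
-- numerator and denominator, so that the addition computes.
fromℕ-suc k = sym (trans (cong (1ℚ +_) (ℚ.normalize-coprime {k} {0} coprime))
                         (cong (ℚ._/ 1) (cong (ℤ._+_ (ℤ.+ 1)) (ℤ.*-identityʳ (ℤ.+ k)))))
  where
  coprime : Coprime k 1
  coprime = Coprime.sym (1-coprimeTo k)

fromℕ-nonneg : ∀ k → 0ℚ ≤ fromℕ k
fromℕ-nonneg zero    = ℚ.≤-refl
fromℕ-nonneg (suc k) = subst (0ℚ ≤_) (sym (fromℕ-suc k)) (ℚ.+-mono-≤ (𝟙-nonneg true) (fromℕ-nonneg k))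

fromℕ-positive : ∀ k → 0ℚ < fromℕ (suc k)
fromℕ-positive k = subst (0ℚ <_) (sym (fromℕ-suc k)) (ℚ.+-mono-<-≤ (ℚ.positive⁻¹ 1ℚ) (fromℕ-nonneg k))

sum-filter : {R : A → Set} (R? : ∀ x → Dec (R x)) (xs : List A) (f : A → ℚ) →
             sumOver (filter R? xs) f ≡ sumOver xs (λ x → 𝟙 (does (R? x)) * f x)
sum-filter R? []       f = refl
sum-filter R? (x ∷ xs) f with does (R? x)
... | true  = cong₂ _+_ (sym (*-identityˡ (f x))) (sum-filter R? xs f)
... | false = trans (sum-filter R? xs f) (sym (trans (cong (_+ rest) (*-zeroˡ (f x))) (+-identityˡ rest)))
  where rest = sumOver xs (λ y → 𝟙 (does (R? y)) * f y)

fromℕ-length : (xs : List A) → fromℕ (length xs) ≡ sumOver xs (λ _ → 1ℚ)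
fromℕ-length []       = refl
fromℕ-length (x ∷ xs) = trans (fromℕ-suc (length xs)) (cong (1ℚ +_) (fromℕ-length xs))

fromℕ-length-filter : {R : A → Set} (R? : ∀ x → Dec (R x)) (xs : List A) →
                      fromℕ (length (filter R? xs)) ≡ sumOver xs (λ x → 𝟙 (does (R? x)))
fromℕ-length-filter R? xs = trans (fromℕ-length (filter R? xs))
  (trans (sum-filter R? xs (λ _ → 1ℚ)) (sum-cong′ xs λ x → *-identityʳ (𝟙 (does (R? x)))))

sum-allSubsets : (xs : List A) (f : List A → ℚ) →
                 sumOver (allSubsets (length xs)) (f ∘ select xs) ≡ subsetSum xs f (λ _ → 1ℚ) (λ _ → 1ℚ)
sum-allSubsets []       f = +-identityʳ (f [])
sum-allSubsets (x ∷ xs) f =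
  trans (sum-++ (map (inside ∷_) all) (map (outside ∷_) all) (f ∘ select (x ∷ xs)))
    (cong₂ _+_ (part inside (f ∘ (x ∷_)) (λ _ → refl)) (part outside f (λ _ → refl)))
  where
  all = allSubsets (length xs)
  part : ∀ o g → (∀ s → f (select (x ∷ xs) (o ∷ s)) ≡ g (select xs s)) →
         sumOver (map (o ∷_) all) (f ∘ select (x ∷ xs)) ≡ 1ℚ * subsetSum xs g (λ _ → 1ℚ) (λ _ → 1ℚ)
  part o g h = trans (sum-map all (o ∷_) (f ∘ select (x ∷ xs)))
    (trans (sum-cong′ all h) (trans (sum-allSubsets xs g) (sym (*-identityˡ _))))

fromℕ-t : ∀ G → fromℕ (t G) ≡ subsetSum (edges G) (𝟙 ∘ contractsToPoint id (order G)) (λ _ → 1ℚ) (λ _ → 1ℚ)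
fromℕ-t G = trans (fromℕ-length-filter (λ E′ → isTree? (spanning G E′)) (allSubsets (size G)))
  (trans (sum-cong′ (allSubsets (size G)) λ E′ → cong 𝟙 (isTree-contracts (spanning G E′)))
         (sum-allSubsets (edges G) (𝟙 ∘ contractsToPoint id (order G))))

-- The weighted matrix-tree theorem for `tau`, obtained by starting the contraction with every
-- vertex as its own label.
weighted-spanning-trees : (ends : A → Fin n × Fin n) {w : A → ℚ} → (∀ e → 0ℚ ≤ w e) → ∀ es →
  subsetSum es (𝟙 ∘ contractsToPoint id n ∘ map ends) w (λ _ → 1ℚ) ≡ tau (network ends w es) (allFin n)
weighted-spanning-trees {n = n} ends {w} w≥0 es =
  trans (subsetSum-cong es (λ s → cong (λ k → 𝟙 (contractsToPoint id k (map ends s))) (sym (length-tabulate {n = n} id)))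
                        (λ _ → refl) (λ _ → refl))
        (weighted-trees ends w≥0 es id (allFin n) (allFin⁺ n) ∈-allFin)

t-tau : ∀ G → fromℕ (t G) ≡ tau (network id (λ _ → 1ℚ) (edges G)) (vertices G)
t-tau G = trans (fromℕ-t G)
  (trans (subsetSum-cong (edges G) (λ s → cong (𝟙 ∘ contractsToPoint id (order G)) (sym (map-id s))) (λ _ → refl) (λ _ → refl))
         (weighted-spanning-trees id (λ _ → 𝟙-nonneg true) (edges G)))

-- Elimination of one side of a bipartite network.

-- The entry `M` starts at zero and accumulates the meshes of the vertices of `A` eliminated so far;
-- the zero block on `A` is preserved throughout.
block : (A → B → ℚ) → Weights B → Weights (A ⊎ B)
block w M (inj₁ a) (inj₁ a′) = 0ℚ
block w M (inj₁ a) (inj₂ b)  = w a b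
block w M (inj₂ b) (inj₁ a)  = w a b
block w M (inj₂ b) (inj₂ b′) = M b b′

block-isNetwork : {w : A → B → ℚ} → (∀ a b → 0ℚ ≤ w a b) → IsNetwork (block w (λ _ _ → 0ℚ))
block-isNetwork w≥0 .IsNetwork.symmetric (inj₁ _) (inj₁ _) = refl
block-isNetwork w≥0 .IsNetwork.symmetric (inj₁ _) (inj₂ _) = refl
block-isNetwork w≥0 .IsNetwork.symmetric (inj₂ _) (inj₁ _) = refl
block-isNetwork w≥0 .IsNetwork.symmetric (inj₂ _) (inj₂ _) = refl
block-isNetwork w≥0 .IsNetwork.nonneg (inj₁ _) (inj₁ _) = ℚ.≤-refl
block-isNetwork w≥0 .IsNetwork.nonneg (inj₁ a) (inj₂ b) = w≥0 a b
block-isNetwork w≥0 .IsNetwork.nonneg (inj₂ b) (inj₁ a) = w≥0 a b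
block-isNetwork w≥0 .IsNetwork.nonneg (inj₂ _) (inj₂ _) = ℚ.≤-refl

-- Vertices that are not joined to each other are eliminated independently.
tau-block : (w : A → B → ℚ) (M : Weights B) (as : List A) (bs : List B) → bs ≢ [] →
  tau (block w M) (map inj₁ as ++ map inj₂ bs) ≡
    productOver as (λ a → sumOver bs (w a))
    * tau (λ b b′ → M b b′ + sumOver as (λ a → w a b * w a b′ * inv (sumOver bs (w a)))) bs
tau-block w M [] bs ne = trans (tau-map inj₂ (block w M) bs)
  (trans (tau-cong′ bs λ b b′ → sym (+-identityʳ (M b b′))) (sym (*-identityˡ _)))
tau-block w M (a ∷ as) []           ne = contradiction refl ne
tau-block {A = A} {B = B} w M (a ∷ as) bs@(b₀ ∷ bs₀) ne = begin
  tau (block w M) (inj₁ a ∷ vs)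
    ≡⟨ tau-∷ (block w M) (inj₁ a) vs (∷ʳ≢[] (map inj₁ as) (inj₂ b₀) (map inj₂ bs₀)) ⟩
  conductance (block w M) (inj₁ a) vs * tau (starMesh (block w M) (inj₁ a) vs) vs
    ≡⟨ cong₂ _*_ s≡ (trans (tau-cong′ vs mesh) (tau-block w M′ as bs ne)) ⟩
  σ * (productOver as (λ a → sumOver bs (w a)) * tau _ bs)
    ≡⟨ sym (*-assoc σ _ _) ⟩
  σ * productOver as (λ a → sumOver bs (w a)) * tau _ bs
    ≡⟨ cong (σ * productOver as (λ a → sumOver bs (w a)) *_) (tau-cong′ bs λ b b′ → +-assoc (M b b′) _ _) ⟩
  σ * productOver as (λ a → sumOver bs (w a)) * tau _ bs ∎
  where
  open ≡-Reasoning
  vs = map inj₁ as ++ map inj₂ bs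
  σ = sumOver bs (w a)
  M′ : Weights B
  M′ b b′ = M b b′ + w a b * w a b′ * inv σ
  s≡ : conductance (block w M) (inj₁ a) vs ≡ σ
  s≡ = trans (sum-++ (map inj₁ as) (map inj₂ bs) (block w M (inj₁ a)))
    (trans (cong₂ _+_ (trans (sum-map as inj₁ (block w M (inj₁ a))) (sum-0 as λ _ _ → refl))
                      (sum-map bs inj₂ (block w M (inj₁ a))))
           (+-identityˡ σ))
  mesh : ∀ x y → starMesh (block w M) (inj₁ a) vs x y ≡ block w M′ x y
  mesh (inj₁ x) y        = trans (cong (λ u → block w M (inj₁ x) y + u * i) (*-zeroˡ (block w M (inj₁ a) y)))
                             (trans (trans (cong (block w M (inj₁ x) y +_) (*-zeroˡ i)) (+-identityʳ _)) (same y))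
    where
    i = inv (conductance (block w M) (inj₁ a) vs)
    same : ∀ y → block w M (inj₁ x) y ≡ block w M′ (inj₁ x) y
    same (inj₁ _) = refl
    same (inj₂ _) = refl
  mesh (inj₂ b) (inj₁ x) = trans (cong (λ u → w x b + u * i) (*-zeroʳ (w a b)))
                             (trans (cong (w x b +_) (*-zeroˡ i)) (+-identityʳ (w x b)))
    where i = inv (conductance (block w M) (inj₁ a) vs)
  mesh (inj₂ b) (inj₂ b′) = cong (λ s → M b b′ + w a b * w a b′ * inv s) s≡

-- Sums and products picked out by indicators.

δ-sym : (p q : Fin n) → δ p q ≡ δ q p
δ-sym p q = cong 𝟙 (does-⇔ (mk⇔ sym sym) (p Fin.≟ q) (q Fin.≟ p))

sum-δ : ∀ {vs : List (Fin n)} {a} → Unique vs → a ∈ vs → (f : Fin n → ℚ) → sumOver vs (λ v → f v * δ v a) ≡ f a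
sum-δ {vs = v ∷ vs} (v∉ ∷ _) (here refl) f =
  trans (cong₂ _+_ (trans (cong (f v *_) (δ-refl v)) (*-identityʳ (f v)))
                   (sum-0 vs λ u u∈ → trans (cong (f u *_) (δ-≢ (All.lookup v∉ u∈ ∘ sym))) (*-zeroʳ (f u))))
        (+-identityʳ (f v))
sum-δ {vs = v ∷ vs} {a} (v∉ ∷ un) (there a∈) f =
  trans (cong₂ _+_ (trans (cong (f v *_) (δ-≢ (All.lookup v∉ a∈))) (*-zeroʳ (f v))) (sum-δ un a∈ f))
        (+-identityˡ (f a))

sum-allFin-δ : (f : Fin n → ℚ) (a : Fin n) → sumOver (allFin n) (λ v → f v * δ v a) ≡ f a
sum-allFin-δ f a = sum-δ (allFin⁺ _) (∈-allFin a) f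

δ-transport : (f : Fin n → ℚ) (a u : Fin n) → f u * δ a u ≡ f a * δ a u
δ-transport f a u with a Fin.≟ u
... | yes refl = refl
... | no  _    = trans (*-zeroʳ (f u)) (sym (*-zeroʳ (f a)))

δ-disjoint : ∀ {p q : Fin n} → p ≢ q → ∀ a → δ a p * δ a q ≡ 0ℚ
δ-disjoint {p = p} {q} p≢q a with a Fin.≟ p
... | yes refl = trans (cong (1ℚ *_) (δ-≢ p≢q)) refl
... | no  _    = *-zeroˡ (δ a q)

sum-cartesian : (xs : List A) (ys : List B) (f : A × B → ℚ) →
                sumOver (cartesianProduct xs ys) f ≡ sumOver xs (λ x → sumOver ys (λ y → f (x , y)))
sum-cartesian []       ys f = refl
sum-cartesian (x ∷ xs) ys f = trans (sum-++ (map (x ,_) ys) (cartesianProduct xs ys) f)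
  (cong₂ _+_ (sum-map ys (x ,_) f) (sum-cartesian xs ys f))

if-then : Bool → ℚ → ℚ
if-then b q = if b then q else 1ℚ

𝟙-⊎ : (p? : Dec P) (q? : Dec Q) → (P → Q → ⊥) → 𝟙 (does (p? ⊎-dec q?)) ≡ 𝟙 (does p?) + 𝟙 (does q?)
𝟙-⊎ (yes p) (yes q) ¬pq = contradiction q (¬pq p)
𝟙-⊎ (yes p) (no _)  ¬pq = refl
𝟙-⊎ (no _)  (yes q) ¬pq = refl
𝟙-⊎ (no _)  (no _)  ¬pq = refl

if-then-⊎ : (p? : Dec P) (q? : Dec Q) → (P → Q → ⊥) → ∀ q →
            if-then (does (p? ⊎-dec q?)) q ≡ if-then (does p?) q * if-then (does q?) q
if-then-⊎ (yes p) (yes q) ¬pq x = contradiction q (¬pq p)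
if-then-⊎ (yes p) (no _)  ¬pq x = sym (*-identityʳ x)
if-then-⊎ (no _)  (yes q) ¬pq x = sym (*-identityˡ x)
if-then-⊎ (no _)  (no _)  ¬pq x = refl

prod-if-≢ : ∀ {a : Fin n} vs (f : Fin n → ℚ) → All (a ≢_) vs → productOver vs (λ v → if-then (does (v Fin.≟ a)) (f v)) ≡ 1ℚ
prod-if-≢ {a = a} vs f a∉ = prod-1 vs λ v v∈ → cong (λ b → if-then b (f v)) (dec-false (v Fin.≟ a) (All.lookup a∉ v∈ ∘ sym))

prod-if-≡ : ∀ {vs : List (Fin n)} {a} → Unique vs → a ∈ vs → (f : Fin n → ℚ) →
            productOver vs (λ v → if-then (does (v Fin.≟ a)) (f v)) ≡ f a
prod-if-≡ {vs = v ∷ vs} (v∉ ∷ _) (here refl) f =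
  trans (cong₂ _*_ (cong (λ b → if-then b (f v)) (dec-true (v Fin.≟ v) refl)) (prod-if-≢ vs f v∉)) (*-identityʳ (f v))
prod-if-≡ {vs = v ∷ vs} {a} (v∉ ∷ un) (there a∈) f =
  trans (cong₂ _*_ (cong (λ b → if-then b (f v)) (dec-false (v Fin.≟ a) (All.lookup v∉ a∈))) (prod-if-≡ un a∈ f)) (*-identityˡ (f a))

prod-if-filter : {R : A → Set} (R? : ∀ x → Dec (R x)) (q : ℚ) (xs : List A) →
                 productOver xs (λ x → if-then (does (R? x)) q) ≡ q ^ length (filter R? xs)
prod-if-filter R? q []       = refl
prod-if-filter R? q (x ∷ xs) with does (R? x)
... | true  = cong (q *_) (prod-if-filter R? q xs)
... | false = trans (*-identityˡ _) (prod-if-filter R? q xs)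

-- The line graph as a reduction of the barycentric subdivision.

^ℤ-minus-2 : ∀ {q} k → q ≢ 0ℚ → q ^ℤ (ℤ.+ k ℤ.- ℤ.+ 2) * (q * q) ≡ q ^ k
^ℤ-minus-2 {q} zero q≢0 = trans (solve 2 (λ q i → i :* (i :* con 1ℚ) :* (q :* q) := (q :* i) :* (q :* i)) refl q (inv q))
  (trans (cong₂ _*_ (inv-inverseʳ q q≢0) (inv-inverseʳ q q≢0)) (*-identityˡ 1ℚ))
^ℤ-minus-2 {q} (suc zero) q≢0 = trans (solve 2 (λ q i → i :* con 1ℚ :* (q :* q) := (q :* i) :* q) refl q (inv q))
  (trans (cong (_* q) (inv-inverseʳ q q≢0)) (*-comm 1ℚ q))
^ℤ-minus-2 {q} (suc (suc k)) q≢0 = solve 2 (λ q p → p :* (q :* q) := q :* (q :* p)) refl q (q ^ k)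

-- The degrees are a parameter d, and not fromℕ ∘ degree H: when that unfolds to
-- normalised fractions, type checking runs out of memory.
module LineGraph (H : Graph) (d : V H → ℚ) (d-degree : ∀ v → d v ≡ fromℕ (degree H v)) where

  inc : V H → E H → ℚ
  inc v e = 𝟙 (does (incident? H v e))

  ends : E H → V H × V H
  ends e = lookup (edges H) e

  resistance : E H → ℚ
  resistance e = inv (d (end₁ H e)) + inv (d (end₂ H e))

  ends-≢ : ∀ e → end₁ H e ≢ end₂ H e
  ends-≢ e = All.lookup (loopless H) (∈-lookup e)

  inc-δ : ∀ v e → inc v e ≡ δ (end₁ H e) v + δ (end₂ H e) v
  inc-δ v e = trans (𝟙-⊎ (v Fin.≟ end₁ H e) (v Fin.≟ end₂ H e) λ p q → ends-≢ e (trans (sym p) q))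
                    (cong₂ _+_ (δ-sym v (end₁ H e)) (δ-sym v (end₂ H e)))

  degree-sum : ∀ v → d v ≡ sumOver (allFin (size H)) (inc v)
  degree-sum v = trans (d-degree v) (fromℕ-length-filter (incident? H v) (allFin (size H)))

  -- Double counting of incident pairs: after the two products are exchanged, `d v` occurs once for
  -- every edge at `v`.
  handshake : productOver (allFin (size H)) (λ e → d (end₁ H e) * d (end₂ H e)) ≡ productOver (vertices H) (λ v → d v ^ degree H v)
  handshake = begin
    productOver (allFin (size H)) (λ e → d (end₁ H e) * d (end₂ H e))
      ≡⟨ prod-cong (allFin (size H)) (λ e _ → sym (per-edge e)) ⟩
    productOver (allFin (size H)) (λ e → productOver (vertices H) (λ v → if-then (does (incident? H v e)) (d v)))
      ≡⟨ prod-swap (allFin (size H)) (vertices H) (λ e v → if-then (does (incident? H v e)) (d v)) ⟩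
    productOver (vertices H) (λ v → productOver (allFin (size H)) (λ e → if-then (does (incident? H v e)) (d v)))
      ≡⟨ prod-cong (vertices H) (λ v _ → prod-if-filter (incident? H v) (d v) (allFin (size H))) ⟩
    productOver (vertices H) (λ v → d v ^ degree H v) ∎
    where
    open ≡-Reasoning
    per-edge : ∀ e → productOver (vertices H) (λ v → if-then (does (incident? H v e)) (d v)) ≡ d (end₁ H e) * d (end₂ H e)
    per-edge e = trans (prod-cong (vertices H) (λ v _ → if-then-⊎ (v Fin.≟ end₁ H e) (v Fin.≟ end₂ H e) (λ p q → ends-≢ e (trans (sym p) q)) (d v)))
      (trans (prod-* (vertices H) (λ v → if-then (does (v Fin.≟ end₁ H e)) (d v)) (λ v → if-then (does (v Fin.≟ end₂ H e)) (d v)))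
             (cong₂ _*_ (prod-if-≡ (allFin⁺ _) (∈-allFin (end₁ H e)) d) (prod-if-≡ (allFin⁺ _) (∈-allFin (end₂ H e)) d)))

  common : E H → E H → ℚ
  common e f = sumOver (vertices H) (λ v → inc v e * inc v f)

  -- `link` reads an edge of `L H` in both orientations. The triples are restricted to a smaller
  -- first edge, so only the orientation from `e` to `f` contributes, once for each common end.
  line-network : ∀ {e f} → e Fin.< f → network id (λ _ → 1ℚ) (edges (L H)) e f ≡ common e f
  line-network {e} {f} e<f = begin
    sumOver (map proj₁ (filter (adjacency? H) (triples H))) (λ l → 1ℚ * link l e f)
      ≡⟨ sum-map (filter (adjacency? H) (triples H)) proj₁ _ ⟩
    sumOver (filter (adjacency? H) (triples H)) (λ x → 1ℚ * link (proj₁ x) e f)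
      ≡⟨ sum-filter (adjacency? H) (triples H) _ ⟩
    sumOver (triples H) (λ x → 𝟙 (does (adjacency? H x)) * (1ℚ * link (proj₁ x) e f))
      ≡⟨ sum-cartesian (cartesianProduct es es) (vertices H) _ ⟩
    sumOver (cartesianProduct es es) (λ p → sumOver (vertices H) (λ v → 𝟙 (does (adjacency? H (p , v))) * (1ℚ * link p e f)))
      ≡⟨ sum-cartesian es es _ ⟩
    sumOver es (λ a → sumOver es (λ b → sumOver (vertices H) (λ v → 𝟙 (does (adjacency? H ((a , b) , v))) * (1ℚ * link (a , b) e f))))
      ≡⟨ sum-cong′ es (λ a → sum-cong′ es (λ b → trans (sum-*ʳ (1ℚ * link (a , b) e f) (vertices H) _) (factor a b))) ⟩
    sumOver es (λ a → sumOver es (λ b → (F a b * δ b f) * δ a e + (F a b * δ b e) * δ a f))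
      ≡⟨ sum-cong′ es (λ a → trans (sum-+ es _ _) (cong₂ _+_
           (trans (sum-*ʳ (δ a e) es _) (cong (_* δ a e) (sum-allFin-δ (F a) f)))
           (trans (sum-*ʳ (δ a f) es _) (cong (_* δ a f) (sum-allFin-δ (F a) e))))) ⟩
    sumOver es (λ a → F a f * δ a e + F a e * δ a f)
      ≡⟨ trans (sum-+ es _ _) (cong₂ _+_ (sum-allFin-δ (λ a → F a f) e) (sum-allFin-δ (λ a → F a e) f)) ⟩
    F e f + F f e
      ≡⟨ cong₂ _+_ (sum-cong′ (vertices H) F-ef) (sum-0 (vertices H) λ v _ → F-fe v) ⟩
    common e f + 0ℚ
      ≡⟨ +-identityʳ (common e f) ⟩
    common e f ∎
    where
    open ≡-Reasoning
    es = allFin (size H)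
    F : E H → E H → ℚ
    F a b = sumOver (vertices H) (λ v → 𝟙 (does (adjacency? H ((a , b) , v))))
    factor : ∀ a b → F a b * (1ℚ * link (a , b) e f) ≡ (F a b * δ b f) * δ a e + (F a b * δ b e) * δ a f
    factor a b = solve 5 (λ F ae bf af be → F :* (con 1ℚ :* (ae :* bf :+ af :* be)) := (F :* bf) :* ae :+ (F :* be) :* af)
      refl (F a b) (δ a e) (δ b f) (δ a f) (δ b e)
    F-ef : ∀ v → 𝟙 (does (adjacency? H ((e , f) , v))) ≡ inc v e * inc v f
    F-ef v = trans (cong (λ b → 𝟙 (b ∧ does (incident? H v e) ∧ does (incident? H v f))) (dec-true (toℕ e ℕ.<? toℕ f) e<f))
                   (𝟙-∧ (does (incident? H v e)) (does (incident? H v f)))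
    F-fe : ∀ v → 𝟙 (does (adjacency? H ((f , e) , v))) ≡ 0ℚ
    F-fe v = cong (λ b → 𝟙 (b ∧ does (incident? H v f) ∧ does (incident? H v e))) (dec-false (toℕ f ℕ.<? toℕ e) (ℕ.<-asym e<f))

  module _ (d≢0 : ∀ v → d v ≢ 0ℚ) (v₀ : V H) (e₀ : E H) where

    private
      es = allFin (size H)
      vs = vertices H

      d≥0 : ∀ v → 0ℚ ≤ d v
      d≥0 v = subst (0ℚ ≤_) (sym (d-degree v)) (fromℕ-nonneg (degree H v))

      d>0 : ∀ v → 0ℚ < d v
      d>0 v = ≥0∧≢0⇒>0 (d≥0 v) (d≢0 v)

      w : V H → E H → ℚ
      w v e = d v * inc v e

      ne : ∀ {xs : List A} {x} → x ∈ xs → xs ≢ []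
      ne () refl

      vertex-sum : ∀ v → sumOver es (w v) ≡ d v * d v
      vertex-sum v = trans (sum-*ˡ (d v) es (inc v)) (cong (d v *_) (sym (degree-sum v)))

      edge-sum : ∀ e → sumOver vs (λ v → w v e) ≡ d (end₁ H e) + d (end₂ H e)
      edge-sum e = trans (sum-cong′ vs λ v → trans (cong (d v *_) (trans (inc-δ v e) (cong₂ _+_ (δ-sym (end₁ H e) v) (δ-sym (end₂ H e) v))))
                                                    (*-distribˡ-+ (d v) (δ v (end₁ H e)) (δ v (end₂ H e))))
        (trans (sum-+ vs _ _) (cong₂ _+_ (sum-allFin-δ d (end₁ H e)) (sum-allFin-δ d (end₂ H e))))

      N : Weights (V H)
      N = network ends (inv ∘ resistance) es

      d₁d₂R : ∀ e → (d (end₁ H e) * d (end₂ H e)) * resistance e ≡ d (end₁ H e) + d (end₂ H e)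
      d₁d₂R e = trans (solve 4 (λ a b i j → (a :* b) :* (i :+ j) := (a :* i) :* b :+ a :* (b :* j)) refl a b (inv a) (inv b))
        (trans (cong₂ (λ u v → u * b + a * v) (inv-inverseʳ a (d≢0 _)) (inv-inverseʳ b (d≢0 _)))
               (solve 2 (λ a b → con 1ℚ :* b :+ a :* con 1ℚ := a :+ b) refl a b))
        where
        a = d (end₁ H e)
        b = d (end₂ H e)

      star-edges : tau (block w (λ _ _ → 0ℚ)) (map inj₁ vs ++ map inj₂ es) ≡ productOver vs (λ v → d v * d v) * fromℕ (t (L H))
      star-edges = trans (tau-block w (λ _ _ → 0ℚ) vs es (ne (∈-allFin e₀)))
        (cong₂ _*_ (prod-cong vs λ v _ → vertex-sum v)
          (trans (tau-cong (AllPairs.map (λ {e} {f} e<f → trans (+-identityˡ _)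
                   (trans (sum-cong′ vs λ v → per-vertex v e f) (sym (line-network e<f)))) increasing))
                 (sym (t-tau (L H)))))
        where
        -- `tau` reads a weight only from an earlier to a later list entry; these are the pairs
        -- `e < f` that `line-network` covers.
        increasing : AllPairs Fin._<_ es
        increasing = AllPairs.tabulate⁺-< id
        per-vertex : ∀ v e f → w v e * w v f * inv (sumOver es (w v)) ≡ inc v e * inc v f
        per-vertex v e f = trans (cong (λ s → w v e * w v f * inv s) (vertex-sum v))
          (trans (solve 4 (λ d x y i → (d :* x) :* (d :* y) :* i := x :* y :* ((d :* d) :* i)) refl (d v) (inc v e) (inc v f) (inv (d v * d v)))
          (trans (cong (inc v e * inc v f *_) (inv-inverseʳ (d v * d v) (*-≢0 (d≢0 v) (d≢0 v)))) (*-identityʳ _)))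

      -- The order of elimination is free, so the edges may go first. Exchanging the two summands of
      -- the vertex type by `swap` lets `tau-block` serve for this elimination as well.
      star-vertices : tau (block w (λ _ _ → 0ℚ)) (map inj₁ vs ++ map inj₂ es) ≡ productOver es (λ e → d (end₁ H e) + d (end₂ H e)) * tau N vs
      star-vertices = begin
        tau W (map inj₁ vs ++ map inj₂ es)
          ≡⟨ tau-↭ (block-isNetwork λ v e → *-nonneg (d≥0 v) (𝟙-nonneg (does (incident? H v e)))) (++-comm (map inj₁ vs) (map inj₂ es)) ⟩
        tau W (map inj₂ es ++ map inj₁ vs)
          ≡⟨ cong (tau W) (sym (trans (map-++ swap (map inj₁ es) (map inj₂ vs)) (cong₂ _++_ (sym (map-∘ es)) (sym (map-∘ vs))))) ⟩
        tau W (map swap (map inj₁ es ++ map inj₂ vs))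
          ≡⟨ tau-map swap W (map inj₁ es ++ map inj₂ vs) ⟩
        tau (λ x y → W (swap x) (swap y)) (map inj₁ es ++ map inj₂ vs)
          ≡⟨ tau-cong′ (map inj₁ es ++ map inj₂ vs) swapped ⟩
        tau (block (λ e v → w v e) (λ _ _ → 0ℚ)) (map inj₁ es ++ map inj₂ vs)
          ≡⟨ tau-block (λ e v → w v e) (λ _ _ → 0ℚ) es vs (ne (∈-allFin v₀)) ⟩
        productOver es (λ e → sumOver vs (λ v → w v e)) * tau _ vs
          ≡⟨ cong₂ _*_ (prod-cong es λ e _ → edge-sum e)
               (tau-cong (AllPairs.map (λ {u} {v} u≢v → trans (+-identityˡ _) (sum-cong′ es λ e → per-edge e u≢v)) (allFin⁺ (order H)))) ⟩
        productOver es (λ e → d (end₁ H e) + d (end₂ H e)) * tau N vs ∎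
        where
        open ≡-Reasoning
        W = block w (λ _ _ → 0ℚ)
        swapped : ∀ x y → W (swap x) (swap y) ≡ block (λ e v → w v e) (λ _ _ → 0ℚ) x y
        swapped (inj₁ _) (inj₁ _) = refl
        swapped (inj₁ _) (inj₂ _) = refl
        swapped (inj₂ _) (inj₁ _) = refl
        swapped (inj₂ _) (inj₂ _) = refl
        per-edge : ∀ e {u v} → u ≢ v → w u e * w v e * inv (sumOver vs (λ v → w v e)) ≡ inv (resistance e) * link (ends e) u v
        per-edge e {u} {v} u≢v = begin
          w u e * w v e * inv (sumOver vs (λ v → w v e))
            ≡⟨ cong₂ _*_ (cong₂ _*_ (at u) (at v)) (cong inv (edge-sum e)) ⟩
          (da * δ a u + db * δ b u) * (da * δ a v + db * δ b v) * inv (da + db)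
            -- Products of two indicators at the same end are separated off; they vanish because `u`
            -- and `v` differ, and the remainder is the link.
            ≡⟨ solve 7 (λ x y au av bu bv i →
                 (x :* au :+ y :* bu) :* (x :* av :+ y :* bv) :* i
                 := ((x :* y) :* i) :* (au :* bv :+ av :* bu) :+ (x :* x :* i) :* (au :* av) :+ (y :* y :* i) :* (bu :* bv))
                 refl da db (δ a u) (δ a v) (δ b u) (δ b v) (inv (da + db)) ⟩
          da * db * inv (da + db) * link (a , b) u v + da * da * inv (da + db) * (δ a u * δ a v) + db * db * inv (da + db) * (δ b u * δ b v)
            ≡⟨ cong₂ (λ x y → da * db * inv (da + db) * link (a , b) u v + da * da * inv (da + db) * x + db * db * inv (da + db) * y)
                     (δ-disjoint u≢v a) (δ-disjoint u≢v b) ⟩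
          da * db * inv (da + db) * link (a , b) u v + da * da * inv (da + db) * 0ℚ + db * db * inv (da + db) * 0ℚ
            ≡⟨ solve 3 (λ x y z → x :+ y :* con 0ℚ :+ z :* con 0ℚ := x) refl
                 (da * db * inv (da + db) * link (a , b) u v) (da * da * inv (da + db)) (db * db * inv (da + db)) ⟩
          da * db * inv (da + db) * link (a , b) u v
            ≡⟨ cong (_* link (a , b) u v) (sym (inv-unique (resistance e) (da * db * inv (da + db)) inverse)) ⟩
          inv (resistance e) * link (ends e) u v ∎
          where
          a = end₁ H e
          b = end₂ H e
          da = d a
          db = d b
          at : ∀ v → w v e ≡ da * δ a v + db * δ b v
          at v = trans (cong (d v *_) (inc-δ v e))
            (trans (*-distribˡ-+ (d v) (δ a v) (δ b v)) (cong₂ _+_ (δ-transport d a v) (δ-transport d b v)))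
          inverse : resistance e * (da * db * inv (da + db)) ≡ 1ℚ
          inverse = trans (solve 3 (λ r p i → r :* (p :* i) := (p :* r) :* i) refl (resistance e) (da * db) (inv (da + db)))
            (trans (cong (_* inv (da + db)) (d₁d₂R e)) (inv-inverseʳ (da + db) (>0⇒≢0 (+-positive (d>0 a) (d>0 b)))))

    -- Two evaluations of the same network are compared, and the product of `d v * d v`, nonzero
    -- since no degree is zero, is cancelled.
    line-graph-trees : fromℕ (t (L H)) ≡
      productOver vs (λ v → d v ^ℤ (ℤ.+ degree H v ℤ.- ℤ.+ 2)) * (productOver es resistance * tau N vs)
    line-graph-trees = *-cancelˡ (prod-≢0 vs) (begin
      productOver vs (λ v → d v * d v) * fromℕ (t (L H))
        ≡⟨ trans (sym star-edges) star-vertices ⟩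
      productOver es (λ e → d (end₁ H e) + d (end₂ H e)) * tau N vs
        ≡⟨ cong (_* tau N vs) (trans (prod-cong es λ e _ → sym (d₁d₂R e)) (trans (prod-* es (λ e → d (end₁ H e) * d (end₂ H e)) resistance) (cong (_* productOver es resistance) handshake))) ⟩
      productOver vs (λ v → d v ^ degree H v) * productOver es resistance * tau N vs
        ≡⟨ cong (λ u → u * productOver es resistance * tau N vs)
                (trans (prod-cong vs λ v _ → sym (^ℤ-minus-2 (degree H v) (d≢0 v))) (prod-* vs (λ v → d v ^ℤ (ℤ.+ degree H v ℤ.- ℤ.+ 2)) (λ v → d v * d v))) ⟩
      Π * productOver vs (λ v → d v * d v) * productOver es resistance * tau N vs
        ≡⟨ solve 4 (λ p q r t → p :* q :* r :* t := q :* (p :* (r :* t))) refl Π (productOver vs (λ v → d v * d v)) (productOver es resistance) (tau N vs) ⟩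
      productOver vs (λ v → d v * d v) * (Π * (productOver es resistance * tau N vs)) ∎)
      where
      open ≡-Reasoning
      Π = productOver vs (λ v → d v ^ℤ (ℤ.+ degree H v ℤ.- ℤ.+ 2))
      prod-≢0 : ∀ xs → productOver xs (λ v → d v * d v) ≢ 0ℚ
      prod-≢0 []       = ℚ.1≢0
      prod-≢0 (v ∷ xs) = *-≢0 (*-≢0 (d≢0 v) (d≢0 v)) (prod-≢0 xs)

sum-lookup : (xs : List A) (f : A → ℚ) → sumOver (allFin (length xs)) (f ∘ lookup xs) ≡ sumOver xs f
sum-lookup xs f = trans (sym (sum-map (allFin (length xs)) (lookup xs) f))
  (cong (λ ys → sumOver ys f) (trans (map-tabulate id (lookup xs)) (tabulate-lookup xs)))

prod-lookup : (xs : List A) (f : A → ℚ) → productOver (allFin (length xs)) (f ∘ lookup xs) ≡ productOver xs f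
prod-lookup xs f = trans (sym (prod-map (allFin (length xs)) (lookup xs) f))
  (cong (λ ys → productOver ys f) (trans (map-tabulate id (lookup xs)) (tabulate-lookup xs)))

Unique-++⁻ : (xs : List A) {ys : List A} → Unique (xs ++ ys) → Unique ys × (∀ {x y} → x ∈ xs → y ∈ ys → x ≢ y)
Unique-++⁻ []       un = un , λ ()
Unique-++⁻ (x ∷ xs) (x∉ ∷ un) with Unique-++⁻ xs un
... | un′ , dis = un′ , λ { (here refl) y∈ → All.lookup x∉ (∈-++⁺ʳ xs y∈) ; (there x∈) y∈ → dis x∈ y∈ }

-- Series reduction of paths.

Weighted : ℕ → Set
Weighted n = (Fin n × Fin n) × ℚ

resistive : List (Weighted n) → Weights (Fin n)
resistive = network proj₁ (inv ∘ proj₂)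

-- The edge from a vertex a to a vertex b has resistance q a + q b, except that
-- the first edge of a path may have absorbed eliminated vertices into ρ.
module SeriesReduction {n : ℕ} (q : Fin n → ℚ) (q>0 : ∀ v → 0ℚ < q v) where

  next : List (Fin n) → Fin n → Fin n
  next []      v = v
  next (x ∷ _) v = x

  later : List (Fin n) → Fin n → List (Weighted n)
  later []       v = []
  later (x ∷ xs) v = ((x , next xs v) , q x + q (next xs v)) ∷ later xs v

  path : Fin n → ℚ → List (Fin n) → Fin n → List (Weighted n)
  path u ρ xs v = ((u , next xs v) , ρ + q (next xs v)) ∷ later xs v

  pathResistance : ℚ → List (Fin n) → Fin n → ℚ
  pathResistance ρ xs v = ρ + sumOver xs (λ x → q x + q x) + q v

  path-consecutive : ∀ u xs v → path u (q u) xs v ≡ map (λ e → e , q (proj₁ e) + q (proj₂ e)) (consecutive (u ∷ xs ++ [ v ]))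
  path-consecutive u []       v = refl
  path-consecutive u (x ∷ xs) v = cong (((u , x) , q u + q x) ∷_) (path-consecutive x xs v)

  later-vanishes : ∀ xs v {x} → (∀ {y} → y ∈ xs → y ≢ x) → v ≢ x → ∀ z → resistive (later xs v) x z ≡ 0ℚ
  later-vanishes []       v h v≢x z = refl
  later-vanishes (y ∷ xs) v {x} h v≢x z =
    trans (cong₂ (λ l s → inv (q y + q (next xs v)) * l + s) (link-≢ (h (here refl)) (next≢ xs (h ∘ there)) z)
                                     (later-vanishes xs v (h ∘ there) v≢x z))
          (trans (+-identityʳ _) (*-zeroʳ (inv (q y + q (next xs v)))))
    where
    next≢ : ∀ xs → (∀ {y} → y ∈ xs → y ≢ x) → next xs v ≢ x
    next≢ []      h = v≢x
    next≢ (_ ∷ _) h = h (here refl)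

  path-vanishes : ∀ u ρ xs v {x} → u ≢ x → (∀ {y} → y ∈ xs → y ≢ x) → v ≢ x → ∀ z → resistive (path u ρ xs v) x z ≡ 0ℚ
  path-vanishes u ρ []       v u≢x h v≢x z =
    trans (cong (λ l → inv (ρ + q v) * l + 0ℚ) (link-≢ u≢x v≢x z)) (trans (+-identityʳ _) (*-zeroʳ (inv (ρ + q v))))
  path-vanishes u ρ (y ∷ xs) v u≢x h v≢x z =
    trans (cong₂ (λ l s → inv (ρ + q y) * l + s) (link-≢ u≢x (h (here refl)) z) (later-vanishes (y ∷ xs) v h v≢x z))
          (trans (+-identityʳ _) (*-zeroʳ (inv (ρ + q y))))

  next-∈ : ∀ xs {v vs} → v ∈ vs → next xs v ∈ xs ++ vs
  next-∈ []      v∈ = v∈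
  next-∈ (_ ∷ _) v∈ = here refl

  module Elimination (u x h : Fin n) (R₁ R₂ : ℚ) (R₁>0 : 0ℚ < R₁) (R₂>0 : 0ℚ < R₂) (K : Weights (Fin n)) (vs : List (Fin n))
    (unique : Unique (x ∷ vs)) (u∈ : u ∈ vs) (h∈ : h ∈ vs) (K-x : ∀ z → K x z ≡ 0ℚ) where

    private
      x∉ : ∀ {z} → z ∈ vs → x ≢ z
      x∉ = All.lookup (AllPairs.head unique)
      g₁ = inv R₁
      g₂ = inv R₂
      s = g₁ + g₂
      s≢0 : s ≢ 0ℚ
      s≢0 = >0⇒≢0 (+-positive (inv-positive R₁>0) (inv-positive R₂>0))
      e₁ : R₁ * g₁ ≡ 1ℚ
      e₁ = inv-inverseʳ R₁ (>0⇒≢0 R₁>0)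
      e₂ : R₂ * g₂ ≡ 1ℚ
      e₂ = inv-inverseʳ R₂ (>0⇒≢0 R₂>0)

      W : Weights (Fin n)
      W a b = (g₁ * link (u , x) a b + (g₂ * link (x , h) a b + K a b))

      W-x : ∀ z → W x z ≡ g₁ * δ z u + g₂ * δ z h
      W-x z = trans (cong₂ (λ l k → g₁ * l + (g₂ * link (x , h) x z + k)) left (K-x z))
        (trans (cong (λ l → g₁ * δ z u + (g₂ * l + 0ℚ)) right) (cong (g₁ * δ z u +_) (+-identityʳ _)))
        where
        left : link (u , x) x z ≡ δ z u
        left = trans (cong₂ (λ a b → a * δ x z + δ u z * b) (δ-≢ (x∉ u∈ ∘ sym)) (δ-refl x))
          (trans (solve 2 (λ a b → con 0ℚ :* a :+ b :* con 1ℚ := b) refl (δ x z) (δ u z)) (δ-sym u z))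
        right : link (x , h) x z ≡ δ z h
        right = trans (cong₂ (λ a b → a * δ h z + δ x z * b) (δ-refl x) (δ-≢ (x∉ h∈ ∘ sym)))
          (trans (solve 2 (λ a b → con 1ℚ :* a :+ b :* con 0ℚ := a) refl (δ h z) (δ x z)) (δ-sym h z))

      s≡ : conductance W x vs ≡ s
      s≡ = trans (sum-cong′ vs W-x) (trans (sum-+ vs _ _)
        (cong₂ _+_ (sum-δ (AllPairs.tail unique) u∈ (λ _ → g₁)) (sum-δ (AllPairs.tail unique) h∈ (λ _ → g₂))))

      parallel : inv (R₁ + R₂) ≡ g₁ * g₂ * inv s
      parallel = inv-unique (R₁ + R₂) (g₁ * g₂ * inv s)
        (trans (solve 5 (λ R₁ R₂ g₁ g₂ i → (R₁ :+ R₂) :* (g₁ :* g₂ :* i) := ((R₁ :* g₁) :* g₂ :+ (R₂ :* g₂) :* g₁) :* i) refl R₁ R₂ g₁ g₂ (inv s))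
        (trans (cong₂ (λ a b → (a * g₂ + b * g₁) * inv s) e₁ e₂)
        (trans (solve 3 (λ g₁ g₂ i → (con 1ℚ :* g₂ :+ con 1ℚ :* g₁) :* i := (g₁ :+ g₂) :* i) refl g₁ g₂ (inv s)) (inv-inverseʳ s s≢0))))

      mesh : ∀ {a b} → x ≢ a → x ≢ b → a ≢ b → starMesh W x vs a b ≡ inv (R₁ + R₂) * link (u , h) a b + K a b
      mesh {a} {b} x≢a x≢b a≢b = begin
        g₁ * link (u , x) a b + (g₂ * link (x , h) a b + K a b) + W x a * W x b * inv (conductance W x vs)
          ≡⟨ cong₂ (λ l m → g₁ * l + (g₂ * m + K a b) + W x a * W x b * inv (conductance W x vs)) far₁ far₂ ⟩
        g₁ * 0ℚ + (g₂ * 0ℚ + K a b) + W x a * W x b * inv (conductance W x vs)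
          ≡⟨ cong₂ (λ p i → g₁ * 0ℚ + (g₂ * 0ℚ + K a b) + p * inv i) (cong₂ _*_ (W-x′ a) (W-x′ b)) s≡ ⟩
        g₁ * 0ℚ + (g₂ * 0ℚ + K a b) + (g₁ * δ u a + g₂ * δ h a) * (g₁ * δ u b + g₂ * δ h b) * inv s
          ≡⟨ solve 8 (λ g₁ g₂ k ua ub ha hb i →
               g₁ :* con 0ℚ :+ (g₂ :* con 0ℚ :+ k) :+ (g₁ :* ua :+ g₂ :* ha) :* (g₁ :* ub :+ g₂ :* hb) :* i
               := (g₁ :* g₂ :* i) :* (ua :* hb :+ ub :* ha) :+ k :+ (g₁ :* g₁ :* i) :* (ua :* ub) :+ (g₂ :* g₂ :* i) :* (ha :* hb))
               refl g₁ g₂ (K a b) (δ u a) (δ u b) (δ h a) (δ h b) (inv s) ⟩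
        (g₁ * g₂ * inv s) * link (u , h) a b + K a b + (g₁ * g₁ * inv s) * (δ u a * δ u b) + (g₂ * g₂ * inv s) * (δ h a * δ h b)
          ≡⟨ cong₂ (λ y z → (g₁ * g₂ * inv s) * link (u , h) a b + K a b + (g₁ * g₁ * inv s) * y + (g₂ * g₂ * inv s) * z)
                   (δ-disjoint a≢b u) (δ-disjoint a≢b h) ⟩
        (g₁ * g₂ * inv s) * link (u , h) a b + K a b + (g₁ * g₁ * inv s) * 0ℚ + (g₂ * g₂ * inv s) * 0ℚ
          ≡⟨ solve 3 (λ x y z → x :+ y :* con 0ℚ :+ z :* con 0ℚ := x) refl
               ((g₁ * g₂ * inv s) * link (u , h) a b + K a b) (g₁ * g₁ * inv s) (g₂ * g₂ * inv s) ⟩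
        (g₁ * g₂ * inv s) * link (u , h) a b + K a b
          ≡⟨ cong (λ i → i * link (u , h) a b + K a b) (sym parallel) ⟩
        inv (R₁ + R₂) * link (u , h) a b + K a b ∎
        where
        open ≡-Reasoning
        W-x′ : ∀ z → W x z ≡ g₁ * δ u z + g₂ * δ h z
        W-x′ z = trans (W-x z) (cong₂ (λ y y′ → g₁ * y + g₂ * y′) (δ-sym z u) (δ-sym z h))
        far₁ : link (u , x) a b ≡ 0ℚ
        far₁ = trans (cong₂ (λ y z → δ u a * y + δ u b * z) (δ-≢ x≢b) (δ-≢ x≢a))
                     (solve 2 (λ y z → y :* con 0ℚ :+ z :* con 0ℚ := con 0ℚ) refl (δ u a) (δ u b))
        far₂ : link (x , h) a b ≡ 0ℚ
        far₂ = trans (cong₂ (λ y z → z * δ h b + y * δ h a) (δ-≢ x≢b) (δ-≢ x≢a))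
                     (solve 2 (λ y z → con 0ℚ :* y :+ con 0ℚ :* z := con 0ℚ) refl (δ h b) (δ h a))

    -- With conductances `g₁` and `g₂` at `x`, the factor `R₁ * R₂ * (g₁ + g₂)` equals `R₁ + R₂`,
    -- and the mesh weight `g₁ * g₂ * inv (g₁ + g₂)` is the inverse of `R₁ + R₂`. So the product of
    -- resistances times `tau` keeps its shape when two edges in series become one.
    eliminate : R₁ * R₂ * tau W (x ∷ vs) ≡ (R₁ + R₂) * tau (λ a b → inv (R₁ + R₂) * link (u , h) a b + K a b) vs
    eliminate = begin
      R₁ * R₂ * tau W (x ∷ vs)
        ≡⟨ cong (R₁ * R₂ *_) (tau-∷ W x vs (nonempty u∈)) ⟩
      R₁ * R₂ * (conductance W x vs * tau (starMesh W x vs) vs)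
        ≡⟨ cong₂ (λ c y → R₁ * R₂ * (c * y)) s≡
             (tau-cong (AllPairs.map (λ (x≢a , x≢b , a≢b) → mesh x≢a x≢b a≢b) (AllPairs-zip (AllPairs.head unique) (AllPairs.tail unique)))) ⟩
      R₁ * R₂ * (s * T)
        ≡⟨ solve 5 (λ R₁ R₂ g₁ g₂ t → R₁ :* R₂ :* ((g₁ :+ g₂) :* t) := ((R₁ :* g₁) :* R₂ :+ (R₂ :* g₂) :* R₁) :* t) refl R₁ R₂ g₁ g₂ T ⟩
      ((R₁ * g₁) * R₂ + (R₂ * g₂) * R₁) * T
        ≡⟨ cong₂ (λ a b → (a * R₂ + b * R₁) * T) e₁ e₂ ⟩
      (1ℚ * R₂ + 1ℚ * R₁) * T
        ≡⟨ solve 3 (λ R₁ R₂ t → (con 1ℚ :* R₂ :+ con 1ℚ :* R₁) :* t := (R₁ :+ R₂) :* t) refl R₁ R₂ T ⟩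
      (R₁ + R₂) * T ∎
      where
      open ≡-Reasoning
      T = tau (λ a b → inv (R₁ + R₂) * link (u , h) a b + K a b) vs
      nonempty : ∀ {z : Fin n} {zs} → z ∈ zs → zs ≢ []
      nonempty () refl

  -- Eliminating the first interior vertex `x` adds `ρ + q x` and `q x + q h`, which gives the first
  -- edge of a shorter path with `ρ + (q x + q x)` in place of `ρ`. As `M` vanishes at the interior
  -- vertices, each is joined only to its two neighbours on the path.
  series-path : ∀ xs u ρ v vs (M : Weights (Fin n)) → 0ℚ < ρ → Unique (xs ++ vs) → u ∈ vs → v ∈ vs →
    (∀ {x} → x ∈ xs → ∀ z → M x z ≡ 0ℚ) →
    productOver (path u ρ xs v) proj₂ * tau (λ a b → resistive (path u ρ xs v) a b + M a b) (xs ++ vs) ≡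
      pathResistance ρ xs v * tau (λ a b → inv (pathResistance ρ xs v) * link (u , v) a b + M a b) vs
  series-path [] u ρ v vs M ρ>0 un u∈ v∈ M-0 =
    cong₂ _*_ (trans (*-identityʳ (ρ + q v)) ρ≡)
              (tau-cong′ vs λ a b → cong (_+ M a b) (trans (+-identityʳ _) (cong (λ y → inv y * link (u , v) a b) ρ≡)))
    where
    ρ≡ : ρ + q v ≡ ρ + 0ℚ + q v
    ρ≡ = cong (_+ q v) (sym (+-identityʳ ρ))
  series-path (x ∷ xs) u ρ v vs M ρ>0 un@(x∉ ∷ un′) u∈ v∈ M-0 = begin
    R₁ * (R₂ * T) * tau (λ a b → resistive (path u ρ (x ∷ xs) v) a b + M a b) (x ∷ xs ++ vs)
      ≡⟨ cong₂ _*_ (solve 3 (λ a b c → a :* (b :* c) := (a :* b) :* c) refl R₁ R₂ T)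
           (tau-cong′ (x ∷ xs ++ vs) λ a b → solve 4 (λ a b c d → a :+ (b :+ c) :+ d := a :+ (b :+ (c :+ d))) refl
              (inv R₁ * link (u , x) a b) (inv R₂ * link (x , h) a b) (resistive (later xs v) a b) (M a b)) ⟩
    R₁ * R₂ * T * tau (λ a b → inv R₁ * link (u , x) a b + (inv R₂ * link (x , h) a b + K a b)) (x ∷ xs ++ vs)
      ≡⟨ solve 3 (λ p t y → p :* t :* y := t :* (p :* y)) refl (R₁ * R₂) T _ ⟩
    T * (R₁ * R₂ * tau (λ a b → inv R₁ * link (u , x) a b + (inv R₂ * link (x , h) a b + K a b)) (x ∷ xs ++ vs))
      ≡⟨ cong (T *_) (Elimination.eliminate u x h R₁ R₂ (+-positive ρ>0 (q>0 x)) (+-positive (q>0 x) (q>0 h)) K (xs ++ vs) un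
                        (∈-++⁺ʳ xs u∈) (next-∈ xs v∈) K-x) ⟩
    T * ((R₁ + R₂) * tau (λ a b → inv (R₁ + R₂) * link (u , h) a b + K a b) (xs ++ vs))
      ≡⟨ cong (λ r → T * (r * tau (λ a b → inv r * link (u , h) a b + K a b) (xs ++ vs))) R≡ ⟩
    T * (R * tau (λ a b → inv R * link (u , h) a b + K a b) (xs ++ vs))
      ≡⟨ trans (solve 3 (λ t r y → t :* (r :* y) := r :* t :* y) refl T R _)
               (cong (R * T *_) (tau-cong′ (xs ++ vs) λ a b → sym (+-assoc (inv R * link (u , h) a b) (resistive (later xs v) a b) (M a b)))) ⟩
    productOver (path u ρ′ xs v) proj₂ * tau (λ a b → resistive (path u ρ′ xs v) a b + M a b) (xs ++ vs)
      ≡⟨ series-path xs u ρ′ v vs M (+-positive ρ>0 (+-positive (q>0 x) (q>0 x))) un′ u∈ v∈ (M-0 ∘ there) ⟩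
    pathResistance ρ′ xs v * tau (λ a b → inv (pathResistance ρ′ xs v) * link (u , v) a b + M a b) vs
      ≡⟨ cong (λ r → r * tau (λ a b → inv r * link (u , v) a b + M a b) vs) (cong (_+ q v) (+-assoc ρ (q x + q x) _)) ⟩
    pathResistance ρ (x ∷ xs) v * tau (λ a b → inv (pathResistance ρ (x ∷ xs) v) * link (u , v) a b + M a b) vs ∎
    where
    open ≡-Reasoning
    h = next xs v
    R₁ = ρ + q x
    R₂ = q x + q h
    ρ′ = ρ + (q x + q x)
    R = ρ′ + q h
    T = productOver (later xs v) proj₂
    K : Weights (Fin n)
    K a b = resistive (later xs v) a b + M a b
    R≡ : R₁ + R₂ ≡ R
    R≡ = solve 3 (λ r x h → r :+ x :+ (x :+ h) := r :+ (x :+ x) :+ h) refl ρ (q x) (q h)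
    K-x : ∀ z → K x z ≡ 0ℚ
    K-x z = trans (cong₂ _+_ (later-vanishes xs v (λ y∈ → All.lookup x∉ (∈-++⁺ˡ y∈) ∘ sym) (All.lookup x∉ (∈-++⁺ʳ xs v∈) ∘ sym) z)
                             (M-0 (here refl) z)) (+-identityˡ 0ℚ)

  module _ {X : Set} (start finish : X → Fin n) (interior : X → List (Fin n)) where

    pathOf : X → List (Weighted n)
    pathOf e = path (start e) (q (start e)) (interior e) (finish e)

    ρ : X → ℚ
    ρ e = pathResistance (q (start e)) (interior e) (finish e)

    -- `M` holds the paths that are already reduced to single edges. It stays zero at the interior
    -- vertices still to come, since the reduced edges have their ends in `vs`.
    series-paths : ∀ es vs (M : Weights (Fin n)) → Unique (concatMap interior es ++ vs) →
      (∀ e → start e ∈ vs) → (∀ e → finish e ∈ vs) →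
      (∀ {x} → x ∈ concatMap interior es → ∀ z → M x z ≡ 0ℚ) →
      productOver es (λ e → productOver (pathOf e) proj₂)
        * tau (λ a b → sumOver es (λ e → resistive (pathOf e) a b) + M a b) (concatMap interior es ++ vs) ≡
      productOver es ρ * tau (λ a b → network (λ e → start e , finish e) (inv ∘ ρ) es a b + M a b) vs
    series-paths []       vs M un s∈ f∈ M-0 = refl
    series-paths (e ∷ es) vs M un s∈ f∈ M-0 = begin
      (Π * Πs) * tau (λ a b → N a b + Ns a b + M a b) ((interior e ++ concatMap interior es) ++ vs)
        ≡⟨ cong (Π * Πs *_) (trans (cong (tau _) (++-assoc (interior e) (concatMap interior es) vs))
             (tau-cong′ (interior e ++ vs₁) λ a b → +-assoc (N a b) (Ns a b) (M a b))) ⟩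
      (Π * Πs) * tau (λ a b → N a b + (Ns a b + M a b)) (interior e ++ vs₁)
        ≡⟨ solve 3 (λ a b c → a :* b :* c := b :* (a :* c)) refl Π Πs _ ⟩
      Πs * (Π * tau (λ a b → N a b + (Ns a b + M a b)) (interior e ++ vs₁))
        ≡⟨ cong (Πs *_) (series-path (interior e) (start e) (q (start e)) (finish e) vs₁ (λ a b → Ns a b + M a b)
             (q>0 (start e)) un₁ (∈-++⁺ʳ (concatMap interior es) (s∈ e)) (∈-++⁺ʳ (concatMap interior es) (f∈ e)) rest-0) ⟩
      Πs * (ρ e * tau (λ a b → inv (ρ e) * link (start e , finish e) a b + (Ns a b + M a b)) vs₁)
        ≡⟨ trans (solve 3 (λ a b c → a :* (b :* c) := b :* (a :* c)) refl Πs (ρ e) _)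
             (cong (λ y → ρ e * (Πs * y)) (tau-cong′ vs₁ λ a b →
                solve 3 (λ a b c → a :+ (b :+ c) := b :+ (a :+ c)) refl (inv (ρ e) * link (start e , finish e) a b) (Ns a b) (M a b))) ⟩
      ρ e * (Πs * tau (λ a b → Ns a b + M′ a b) vs₁)
        ≡⟨ cong (ρ e *_) (series-paths es vs M′ (proj₁ (Unique-++⁻ (interior e) un₁)) s∈ f∈ M′-0) ⟩
      ρ e * (productOver es ρ * tau (λ a b → network (λ e → start e , finish e) (inv ∘ ρ) es a b + M′ a b) vs)
        ≡⟨ trans (sym (*-assoc (ρ e) _ _)) (cong (ρ e * productOver es ρ *_) (tau-cong′ vs λ a b →
             solve 3 (λ a b c → b :+ (a :+ c) := a :+ b :+ c) refl (inv (ρ e) * link (start e , finish e) a b)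
               (network (λ e → start e , finish e) (inv ∘ ρ) es a b) (M a b))) ⟩
      ρ e * productOver es ρ * tau (λ a b → network (λ e → start e , finish e) (inv ∘ ρ) (e ∷ es) a b + M a b) vs ∎
      where
      open ≡-Reasoning
      Π = productOver (pathOf e) proj₂
      Πs = productOver es (λ e → productOver (pathOf e) proj₂)
      N Ns M′ : Weights (Fin n)
      N a b = resistive (pathOf e) a b
      Ns a b = sumOver es (λ e → resistive (pathOf e) a b)
      M′ a b = inv (ρ e) * link (start e , finish e) a b + M a b
      vs₁ = concatMap interior es ++ vs
      un₁ : Unique (interior e ++ vs₁)
      un₁ = subst Unique (++-assoc (interior e) (concatMap interior es) vs) un
      apart : ∀ {x y} → x ∈ interior e → y ∈ vs₁ → x ≢ y
      apart = proj₂ (Unique-++⁻ (interior e) un₁)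
      rest-0 : ∀ {x} → x ∈ interior e → ∀ z → Ns x z + M x z ≡ 0ℚ
      rest-0 x∈ z = trans (cong₂ _+_
        (sum-0 es λ e′ e′∈ → path-vanishes (start e′) (q (start e′)) (interior e′) (finish e′)
          (λ eq → apart x∈ (∈-++⁺ʳ (concatMap interior es) (s∈ e′)) (sym eq))
          (λ y∈ eq → apart x∈ (∈-++⁺ˡ (∈-concatMap⁺ interior (lose e′∈ y∈))) (sym eq))
          (λ eq → apart x∈ (∈-++⁺ʳ (concatMap interior es) (f∈ e′)) (sym eq)) z)
        (M-0 (∈-++⁺ˡ x∈) z)) (+-identityˡ 0ℚ)
      M′-0 : ∀ {x} → x ∈ concatMap interior es → ∀ z → M′ x z ≡ 0ℚ
      M′-0 x∈ z = trans (cong₂ (λ l m → inv (ρ e) * l + m)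
        (link-≢ (λ eq → sep x∈ (s∈ e) (sym eq)) (λ eq → sep x∈ (f∈ e) (sym eq)) z) (M-0 (∈-++⁺ʳ (interior e) x∈) z))
        (trans (+-identityʳ _) (*-zeroʳ (inv (ρ e))))
        where
        sep : ∀ {x y} → x ∈ concatMap interior es → y ∈ vs → x ≢ y
        sep = proj₂ (Unique-++⁻ (concatMap interior es) (proj₁ (Unique-++⁻ (interior e) un₁)))

-- Vertices, degrees and resistances of the subdivided graph.

prod-↭ : {xs ys : List A} (f : A → ℚ) → xs ↭ ys → productOver xs f ≡ productOver ys f
prod-↭ f Perm.refl         = refl
prod-↭ f (Perm.prep x p)   = cong (f x *_) (prod-↭ f p)
prod-↭ f (Perm.trans p q)  = trans (prod-↭ f p) (prod-↭ f q)
prod-↭ f (Perm.swap {xs} {ys} x y p) =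
  trans (cong (λ s → f x * (f y * s)) (prod-↭ f p))
        (solve 3 (λ a b c → a :* (b :* c) := b :* (a :* c)) refl (f x) (f y) (productOver ys f))

fromℕ-injective : ∀ {k l} → fromℕ k ≡ fromℕ l → k ≡ l
fromℕ-injective {zero}  {zero}  _  = refl
fromℕ-injective {zero}  {suc l} eq = contradiction eq (ℚ.<⇒≢ (fromℕ-positive l))
fromℕ-injective {suc k} {zero}  eq = contradiction (sym eq) (ℚ.<⇒≢ (fromℕ-positive k))
fromℕ-injective {suc k} {suc l} eq = cong suc (fromℕ-injective (begin
  fromℕ k                     ≡⟨ cancel (fromℕ k) ⟩
  ℚ.- 1ℚ + (1ℚ + fromℕ k)   ≡⟨ cong (ℚ.- 1ℚ +_) (trans (sym (fromℕ-suc k)) (trans eq (fromℕ-suc l))) ⟩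
  ℚ.- 1ℚ + (1ℚ + fromℕ l)   ≡⟨ sym (cancel (fromℕ l)) ⟩
  fromℕ l                     ∎))
  where
  open ≡-Reasoning
  cancel : ∀ x → x ≡ ℚ.- 1ℚ + (1ℚ + x)
  cancel = solve 1 (λ x → x := con (ℚ.- 1ℚ) :+ (con 1ℚ :+ x)) refl

allFin-suc : ∀ n → allFin (suc n) ≡ zero ∷ map suc (allFin n)
allFin-suc n = cong (zero ∷_) (sym (map-tabulate id suc))

allFin-+ : ∀ n k → allFin (n ℕ.+ k) ≡ map (_↑ˡ k) (allFin n) ++ map (n ↑ʳ_) (allFin k)
allFin-+ zero    k = sym (map-id (allFin k))
allFin-+ (suc n) k = begin
  allFin (suc (n ℕ.+ k))
    ≡⟨ allFin-suc (n ℕ.+ k) ⟩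
  zero ∷ map suc (allFin (n ℕ.+ k))
    ≡⟨ cong (λ xs → zero ∷ map suc xs) (allFin-+ n k) ⟩
  zero ∷ map suc (map (_↑ˡ k) (allFin n) ++ map (n ↑ʳ_) (allFin k))
    ≡⟨ cong (zero ∷_) (map-++ suc (map (_↑ˡ k) (allFin n)) (map (n ↑ʳ_) (allFin k))) ⟩
  zero ∷ map suc (map (_↑ˡ k) (allFin n)) ++ map suc (map (n ↑ʳ_) (allFin k))
    ≡⟨ cong₂ (λ xs ys → zero ∷ xs ++ ys) (trans (sym (map-∘ (allFin n))) (map-∘ (allFin n))) (sym (map-∘ (allFin k))) ⟩
  map (_↑ˡ k) (zero ∷ map suc (allFin n)) ++ map (suc n ↑ʳ_) (allFin k)
    ≡⟨ cong (λ xs → map (_↑ˡ k) xs ++ map (suc n ↑ʳ_) (allFin k)) (sym (allFin-suc n)) ⟩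
  map (_↑ˡ k) (allFin (suc n)) ++ map (suc n ↑ʳ_) (allFin k) ∎
  where open ≡-Reasoning

allFin-* : ∀ m r → allFin (m ℕ.* r) ≡ concatMap (λ e → map (combine e) (allFin r)) (allFin m)
allFin-* zero    r = refl
allFin-* (suc m) r = begin
  allFin (r ℕ.+ m ℕ.* r)
    ≡⟨ allFin-+ r (m ℕ.* r) ⟩
  map (_↑ˡ (m ℕ.* r)) (allFin r) ++ map (r ↑ʳ_) (allFin (m ℕ.* r))
    ≡⟨ cong (λ xs → map (_↑ˡ (m ℕ.* r)) (allFin r) ++ map (r ↑ʳ_) xs) (allFin-* m r) ⟩
  map (_↑ˡ (m ℕ.* r)) (allFin r) ++ map (r ↑ʳ_) (concatMap (λ e → map (combine e) (allFin r)) (allFin m))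
    ≡⟨ cong (map (_↑ˡ (m ℕ.* r)) (allFin r) ++_) (trans (map-concatMap (r ↑ʳ_) (λ e → map (combine e) (allFin r)) (allFin m))
         (trans (concatMap-cong (λ e → sym (map-∘ (allFin r))) (allFin m)) (sym (concatMap-map (λ e → map (combine e) (allFin r)) suc (allFin m))))) ⟩
  concatMap (λ e → map (combine e) (allFin r)) (zero ∷ map suc (allFin m))
    ≡⟨ cong (concatMap (λ e → map (combine e) (allFin r))) (sym (allFin-suc m)) ⟩
  concatMap (λ e → map (combine e) (allFin r)) (allFin (suc m)) ∎
  where open ≡-Reasoning

-- Every interior vertex of a path lies on two consecutive edges and each end on one. This is the
-- source of degree 2 for new vertices and of unchanged degrees for old ones.
sum-consecutive : ∀ (z u : Fin n) xs v →
  sumOver (consecutive (u ∷ xs ++ [ v ])) (λ e → δ (proj₁ e) z + δ (proj₂ e) z) ≡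
    δ u z + sumOver xs (λ x → δ x z + δ x z) + δ v z
sum-consecutive z u []       v = solve 2 (λ u v → u :+ v :+ con 0ℚ := u :+ con 0ℚ :+ v) refl (δ u z) (δ v z)
sum-consecutive z u (x ∷ xs) v = trans (cong (δ u z + δ x z +_) (sum-consecutive z x xs v))
  (solve 4 (λ u x s v → u :+ x :+ (x :+ s :+ v) := u :+ (x :+ x :+ s) :+ v) refl
     (δ u z) (δ x z) (sumOver xs (λ x → δ x z + δ x z)) (δ v z))

degree-δ : ∀ H z → fromℕ (degree H z) ≡ sumOver (edges H) (λ e → δ (proj₁ e) z + δ (proj₂ e) z)
degree-δ H z = trans (degree-sum z) (trans (sum-cong′ (allFin (size H)) (inc-δ z))
                 (sum-lookup (edges H) (λ e → δ (proj₁ e) z + δ (proj₂ e) z)))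
  where open LineGraph H (λ v → fromℕ (degree H v)) (λ _ → refl)

module Subdivision (r : ℕ) (G : Graph) where

  H : Graph
  H = S r G

  interior : E G → List (V H)
  interior e = map (new r G e) (allFin r)

  interiors : List (V H)
  interiors = concatMap interior (allFin (size G))

  vertices-↭ : vertices H ↭ interiors ++ map (old r G) (vertices G)
  vertices-↭ = ↭-trans (↭-reflexive (allFin-+ (order G) (size G ℕ.* r)))
    (↭-trans (++-comm (map (_↑ˡ (size G ℕ.* r)) (allFin (order G))) (map (order G ↑ʳ_) (allFin (size G ℕ.* r))))
             (↭-reflexive (cong (_++ map (old r G) (vertices G)) interiors≡)))
    where
    interiors≡ : map (order G ↑ʳ_) (allFin (size G ℕ.* r)) ≡ interiors
    interiors≡ = trans (cong (map (order G ↑ʳ_)) (allFin-* (size G) r))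
      (trans (map-concatMap (order G ↑ʳ_) (λ e → map (combine e) (allFin r)) (allFin (size G)))
             (concatMap-cong (λ e → sym (map-∘ (allFin r))) (allFin (size G))))

  vertices-unique : Unique (interiors ++ map (old r G) (vertices G))
  vertices-unique = Unique-↭ vertices-↭ (allFin⁺ (order H))

  old-∈ : ∀ v → old r G v ∈ map (old r G) (vertices G)
  old-∈ v = ∈-map⁺ (old r G) (∈-allFin v)

  interior≢old : ∀ {x} v → x ∈ interiors → x ≢ old r G v
  interior≢old v x∈ = proj₂ (Unique-++⁻ interiors vertices-unique) x∈ (old-∈ v)

  δ-old : ∀ u v → δ (old r G u) (old r G v) ≡ δ u v
  δ-old u v = cong 𝟙 (does-⇔ (mk⇔ (Fin.↑ˡ-injective _ _ _) (cong (old r G))) (old r G u Fin.≟ old r G v) (u Fin.≟ v))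

  subdivided-degree : ∀ z → fromℕ (degree H z) ≡
    sumOver (allFin (size G)) (λ e → δ (old r G (end₁ G e)) z + sumOver (interior e) (λ x → δ x z + δ x z) + δ (old r G (end₂ G e)) z)
  subdivided-degree z = trans (degree-δ H z) (trans (sum-concatMap (allFin (size G)) (consecutive ∘ pathVertices r G) _)
    (sum-cong′ (allFin (size G)) λ e → sum-consecutive z (old r G (end₁ G e)) (interior e) (old r G (end₂ G e))))

  interior⊆ : ∀ {e x} → x ∈ interior e → x ∈ interiors
  interior⊆ {e} x∈ = ∈-concatMap⁺ interior (lose (∈-allFin e) x∈)

  degree-old : ∀ v → degree H (old r G v) ≡ degree G v
  degree-old v = fromℕ-injective (trans (subdivided-degree (old r G v))
    (trans (trans (sum-cong′ (allFin (size G)) λ e →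
              trans (cong₂ _+_ (cong₂ _+_ (δ-old (end₁ G e) v)
                      (sum-0 (interior e) λ x x∈ → cong (λ y → y + y) (δ-≢ (interior≢old v (interior⊆ {e} x∈)))))
                      (δ-old (end₂ G e) v))
                    (cong (_+ δ (end₂ G e) v) (+-identityʳ (δ (end₁ G e) v))))
             (sum-lookup (edges G) (λ e → δ (proj₁ e) v + δ (proj₂ e) v)))
           (sym (degree-δ G v))))

  degree-interior : ∀ {z} → z ∈ interiors → degree H z ≡ 2
  degree-interior {z} z∈ = fromℕ-injective (trans (subdivided-degree z)
    (trans (sum-cong′ (allFin (size G)) λ e →
       trans (cong₂ (λ a b → a + sumOver (interior e) (λ x → δ x z + δ x z) + b) (δ-old-z (end₁ G e)) (δ-old-z (end₂ G e)))
             (trans (+-identityʳ _) (+-identityˡ _)))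
    (trans (sym (sum-concatMap (allFin (size G)) interior (λ x → δ x z + δ x z)))
    (trans (sum-+ interiors (λ x → δ x z) (λ x → δ x z)) (cong (λ y → y + y) (trans (sum-cong′ interiors λ x → sym (*-identityˡ (δ x z)))
      (sum-δ (unique-++ˡ interiors vertices-unique) z∈ (λ _ → 1ℚ))))))))
    where
    δ-old-z : ∀ v → δ (old r G v) z ≡ 0ℚ
    δ-old-z v = δ-≢ (interior≢old v z∈ ∘ sym)
    unique-++ˡ : ∀ xs {ys : List (V H)} → Unique (xs ++ ys) → Unique xs
    unique-++ˡ []       un        = []
    unique-++ˡ (x ∷ xs) (p ∷ un) = All.++⁻ˡ xs p ∷ unique-++ˡ xs un

  module _ (d : V H → ℚ) (d-degree : ∀ z → d z ≡ fromℕ (degree H z))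
           (g : V G → ℚ) (g-degree : ∀ v → g v ≡ fromℕ (degree G v))
           (g≢0 : ∀ v → g v ≢ 0ℚ) (v₀ : V G) where

    resistance : E G → ℚ
    resistance e = fromℕ r + (inv (g (end₁ G e)) + inv (g (end₂ G e)))

    private
      open LineGraph H d d-degree using (line-graph-trees) renaming (resistance to R; ends to endsH)

      q : V H → ℚ
      q = inv ∘ d

      d-old : ∀ v → d (old r G v) ≡ g v
      d-old v = trans (d-degree (old r G v)) (trans (cong fromℕ (degree-old v)) (sym (g-degree v)))

      d-interior : ∀ {z} → z ∈ interiors → d z ≡ fromℕ 2
      d-interior {z} z∈ = trans (d-degree z) (cong fromℕ (degree-interior z∈))

      d≢0 : ∀ z → d z ≢ 0ℚ
      d≢0 z = go (∈-++⁻ interiors (∈-resp-↭ vertices-↭ (∈-allFin z)))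
        where
        transfer : ∀ {x y} → x ≡ y → y ≢ 0ℚ → x ≢ 0ℚ
        transfer refl ne = ne
        2≢0 : fromℕ 2 ≢ 0ℚ
        2≢0 = >0⇒≢0 {fromℕ 2} (fromℕ-positive 1)
        go : z ∈ interiors ⊎ z ∈ map (old r G) (vertices G) → d z ≢ 0ℚ
        go (inj₁ z∈) = transfer (d-interior z∈) 2≢0
        go (inj₂ z∈) = let v , _ , z≡ = ∈-map⁻ (old r G) z∈ in transfer (trans (cong d z≡) (d-old v)) (g≢0 v)

      q>0 : ∀ z → 0ℚ < q z
      q>0 z = inv-positive (≥0∧≢0⇒>0 (subst (0ℚ ≤_) (sym (d-degree z)) (fromℕ-nonneg (degree H z))) (d≢0 z))

      open SeriesReduction q q>0

      e₀ : E H
      e₀ = some (filter (incident? H (old r G v₀)) (allFin (size H)))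
                (λ e → d≢0 (old r G v₀) (trans (d-degree (old r G v₀)) (cong fromℕ e)))
        where
        some : (xs : List A) → length xs ≢ 0 → A
        some []      ne = contradiction refl ne
        some (x ∷ _) _  = x

      s f : E G → V H
      s e = old r G (end₁ G e)
      f e = old r G (end₂ G e)

      vs : List (V H)
      vs = map (old r G) (vertices G)

      es : List (E G)
      es = allFin (size G)

      Rₚ : V H × V H → ℚ
      Rₚ (a , b) = q a + q b

      resistances : productOver (allFin (size H)) R ≡ productOver es (λ e → productOver (pathOf s f interior e) proj₂)
      resistances = trans (prod-lookup (edges H) Rₚ) (trans (prod-concatMap es (consecutive ∘ pathVertices r G) Rₚ)
        (prod-cong es λ e _ → trans (sym (prod-map (consecutive (pathVertices r G e)) (λ p → p , Rₚ p) proj₂))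
           (cong (λ ps → productOver ps proj₂) (sym (path-consecutive (s e) (interior e) (f e))))))

      conductances : ∀ a b → network endsH (inv ∘ R) (allFin (size H)) a b ≡ sumOver es (λ e → resistive (pathOf s f interior e) a b)
      conductances a b = trans (sum-lookup (edges H) (λ p → inv (Rₚ p) * link p a b))
        (trans (sum-concatMap es (consecutive ∘ pathVertices r G) _)
        (sum-cong′ es λ e → trans (sym (sum-map (consecutive (pathVertices r G e)) (λ p → p , Rₚ p) (λ p → inv (proj₂ p) * link (proj₁ p) a b)))
           (cong (λ ps → resistive ps a b) (sym (path-consecutive (s e) (interior e) (f e))))))

      R>0 : ∀ e → 0ℚ < R e
      R>0 e = +-positive (q>0 _) (q>0 _)

      ρ≡ : ∀ e → ρ s f interior e ≡ resistance e
      ρ≡ e = trans (cong₂ _+_ (cong₂ _+_ (cong inv (d-old (end₁ G e))) inner) (cong inv (d-old (end₂ G e))))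
                   (solve 3 (λ a r b → a :+ r :+ b := r :+ (a :+ b)) refl (inv (g (end₁ G e))) (fromℕ r) (inv (g (end₂ G e))))
        where
        -- A new vertex has degree 2, so it contributes 1/2 + 1/2 = 1 to the resistance; the `r` new
        -- vertices together give the term `r`.
        inner : sumOver (interior e) (λ x → q x + q x) ≡ fromℕ r
        inner = trans (sum-cong (interior e) λ x x∈ → cong (λ y → inv y + inv y) (d-interior (interior⊆ {e} x∈)))
          (trans (sum-map (allFin r) (new r G e) (λ _ → 1ℚ))
          (trans (sym (fromℕ-length (allFin r))) (cong fromℕ (length-tabulate {n = r} id))))

      to-G : ∀ a b → network (λ e → s e , f e) (inv ∘ ρ s f interior) es (old r G a) (old r G b) + 0ℚ ≡
                     network (lookup (edges G)) (inv ∘ resistance) es a b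
      to-G a b = trans (+-identityʳ _) (sum-cong′ es λ e → cong₂ (λ x y → inv x * y) (ρ≡ e)
        (cong₂ _+_ (cong₂ _*_ (δ-old (end₁ G e) a) (δ-old (end₂ G e) b)) (cong₂ _*_ (δ-old (end₁ G e) b) (δ-old (end₂ G e) a))))

      reduce : productOver (allFin (size H)) R * tau (network endsH (inv ∘ R) (allFin (size H))) (vertices H) ≡
               productOver es resistance * tau (network (lookup (edges G)) (inv ∘ resistance) es) (vertices G)
      reduce = begin
        productOver (allFin (size H)) R * tau (network endsH (inv ∘ R) (allFin (size H))) (vertices H)
          ≡⟨ cong₂ _*_ resistances (trans
               (tau-↭ (network-isNetwork endsH (allFin (size H)) λ e → ℚ.<⇒≤ (inv-positive (R>0 e))) vertices-↭)
               (tau-cong′ (interiors ++ vs) λ a b → trans (conductances a b) (sym (+-identityʳ _)))) ⟩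
        productOver es (λ e → productOver (pathOf s f interior e) proj₂)
          * tau (λ a b → sumOver es (λ e → resistive (pathOf s f interior e) a b) + 0ℚ) (interiors ++ vs)
          ≡⟨ series-paths s f interior es vs (λ _ _ → 0ℚ) vertices-unique (λ e → old-∈ (end₁ G e)) (λ e → old-∈ (end₂ G e)) (λ _ _ → refl) ⟩
        productOver es (ρ s f interior) * tau (λ a b → network (λ e → s e , f e) (inv ∘ ρ s f interior) es a b + 0ℚ) vs
          ≡⟨ cong₂ _*_ (prod-cong es λ e _ → ρ≡ e) (trans (tau-map (old r G) _ (vertices G)) (tau-cong′ (vertices G) to-G)) ⟩
        productOver es resistance * tau (network (lookup (edges G)) (inv ∘ resistance) es) (vertices G) ∎
        where open ≡-Reasoning

      degrees : productOver (vertices H) (λ z → d z ^ℤ (ℤ.+ degree H z ℤ.- ℤ.+ 2)) ≡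
                productOver (vertices G) (λ v → g v ^ℤ (ℤ.+ degree G v ℤ.- ℤ.+ 2))
      degrees = trans (prod-↭ F vertices-↭) (trans (prod-++ interiors vs F)
        -- Degree 2 means exponent 0, so the new vertices contribute the factor 1.
        (trans (cong₂ _*_ (prod-1 interiors λ z z∈ → cong (λ k → d z ^ℤ (ℤ.+ k ℤ.- ℤ.+ 2)) (degree-interior z∈))
                          (trans (prod-map (vertices G) (old r G) F)
                                 (prod-cong (vertices G) λ v _ → cong₂ (λ x k → x ^ℤ (ℤ.+ k ℤ.- ℤ.+ 2)) (d-old v) (degree-old v))))
               (*-identityˡ _)))
        where
        F : V H → ℚ
        F z = d z ^ℤ (ℤ.+ degree H z ℤ.- ℤ.+ 2)

    subdivision-trees : fromℕ (t (L H)) ≡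
      productOver (vertices G) (λ v → g v ^ℤ (ℤ.+ degree G v ℤ.- ℤ.+ 2))
      * (productOver (allFin (size G)) resistance * tau (network (lookup (edges G)) (inv ∘ resistance) (allFin (size G))) (vertices G))
    subdivision-trees = trans (line-graph-trees d≢0 (old r G v₀) e₀) (cong₂ _*_ degrees reduce)

-- Expansion over the edge sets.

subsetSum-linear : (xs : List A) (g h : List A → ℚ) (a b : ℚ) (w y : A → ℚ) →
  subsetSum xs (λ s → a * g s + b * h s) w y ≡ a * subsetSum xs g w y + b * subsetSum xs h w y
subsetSum-linear []       g h a b w y = refl
subsetSum-linear (x ∷ xs) g h a b w y =
  trans (cong₂ (λ u v → w x * u + y x * v) (subsetSum-linear xs (g ∘ (x ∷_)) (h ∘ (x ∷_)) a b w y) (subsetSum-linear xs g h a b w y))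
        (solve 8 (λ a b w y g₁ h₁ g₀ h₀ → w :* (a :* g₁ :+ b :* h₁) :+ y :* (a :* g₀ :+ b :* h₀)
                   := a :* (w :* g₁ :+ y :* g₀) :+ b :* (w :* h₁ :+ y :* h₀)) refl a b (w x) (y x)
           (subsetSum xs (g ∘ (x ∷_)) w y) (subsetSum xs (h ∘ (x ∷_)) w y) (subsetSum xs g w y) (subsetSum xs h w y))

𝟏 : A → ℚ
𝟏 _ = 1ℚ

-- In the product of the y x + z x over the x outside a selection s, the chosen terms
-- y x extend s to the selection of the outer sum.
subsetSum-nested : (xs : List A) (g : List A → ℚ) (y z : A → ℚ) →
  subsetSum xs (λ s → subsetSum s g 𝟏 y) 𝟏 z ≡ subsetSum xs g 𝟏 (λ x → y x + z x)
subsetSum-nested []       g y z = refl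
subsetSum-nested (x ∷ xs) g y z =
  trans (cong₂ (λ u v → 1ℚ * u + z x * v)
               (trans (subsetSum-linear xs (λ s → subsetSum s (g ∘ (x ∷_)) 𝟏 y) (λ s → subsetSum s g 𝟏 y) 1ℚ (y x) 𝟏 z)
                      (cong₂ (λ u v → 1ℚ * u + y x * v) (subsetSum-nested xs (g ∘ (x ∷_)) y z) (subsetSum-nested xs g y z)))
               (subsetSum-nested xs g y z))
        (solve 4 (λ y z u v → con 1ℚ :* (con 1ℚ :* u :+ y :* v) :+ z :* v := con 1ℚ :* u :+ (y :+ z) :* v) refl
           (y x) (z x) (subsetSum xs (g ∘ (x ∷_)) 𝟏 (λ x → y x + z x)) (subsetSum xs g 𝟏 (λ x → y x + z x)))

-- The resistance of a selected element cancels against its inverse weight; the resistances of the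
-- others survive.
subsetSum-inv : (xs : List A) (g : List A → ℚ) (ρ : A → ℚ) → (∀ x → ρ x ≢ 0ℚ) →
  productOver xs ρ * subsetSum xs g (inv ∘ ρ) 𝟏 ≡ subsetSum xs g 𝟏 ρ
subsetSum-inv []       g ρ ρ≢0 = *-identityˡ (g [])
subsetSum-inv (x ∷ xs) g ρ ρ≢0 =
  trans (solve 5 (λ r i p u v → (r :* p) :* (i :* u :+ con 1ℚ :* v) := (r :* i) :* (p :* u) :+ r :* (p :* v)) refl
           (ρ x) (inv (ρ x)) (productOver xs ρ) (subsetSum xs (g ∘ (x ∷_)) (inv ∘ ρ) 𝟏) (subsetSum xs g (inv ∘ ρ) 𝟏))
  (cong₂ _+_ (cong₂ _*_ (inv-inverseʳ (ρ x) (ρ≢0 x)) (subsetSum-inv xs (g ∘ (x ∷_)) ρ ρ≢0))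
             (cong (ρ x *_) (subsetSum-inv xs g ρ ρ≢0)))

subsetSum-map : (xs : List A) (h : A → B) (g : List B → ℚ) → subsetSum (map h xs) g 𝟏 𝟏 ≡ subsetSum xs (g ∘ map h) 𝟏 𝟏
subsetSum-map []       h g = refl
subsetSum-map (x ∷ xs) h g = cong₂ (λ u v → 1ℚ * u + 1ℚ * v) (subsetSum-map xs h (g ∘ (h x ∷_))) (subsetSum-map xs h g)

subsetSum-short : (xs : List A) (g : List A → ℚ) (w y : A → ℚ) →
  (∀ s → length s ℕ.≤ length xs → g s ≡ 0ℚ) → subsetSum xs g w y ≡ 0ℚ
subsetSum-short []       g w y h = h [] ℕ.z≤n
subsetSum-short (x ∷ xs) g w y h =
  trans (cong₂ (λ u v → w x * u + y x * v) (subsetSum-short xs (g ∘ (x ∷_)) w y λ s l → h (x ∷ s) (ℕ.s≤s l))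
                                           (subsetSum-short xs g w y λ s l → h s (ℕ.m≤n⇒m≤1+n l)))
        (solve 2 (λ a b → a :* con 0ℚ :+ b :* con 0ℚ := con 0ℚ) refl (w x) (y x))

-- A spanning tree on `n` vertices has `n - 1` edges; the successor on the left avoids truncated
-- subtraction.
ConcentratedAt : ℕ → (List A → ℚ) → Set
ConcentratedAt n g = ∀ s → g s ≡ 0ℚ ⊎ suc (length s) ≡ n

concentrated-short : ∀ {n} (xs : List A) (g : List A → ℚ) (w y : A → ℚ) →
  ConcentratedAt n g → suc (length xs) ℕ.< n → subsetSum xs g w y ≡ 0ℚ
concentrated-short xs g w y conc lt = subsetSum-short xs g w y λ s l → vanish s l (conc s)
  where
  vanish : ∀ s → length s ℕ.≤ length xs → g s ≡ 0ℚ ⊎ suc (length s) ≡ _ → g s ≡ 0ℚ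
  vanish s l (inj₁ e)    = e
  vanish s l (inj₂ refl) = contradiction (ℕ.s≤s l) (ℕ.<⇒≱ lt)

concentrated-∷ : ∀ {n} {x : A} {g : List A → ℚ} → ConcentratedAt (suc n) g → ConcentratedAt n (g ∘ (x ∷_))
concentrated-∷ {x = x} conc s with conc (x ∷ s)
... | inj₁ e = inj₁ e
... | inj₂ e = inj₂ (ℕ.suc-injective e)

-- All selections that contribute have the same size, so each leaves out exactly `k` elements and
-- `r ^ k` is a common factor. For `r` zero and `k` zero this factor is 1.
concentrated-power : ∀ n k (xs : List A) (g : List A → ℚ) (r : ℚ) → ConcentratedAt n g → suc (length xs) ≡ n ℕ.+ k →
  subsetSum xs g 𝟏 (λ _ → r) ≡ subsetSum xs g 𝟏 𝟏 * r ^ k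
concentrated-power n k [] g r conc l≡ = base (conc [])
  where
  base : g [] ≡ 0ℚ ⊎ 1 ≡ n → g [] ≡ g [] * r ^ k
  base (inj₁ e)    = trans e (trans (sym (*-zeroˡ (r ^ k))) (cong (_* r ^ k) (sym e)))
  base (inj₂ refl) = trans (sym (*-identityʳ (g []))) (cong (λ k → g [] * r ^ k) (ℕ.suc-injective l≡))
concentrated-power zero k (x ∷ xs) g r conc l≡ =
  trans (subsetSum-0 (x ∷ xs) 𝟏 (λ _ → r) g≡0)
        (sym (trans (cong (_* r ^ k) (subsetSum-0 (x ∷ xs) 𝟏 𝟏 g≡0)) (*-zeroˡ (r ^ k))))
  where
  g≡0 : ∀ s → g s ≡ 0ℚ
  g≡0 s with conc s
  ... | inj₁ e = e
-- Here only the full list has the right length. Once `x` is left out the remaining selections are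
-- too short, so that branch vanishes with either weight.
concentrated-power (suc n) zero (x ∷ xs) g r conc l≡ =
  trans (cong₂ (λ u v → 1ℚ * u + r * v) (concentrated-power n zero xs (g ∘ (x ∷_)) r (concentrated-∷ {x = x} {g} conc) (ℕ.suc-injective l≡))
                                         (short (λ _ → r)))
    (trans (solve 2 (λ u r → con 1ℚ :* (u :* con 1ℚ) :+ r :* con 0ℚ := (con 1ℚ :* u :+ con 1ℚ :* con 0ℚ) :* con 1ℚ) refl
              (subsetSum xs (g ∘ (x ∷_)) 𝟏 𝟏) r)
           (cong (λ v → (1ℚ * subsetSum xs (g ∘ (x ∷_)) 𝟏 𝟏 + 1ℚ * v) * 1ℚ) (sym (short 𝟏))))
  where
  short : ∀ y → subsetSum xs g 𝟏 y ≡ 0ℚ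
  short y = concentrated-short xs g 𝟏 y conc (ℕ.≤-reflexive (trans l≡ (ℕ.+-identityʳ (suc n))))
concentrated-power (suc n) (suc k) (x ∷ xs) g r conc l≡ =
  trans (cong₂ (λ u v → 1ℚ * u + r * v) (concentrated-power n (suc k) xs (g ∘ (x ∷_)) r (concentrated-∷ {x = x} {g} conc) (ℕ.suc-injective l≡))
                                         (concentrated-power (suc n) k xs g r conc (trans (ℕ.suc-injective l≡) (ℕ.+-suc n k))))
        (solve 4 (λ u v r p → con 1ℚ :* (u :* (r :* p)) :+ r :* (v :* p) := (con 1ℚ :* u :+ con 1ℚ :* v) :* (r :* p)) refl
           (subsetSum xs (g ∘ (x ∷_)) 𝟏 𝟏) (subsetSum xs g 𝟏 𝟏) r (r ^ k))

-- If the list is too short for a tree, both sums vanish and the value of the negative power is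
-- irrelevant. Otherwise the integer exponent is the natural number `k` of elements left out.
concentrated-^ℤ : ∀ n (xs : List A) (g : List A → ℚ) (r : ℚ) → ConcentratedAt n g →
  subsetSum xs g 𝟏 (λ _ → r) ≡ subsetSum xs g 𝟏 𝟏 * r ^ℤ (ℤ.+ length xs ℤ.- ℤ.+ n ℤ.+ ℤ.+ 1)
concentrated-^ℤ n xs g r conc = cases (n ℕ.≤? suc (length xs))
  where
  cases : Dec (n ℕ.≤ suc (length xs)) → _
  cases (no n≰) =
    trans (concentrated-short xs g 𝟏 (λ _ → r) conc (ℕ.≰⇒> n≰))
          (sym (trans (cong (_* r ^ℤ (ℤ.+ length xs ℤ.- ℤ.+ n ℤ.+ ℤ.+ 1)) (concentrated-short xs g 𝟏 𝟏 conc (ℕ.≰⇒> n≰)))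
                      (*-zeroˡ (r ^ℤ (ℤ.+ length xs ℤ.- ℤ.+ n ℤ.+ ℤ.+ 1)))))
  cases (yes n≤) = trans (concentrated-power n k xs g r conc (sym (ℕ.m+[n∸m]≡n n≤)))
                         (cong (λ z → subsetSum xs g 𝟏 𝟏 * r ^ℤ z) exponent)
    where
    k = suc (length xs) ℕ.∸ n
    exponent : ℤ.+ k ≡ ℤ.+ length xs ℤ.- ℤ.+ n ℤ.+ ℤ.+ 1
    exponent = begin
      ℤ.+ k                                          ≡⟨ sym (ℤ.⊖-≥ n≤) ⟩
      suc (length xs) ℤ.⊖ n                          ≡⟨ sym (ℤ.m-n≡m⊖n (suc (length xs)) n) ⟩
      ℤ.+ 1 ℤ.+ ℤ.+ length xs ℤ.- ℤ.+ n             ≡⟨ ℤ.+-assoc (ℤ.+ 1) (ℤ.+ length xs) (ℤ.- ℤ.+ n) ⟩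
      ℤ.+ 1 ℤ.+ (ℤ.+ length xs ℤ.- ℤ.+ n)           ≡⟨ ℤ.+-comm (ℤ.+ 1) (ℤ.+ length xs ℤ.- ℤ.+ n) ⟩
      ℤ.+ length xs ℤ.- ℤ.+ n ℤ.+ ℤ.+ 1             ∎
      where open ≡-Reasoning

contracts-length : ∀ (c : Fin n → Fin n) k es → contractsToPoint c k es ≡ true → suc (length es) ≡ k
contracts-length c (suc zero) [] h = refl
contracts-length c k ((a , b) ∷ es) h with does (c a Fin.≟ c b)
contracts-length c k ((a , b) ∷ es) () | true
contracts-length c (suc k) ((a , b) ∷ es) h | false = cong suc (contracts-length _ k es h)
-- From 0 the truncated subtraction stays at 0, so the count can never end at 1.
contracts-length c zero ((a , b) ∷ es) h | false with () ← contracts-length _ zero es h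

trees-concentrated : (ends : A → Fin n × Fin n) → ConcentratedAt n (𝟙 ∘ contractsToPoint id n ∘ map ends)
trees-concentrated {n = n} ends s = dichotomy (contractsToPoint id n (map ends s)) refl
  where
  dichotomy : ∀ b → contractsToPoint id n (map ends s) ≡ b → 𝟙 b ≡ 0ℚ ⊎ suc (length s) ≡ n
  dichotomy false _ = inj₁ refl
  dichotomy true  h = inj₂ (trans (cong suc (sym (length-map ends s))) (contracts-length id n (map ends s) h))

-- The function `h` takes the place of a list so that an induction on `k` can pass to `h ∘ suc`.
-- With `id` it lists the chosen positions, with `lookup` it is `select`.
chosen : ∀ {k} → (Fin k → A) → Subset k → List A
chosen h []            = []
chosen h (inside  ∷ s) = h zero ∷ chosen (h ∘ suc) s
chosen h (outside ∷ s) = chosen (h ∘ suc) s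

chosen-map : ∀ {k} (f : A → B) (h : Fin k → A) s → map f (chosen h s) ≡ chosen (f ∘ h) s
chosen-map f h []            = refl
chosen-map f h (inside  ∷ s) = cong (f (h zero) ∷_) (chosen-map f (h ∘ suc) s)
chosen-map f h (outside ∷ s) = chosen-map f (h ∘ suc) s

chosen-lookup : (xs : List A) (s : Subset (length xs)) → chosen (lookup xs) s ≡ select xs s
chosen-lookup []       []            = refl
chosen-lookup (x ∷ xs) (inside  ∷ s) = cong (x ∷_) (chosen-lookup xs s)
chosen-lookup (x ∷ xs) (outside ∷ s) = chosen-lookup xs s

length-chosen : ∀ {k} (h : Fin k → A) s → length (chosen h s) ≡ ∣ s ∣
length-chosen h []            = refl
length-chosen h (inside  ∷ s) = cong suc (length-chosen (h ∘ suc) s)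
length-chosen h (outside ∷ s) = length-chosen (h ∘ suc) s

prod-filter : {R : A → Set} (R? : ∀ x → Dec (R x)) (xs : List A) (f : A → ℚ) →
              productOver (filter R? xs) f ≡ productOver xs (λ x → if-then (does (R? x)) (f x))
prod-filter R? []       f = refl
prod-filter R? (x ∷ xs) f with does (R? x)
... | true  = cong (f x *_) (prod-filter R? xs f)
... | false = trans (prod-filter R? xs f) (sym (*-identityˡ _))

outsideProduct : ∀ {k} → (Fin k → ℚ) → Subset k → ℚ
outsideProduct y s = productOver (filter (λ e → ¬? (e ∈? s)) (allFin _)) y

outsideProduct-∷ : ∀ {k} (y : Fin (suc k) → ℚ) o s →
  outsideProduct y (o ∷ s) ≡ if-then (not o) (y zero) * outsideProduct (y ∘ suc) s
outsideProduct-∷ {k} y o s = trans (prod-filter (λ e → ¬? (e ∈? (o ∷ s))) (allFin (suc k)) y)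
  (cong₂ _*_ (first o)
    (trans (cong (λ es → productOver es (λ e → if-then (does (¬? (e ∈? (o ∷ s)))) (y e))) (sym (map-tabulate id suc)))
    (trans (prod-map (allFin k) suc _) (sym (prod-filter (λ e → ¬? (e ∈? s)) (allFin k) (y ∘ suc))))))
  where
  first : ∀ o → if-then (does (¬? (zero ∈? (o ∷ s)))) (y zero) ≡ if-then (not o) (y zero)
  first true  = refl
  first false = refl

subsets-subsetSum : ∀ {k} (h : Fin k → A) (g : List A → ℚ) (y : A → ℚ) →
  sumOver (allSubsets k) (λ s → g (chosen h s) * outsideProduct (y ∘ h) s) ≡ subsetSum (tabulate h) g 𝟏 y
subsets-subsetSum {k = zero}  h g y = trans (+-identityʳ _) (*-identityʳ (g []))
subsets-subsetSum {k = suc k} h g y =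
  trans (sum-++ (map (inside ∷_) (allSubsets k)) (map (outside ∷_) (allSubsets k)) F)
  (cong₂ _+_ (part inside (g ∘ (h zero ∷_)) (λ _ → refl)) (part outside g (λ _ → refl)))
  where
  F : Subset (suc k) → ℚ
  F s = g (chosen h s) * outsideProduct (y ∘ h) s
  part : ∀ o g′ → (∀ s → g (chosen h (o ∷ s)) ≡ g′ (chosen (h ∘ suc) s)) →
         sumOver (map (o ∷_) (allSubsets k)) F ≡ if-then (not o) (y (h zero)) * subsetSum (tabulate (h ∘ suc)) g′ 𝟏 y
  part o g′ g≡ = trans (sum-map (allSubsets k) (o ∷_) F)
    (trans (sum-cong′ (allSubsets k) λ s →
              trans (cong₂ _*_ (g≡ s) (outsideProduct-∷ (y ∘ h) o s))
                    (solve 3 (λ a b c → a :* (b :* c) := b :* (a :* c)) refl (g′ (chosen (h ∘ suc) s)) c₀ (outsideProduct (y ∘ h ∘ suc) s)))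
    (trans (sum-*ˡ c₀ (allSubsets k) _) (cong (c₀ *_) (subsets-subsetSum (h ∘ suc) g′ y))))
    where c₀ = if-then (not o) (y (h zero))

-- Clearing the inverses leaves the factor `r + y e` for every edge outside a tree. Expanding it,
-- `E′` collects the tree and the edges that contribute `r`; for fixed `E′` the trees inside it
-- number `t (spanning G E′)`, and all give the same power of `r`.
expand-trees : ∀ G (r : ℚ) (y : E G → ℚ) → (∀ e → 0ℚ < r + y e) →
  productOver (allFin (size G)) (λ e → r + y e)
    * tau (network (lookup (edges G)) (λ e → inv (r + y e)) (allFin (size G))) (vertices G) ≡
  sumOver (edgeSets G) (λ E′ → fromℕ (t (spanning G E′)) * r ^ℤ (ℤ.+ ∣ E′ ∣ ℤ.- ℤ.+ order G ℤ.+ ℤ.+ 1) * outsideProduct y E′)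
expand-trees G r y pos = begin
  productOver es ρ * tau (network ends (inv ∘ ρ) es) (vertices G)
    ≡⟨ cong (productOver es ρ *_) (sym (weighted-spanning-trees ends (λ e → ℚ.<⇒≤ (inv-positive (pos e))) es)) ⟩
  productOver es ρ * subsetSum es g (inv ∘ ρ) 𝟏
    ≡⟨ subsetSum-inv es g ρ (λ e → >0⇒≢0 (pos e)) ⟩
  subsetSum es g 𝟏 ρ
    ≡⟨ sym (subsetSum-nested es g (λ _ → r) y) ⟩
  subsetSum es (λ s → subsetSum s g 𝟏 (λ _ → r)) 𝟏 y
    ≡⟨ sym (subsets-subsetSum id (λ s → subsetSum s g 𝟏 (λ _ → r)) y) ⟩
  sumOver (edgeSets G) (λ E′ → subsetSum (chosen id E′) g 𝟏 (λ _ → r) * outsideProduct y E′)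
    ≡⟨ sum-cong′ (edgeSets G) (λ E′ → cong (_* outsideProduct y E′) (per-set E′)) ⟩
  sumOver (edgeSets G) (λ E′ → fromℕ (t (spanning G E′)) * r ^ℤ (ℤ.+ ∣ E′ ∣ ℤ.- ℤ.+ order G ℤ.+ ℤ.+ 1) * outsideProduct y E′) ∎
  where
  open ≡-Reasoning
  es = allFin (size G)
  ends = lookup (edges G)
  ρ : E G → ℚ
  ρ e = r + y e
  g : List (E G) → ℚ
  g = 𝟙 ∘ contractsToPoint id (order G) ∘ map ends
  per-set : ∀ E′ → subsetSum (chosen id E′) g 𝟏 (λ _ → r) ≡
                   fromℕ (t (spanning G E′)) * r ^ℤ (ℤ.+ ∣ E′ ∣ ℤ.- ℤ.+ order G ℤ.+ ℤ.+ 1)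
  per-set E′ = trans (concentrated-^ℤ (order G) (chosen id E′) g r (trees-concentrated ends))
    (cong₂ (λ a k → a * r ^ℤ (ℤ.+ k ℤ.- ℤ.+ order G ℤ.+ ℤ.+ 1))
      (sym (trans (fromℕ-t (spanning G E′))
           (trans (cong (λ xs → subsetSum xs (𝟙 ∘ contractsToPoint id (order G)) 𝟏 𝟏)
                        (sym (trans (chosen-map ends id E′) (chosen-lookup (edges G) E′))))
                  (subsetSum-map (chosen id E′) ends (𝟙 ∘ contractsToPoint id (order G))))))
      (length-chosen id E′))

-- Positive degrees and the edgeless case.

degree-positive : ∀ G v e → Incident G v e → degree G v ≢ 0
degree-positive G v e v∈e eq = ℕ.<⇒≢ (filter-some (incident? G v) (lose (∈-allFin e) v∈e)) (sym eq)

-- A walk from `v` to an end of `e` either starts with an edge at `v` or is empty, in which case `e`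
-- itself is at `v`.
connected-degree : ∀ G → Connected G → E G → ∀ v → degree G v ≢ 0
connected-degree G (_ , conn) e v with conn v (end₁ G e)
... | []                 , []    = degree-positive G v e (inj₁ refl)
... | (f , false) ∷ _ , _ ∷ _ = degree-positive G v f (inj₁ refl)
... | (f , true)  ∷ _ , _ ∷ _ = degree-positive G v f (inj₂ refl)

module _ (G : Graph) (connected : Connected G) (r : ℕ) where

  private
    resistance : E G → ℚ
    resistance e = inv (fromℕ (degree G (end₁ G e))) + inv (fromℕ (degree G (end₂ G e)))

    summand : EdgeSet G → ℚ
    summand E′ = fromℕ (t (spanning G E′)) * fromℕ r ^ℤ (ℤ.+ ∣ E′ ∣ ℤ.- ℤ.+ order G ℤ.+ ℤ.+ 1) * outsideProduct resistance E′

    degreeProduct : ℚ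
    degreeProduct = productOver (vertices G) (λ v → fromℕ (degree G v) ^ℤ (ℤ.+ degree G v ℤ.- ℤ.+ 2))

  subdivision-formula : E G → fromℕ (t (L (S r G))) ≡ degreeProduct * sumOver (edgeSets G) summand
  subdivision-formula e = trans
    (Subdivision.subdivision-trees r G (λ z → fromℕ (degree (S r G) z)) (λ _ → refl) (λ v → fromℕ (degree G v)) (λ _ → refl)
       degree≢0 (end₁ G e))
    (cong (degreeProduct *_) (expand-trees G (fromℕ r) resistance λ f →
       -- The strict inequality comes from the inverse degrees, since `r` may be 0.
       ℚ.+-mono-≤-< (fromℕ-nonneg r) (+-positive (inv-positive (degree>0 (end₁ G f))) (inv-positive (degree>0 (end₂ G f))))))
    where
    degree≢0 : ∀ v → fromℕ (degree G v) ≢ 0ℚ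
    degree≢0 v eq = connected-degree G connected e v (fromℕ-injective {degree G v} {0} eq)
    degree>0 : ∀ v → 0ℚ < fromℕ (degree G v)
    degree>0 v = ≥0∧≢0⇒>0 (fromℕ-nonneg (degree G v)) (degree≢0 v)

-- Without edges `L (S r G)` has no vertices and hence no spanning tree. On the right a vertex of
-- degree 0 gives `inv 0ℚ ^ 2`, which is 0 by the convention for the inverse, so the sum can stay an
-- arbitrary `x`.
edgeless-formula : ∀ n → ℕ.NonZero n → ∀ r x → let G = record { order = n ; edges = [] ; loopless = [] } in
  fromℕ (t (L (S r G))) ≡ productOver (vertices G) (λ v → fromℕ (degree G v) ^ℤ (ℤ.+ degree G v ℤ.- ℤ.+ 2)) * x
edgeless-formula (suc n) _ r x = sym (trans (cong (_* x) (*-zeroˡ rest)) (*-zeroˡ x))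
  where
  rest : ℚ
  rest = productOver (tabulate {n = n} suc) (λ _ → inv 0ℚ ^ 2)

open import Data.Integer as ℤ using (+_)

theorem1p1 : (G : Graph) → Connected G → (r : ℕ) →
    fromℕ (t (L (S r G))) ≡
      (∏[ v ← vertices G ] (fromℕ (degree G v) ^ℤ (+ degree G v ℤ.- + 2)))
      * (∑[ E′ ← edgeSets G ]
          (fromℕ (t (spanning G E′))
           * fromℕ r ^ℤ (+ ∣ E′ ∣ ℤ.- + order G ℤ.+ + 1)
           * (∏[ e ← edgesOutside G E′ ]
               (inv (fromℕ (degree G (end₁ G e))) + inv (fromℕ (degree G (end₂ G e)))))))
theorem1p1 record { order = n ; edges = [] ; loopless = [] } connected r = edgeless-formula n (proj₁ connected) r _
theorem1p1 G@record { edges = _ ∷ _ } connected r = subdivision-formula G connected r zero
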